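{- Let $p \geq 7$ be a prime. Then \begin{align*} W_p &\equiv -4\overline{B}_1 + 6\overline{B}_2 - 4\overline{B}_3 + \overline{B}_4 + p\left(-3\overline{B}_1^2 + 4\overline{B}_1\overline{B}_2 - \overline{B}_1\overline{B}_3 - \tfrac{1}{2}\overline{B}_2^2\right)\\ &\quad + p^2\left(-\tfrac{2}{3}\overline{B}_1^3 + \tfrac{1}{2}\overline{B}_1^2\overline{B}_2 - \tfrac{2}{3}\overline{B}_{1,2} + \tfrac{1}{3}\overline{B}_{2,2}\right) - p^3\left(\tfrac{1}{24}\overline{B}_1^4 + \tfrac{1}{3}\overline{B}_1\overline{B}_{1,2}\right) \pmod{p^4}. \end{align*} Equivalently, $(p-1)! \equiv -1 + p\,W_p \pmod{p^5}$ with $W_p$ replaced by the right-hand side above.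
   Context: The Bernoulli numbers $B_n$ are defined by $\frac{t}{e^t-1}=\sum_{n\ge0}B_n\frac{t^n}{n!}$. For a prime $p$, the Wilson quotient is $W_p = \frac{(p-1)!+1}{p}$. For $n\ge1$ define \[ \overline{B}_n = \frac{B_{n(p-1)} + \frac{1}{p} - 1}{n(p-1)}, \qquad \overline{B}_{n,2} = \frac{B_{n(p-1)-2}}{n(p-1)-2}. \] These are $p$-integral rationals; a congruence modulo $p^r$ between $p$-integral rationals means their difference lies in $p^r\mathbb{Z}_p$. -}

module Defs where

open import Data.Nat as ℕ using (ℕ; zero; suc; _∸_; _^_; _!)
open import Data.Nat.Combinatorics using (_C_)
open import Data.Nat.Divisibility using (_∣_)
open import Data.Integer as ℤ using (ℤ; +_; ∣_∣)
open import Data.Rational using (ℚ; _+_; _*_; _-_; -_; _/_; ↥_; ↧ₙ_; 0ℚ; 1ℚ)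
open import Data.List using (List; []; _∷_; _++_; zipWith; upTo; foldr)
open import Data.Product using (_×_)
open import Relation.Nullary using (¬_)

-- the rational 1/n, totalised by 1/0 = 0 (only ever used with n ≠ 0)
inv : ℕ → ℚ
inv zero    = 0ℚ
inv (suc n) = + 1 / suc n

ℕ→ℚ : ℕ → ℚ
ℕ→ℚ n = + n / 1

ℤ→ℚ : ℤ → ℚ
ℤ→ℚ z = z / 1

sumℚ : List ℚ → ℚ
sumℚ = foldr _+_ 0ℚ

-- [B_0, B_1, ..., B_n] via the recurrence  sum_{k=0}^{m} C(m+1,k) B_k = 0  (m ≥ 1),
-- equivalent to t/(e^t - 1) = sum B_n t^n / n!  (so B_1 = -1/2)
bernoullis : ℕ → List ℚ
bernoullis zero    = 1ℚ ∷ []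
bernoullis (suc n) = bs ++ (next ∷ [])
  where
  bs : List ℚ
  bs = bernoullis n
  next : ℚ
  next = - (inv (suc (suc n)) * sumℚ (zipWith (λ k b → ℕ→ℚ (suc (suc n) C k) * b) (upTo (suc n)) bs))

nth : List ℚ → ℕ → ℚ
nth []       _       = 0ℚ
nth (x ∷ _)  zero    = x
nth (_ ∷ xs) (suc i) = nth xs i

B : ℕ → ℚ
B n = nth (bernoullis n) n

W : ℕ → ℚ
W p = ℕ→ℚ ((p ∸ 1) ! ℕ.+ 1) * inv p

Bbar : ℕ → ℕ → ℚ
Bbar p n = (B (n ℕ.* (p ∸ 1)) + inv p - 1ℚ) * inv (n ℕ.* (p ∸ 1))

Bbar2 : ℕ → ℕ → ℚ
Bbar2 p n = B (n ℕ.* (p ∸ 1) ∸ 2) * inv (n ℕ.* (p ∸ 1) ∸ 2)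

-- x ≡ y (mod p^r) for rationals: x - y (in lowest terms) has numerator
-- divisible by p^r and denominator prime to p, i.e. x - y ∈ p^r ℤ_p
_≡_[modℚ_^_] : ℚ → ℚ → ℕ → ℕ → Set
x ≡ y [modℚ p ^ r ] = ((p ^ r) ∣ ∣ ↥ (x - y) ∣) × ¬ (p ∣ ↧ₙ (x - y))

rhs : ℕ → ℚ
rhs p = (- (ℕ→ℚ 4 * b1) + ℕ→ℚ 6 * b2 - ℕ→ℚ 4 * b3 + b4)
        + P * (- (ℕ→ℚ 3 * b1 * b1) + ℕ→ℚ 4 * b1 * b2 - b1 * b3 - inv 2 * b2 * b2)
        + P * P * (- (ℕ→ℚ 2 * inv 3 * b1 * b1 * b1) + inv 2 * b1 * b1 * b2
                   - ℕ→ℚ 2 * inv 3 * b12 + inv 3 * b22)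
        - P * P * P * (inv 24 * b1 * b1 * b1 * b1 + inv 3 * b1 * b12)
  where
  b1 b2 b3 b4 b12 b22 P : ℚ
  b1 = Bbar p 1
  b2 = Bbar p 2
  b3 = Bbar p 3
  b4 = Bbar p 4
  b12 = Bbar2 p 1
  b22 = Bbar2 p 2
  P = ℕ→ℚ p

{-# OPTIONS --safe #-}
-- Let q_a = (a^(p-1) - 1)/p. Multiplying 1 + p q_a = a^(p-1) over a < p gives (p-1)!^(p-1) = (1 - p W)^(p-1), so
-- log(1 - p W) = (p - 1)^(-1) Σ_a log(1 + p q_a) is, modulo p^5, a combination of the moments Σ_a q_a^k with k ≤ 4.
-- Faulhaber's formula modulo p^5 expresses Σ_a a^(n(p-1)) = Σ_a (1 + p q_a)^n through B_{n(p-1)} and B_{n(p-1)-2};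
-- hence, up to the terms in B_{n(p-1)-2}, (p - 1) times the n-th value of B̄ is a cubic polynomial in n whose
-- extrapolation to n = 0 is the wanted logarithm. The values B_{n(p-1)-2}/(n(p-1)-2) with n = 3, 4 are eliminated by
-- Kummer's congruence modulo p^2, and W is recovered by exponentiating.
module Submission where

open import Defs
open import Data.Nat as ℕ using (ℕ; zero; suc; _≤_; _<_; z≤n; s≤s; _!)
open import Data.Nat.Primality using (Prime; euclidsLemma; prime⇒nonZero; prime⇒irreducible)
open import Data.Nat.Combinatorics using (_C_; nC1≡n; nCn≡1; nCk≡nC[n∸k]; k>n⇒nCk≡0; nCk+nC[k+1]≡[n+1]C[k+1])
open import Data.Nat.Coprimality using (Coprime; recompute)
open import Data.Nat.Divisibility
open import Data.Nat.DivMod using (m≡m%n+[m/n]*n; m%n<n)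
import Data.Nat.Properties as ℕₚ
open import Data.Nat.Solver using () renaming (module +-*-Solver to NS)
open import Data.Integer as ℤ using (ℤ; +_; -[1+_])
import Data.Integer.Properties as ℤₚ
open import Data.Rational using (ℚ; mkℚ; _+_; _*_; _-_; -_; ↥_; ↧_; ↧ₙ_; 0ℚ; 1ℚ; toℚᵘ)
open import Data.Rational.Properties
open import Data.Rational.Unnormalised as ℚᵘ using (mkℚᵘ; *≡*) renaming (_≃_ to _≃ᵘ_)
import Data.Rational.Unnormalised.Properties as ℚᵘₚ
open import Algebra.Bundles using (CommutativeRing)
open import Algebra.Properties.CommutativeSemiring.Exp (CommutativeRing.commutativeSemiring +-*-commutativeRing)
open import Algebra.Properties.Group +-0-group using (inverseˡ-unique)
import Algebra.Solver.Ring as RingSolver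
open import Algebra.Solver.Ring.AlmostCommutativeRing using (fromCommutativeRing; _-Raw-AlmostCommutative⟶_)
open import Data.Bool using (T)
open import Data.Empty using (⊥-elim)
open import Data.Fin using (#_) renaming (zero to fz; suc to fs)
open import Data.List using ([]; _∷_; _++_; length; zipWith; upTo; applyUpTo)
open import Data.List.Properties using (length-++; applyUpTo-∷ʳ)
open import Data.Maybe as Maybe using (Maybe; just; is-just; to-witness-T)
open import Data.Product using (∃; _,_; _×_; proj₁; proj₂)
open import Data.Sum using (inj₁; inj₂; [_,_]′)
open import Data.Vec using (Vec; []; _∷_; lookup)
open import Data.Vec.Relation.Unary.All using (All; []; _∷_)
open import Function using (_∘_)
open import Relation.Binary.PropositionalEquality hiding ([_])
open import Relation.Nullary using (¬_; yes; no)
open import Relation.Nullary.Decidable using (dec⇒maybe)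

-- The coefficients -4, 6, -4, 1 come from f(0) = 4f(1) - 6f(2) + 4f(3) - f(4) for cubic f; the sign
-- changes because log(1 - pW)/p begins with -W. The integrality of the Bernoulli numbers of index
-- n(p-1) - 2 and n(p-1) - 4, and Kummer's congruence, all come from one device: doubling the
-- residues modulo p or p^2 (Voronoi's congruence with multiplier 2). It asks that p not divide 2^k
-- - 1, which for these indices k reduces to p not dividing 2^2 - 1 = 3 and 2^4 - 1 = 15. Here p ≥ 7
-- enters; the same bound keeps p from dividing n(p-1) - 2 for n ≤ 4 and makes the tail of
-- Faulhaber's formula vanish modulo p^5. The obstacle is denominators: the final congruence is a
-- polynomial one with rational coefficients, to be checked with integer ones. Rescaling the moments
-- by 12(p-1) and the Bernoulli quotients by 6 turns everything into integer polynomials in p and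
-- six p-integral unknowns, where a congruence modulo p^4 is read off the coefficients of 1, p, p^2,
-- p^3.

-- Integers inside the rationals, and reciprocals

private
  /1ᵘ : ∀ z → toℚᵘ (ℤ→ℚ z) ≃ᵘ mkℚᵘ z 0
  /1ᵘ z = toℚᵘ-fromℚᵘ (mkℚᵘ z 0)

ℤ→ℚ-+ : ∀ a b → ℤ→ℚ (a ℤ.+ b) ≡ ℤ→ℚ a + ℤ→ℚ b
ℤ→ℚ-+ a b = toℚᵘ-injective (begin
  toℚᵘ (ℤ→ℚ (a ℤ.+ b))            ≈⟨ /1ᵘ (a ℤ.+ b) ⟩
  mkℚᵘ (a ℤ.+ b) 0                ≈⟨ *≡* (cong (ℤ._* + 1) (sym (cong₂ ℤ._+_ (ℤₚ.*-identityʳ a) (ℤₚ.*-identityʳ b)))) ⟩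
  mkℚᵘ a 0 ℚᵘ.+ mkℚᵘ b 0          ≈⟨ ℚᵘₚ.+-cong (ℚᵘₚ.≃-sym (/1ᵘ a)) (ℚᵘₚ.≃-sym (/1ᵘ b)) ⟩
  toℚᵘ (ℤ→ℚ a) ℚᵘ.+ toℚᵘ (ℤ→ℚ b)  ≈⟨ toℚᵘ-homo-+ (ℤ→ℚ a) (ℤ→ℚ b) ⟨
  toℚᵘ (ℤ→ℚ a + ℤ→ℚ b)            ∎)
  where open ℚᵘₚ.≃-Reasoning

ℤ→ℚ-* : ∀ a b → ℤ→ℚ (a ℤ.* b) ≡ ℤ→ℚ a * ℤ→ℚ b
ℤ→ℚ-* a b = toℚᵘ-injective (begin
  toℚᵘ (ℤ→ℚ (a ℤ.* b))            ≈⟨ /1ᵘ (a ℤ.* b) ⟩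
  mkℚᵘ a 0 ℚᵘ.* mkℚᵘ b 0          ≈⟨ ℚᵘₚ.*-cong (ℚᵘₚ.≃-sym (/1ᵘ a)) (ℚᵘₚ.≃-sym (/1ᵘ b)) ⟩
  toℚᵘ (ℤ→ℚ a) ℚᵘ.* toℚᵘ (ℤ→ℚ b)  ≈⟨ toℚᵘ-homo-* (ℤ→ℚ a) (ℤ→ℚ b) ⟨
  toℚᵘ (ℤ→ℚ a * ℤ→ℚ b)            ∎)
  where open ℚᵘₚ.≃-Reasoning

ℤ→ℚ-injective : ∀ {a b} → ℤ→ℚ a ≡ ℤ→ℚ b → a ≡ b
ℤ→ℚ-injective {a} {b} eq with ℚᵘₚ.≃-trans (ℚᵘₚ.≃-sym (/1ᵘ a)) (ℚᵘₚ.≃-trans (toℚᵘ-cong eq) (/1ᵘ b))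
... | *≡* e = trans (sym (ℤₚ.*-identityʳ a)) (trans e (ℤₚ.*-identityʳ b))

ℤ→ℚ-neg : ∀ a → ℤ→ℚ (ℤ.- a) ≡ - ℤ→ℚ a
ℤ→ℚ-neg a = inverseˡ-unique (ℤ→ℚ (ℤ.- a)) (ℤ→ℚ a)
  (trans (sym (ℤ→ℚ-+ (ℤ.- a) a)) (cong ℤ→ℚ (ℤₚ.+-inverseˡ a)))

private
  ℤ→ℚ-morphism : CommutativeRing.rawRing ℤₚ.+-*-commutativeRing -Raw-AlmostCommutative⟶ fromCommutativeRing +-*-commutativeRing
  ℤ→ℚ-morphism = record
    { ⟦_⟧ = ℤ→ℚ ; +-homo = ℤ→ℚ-+ ; *-homo = ℤ→ℚ-* ; -‿homo = ℤ→ℚ-neg ; 0-homo = refl ; 1-homo = refl }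

  coefficient≟ : ∀ a b → Maybe (ℤ→ℚ a ≡ ℤ→ℚ b)
  coefficient≟ a b = Maybe.map (cong ℤ→ℚ) (dec⇒maybe (a ℤ.≟ b))

-- Integer coefficients, because normalising fractions with gcd makes the solver over ℚ impractically slow.
open RingSolver (CommutativeRing.rawRing ℤₚ.+-*-commutativeRing) (fromCommutativeRing +-*-commutativeRing)
  ℤ→ℚ-morphism coefficient≟ public

ℕ→ℚ-+ : ∀ m n → ℕ→ℚ (m ℕ.+ n) ≡ ℕ→ℚ m + ℕ→ℚ n
ℕ→ℚ-+ m n = ℤ→ℚ-+ (+ m) (+ n)

ℕ→ℚ-* : ∀ m n → ℕ→ℚ (m ℕ.* n) ≡ ℕ→ℚ m * ℕ→ℚ n
ℕ→ℚ-* m n = trans (cong ℤ→ℚ (ℤₚ.pos-* m n)) (ℤ→ℚ-* (+ m) (+ n))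

ℕ→ℚ-suc : ∀ n → ℕ→ℚ (suc n) ≡ 1ℚ + ℕ→ℚ n
ℕ→ℚ-suc = ℕ→ℚ-+ 1

ℕ→ℚ-^ : ∀ m n → ℕ→ℚ (m ℕ.^ n) ≡ ℕ→ℚ m ^ n
ℕ→ℚ-^ m zero    = refl
ℕ→ℚ-^ m (suc n) = trans (ℕ→ℚ-* m (m ℕ.^ n)) (cong (ℕ→ℚ m *_) (ℕ→ℚ-^ m n))

↧*≡↥ : ∀ c → ℕ→ℚ (↧ₙ c) * c ≡ ℤ→ℚ (↥ c)
↧*≡↥ c@(mkℚ _ _ _) = toℚᵘ-injective (begin
  toℚᵘ (ℕ→ℚ (↧ₙ c) * c)           ≈⟨ toℚᵘ-homo-* (ℕ→ℚ (↧ₙ c)) c ⟩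
  toℚᵘ (ℕ→ℚ (↧ₙ c)) ℚᵘ.* toℚᵘ c   ≈⟨ ℚᵘₚ.*-congʳ {toℚᵘ c} (/1ᵘ (↧ c)) ⟩
  mkℚᵘ (↧ c) 0 ℚᵘ.* toℚᵘ c        ≈⟨ *≡* (trans (cong (ℤ._* + 1) (ℤₚ.*-comm (↧ c) (↥ c))) (trans (ℤₚ.*-identityʳ _) (cong (λ z → ↥ c ℤ.* + z) (sym (ℕₚ.+-identityʳ (↧ₙ c)))))) ⟩
  mkℚᵘ (↥ c) 0                    ≈⟨ /1ᵘ (↥ c) ⟨
  toℚᵘ (ℤ→ℚ (↥ c))                ∎)
  where open ℚᵘₚ.≃-Reasoning

*-inv : ∀ n → n ≢ 0 → ℕ→ℚ n * inv n ≡ 1ℚ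
*-inv zero    n≢0 = ⊥-elim (n≢0 refl)
*-inv (suc n) _   = toℚᵘ-injective (begin
  toℚᵘ (ℕ→ℚ (suc n) * inv (suc n))          ≈⟨ toℚᵘ-homo-* (ℕ→ℚ (suc n)) (inv (suc n)) ⟩
  toℚᵘ (ℕ→ℚ (suc n)) ℚᵘ.* toℚᵘ (inv (suc n)) ≈⟨ ℚᵘₚ.*-cong (/1ᵘ (+ suc n)) (toℚᵘ-fromℚᵘ (mkℚᵘ (+ 1) n)) ⟩
  mkℚᵘ (+ suc n) 0 ℚᵘ.* mkℚᵘ (+ 1) n        ≈⟨ *≡* (trans (ℤₚ.*-identityʳ _) (trans (ℤₚ.*-comm (+ suc n) (+ 1)) (cong (λ z → + 1 ℤ.* + z) (sym (ℕₚ.+-identityʳ (suc n)))))) ⟩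
  toℚᵘ 1ℚ                                   ∎)
  where open ℚᵘₚ.≃-Reasoning

*-cancelˡ-ℕ→ℚ : ∀ n → n ≢ 0 → ∀ {x y} → ℕ→ℚ n * x ≡ ℕ→ℚ n * y → x ≡ y
*-cancelˡ-ℕ→ℚ n n≢0 {x} {y} e = trans (lem x) (trans (cong (inv n *_) e) (sym (lem y)))
  where
  lem : ∀ x → x ≡ inv n * (ℕ→ℚ n * x)
  lem x = begin
    x                       ≡⟨ *-identityˡ x ⟨
    1ℚ * x                  ≡⟨ cong (_* x) (*-inv n n≢0) ⟨
    ℕ→ℚ n * inv n * x       ≡⟨ solve 3 (λ a b c → a :* b :* c := b :* (a :* c)) refl (ℕ→ℚ n) (inv n) x ⟩
    inv n * (ℕ→ℚ n * x)     ∎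
    where open ≡-Reasoning

-- Finite sums

Σ< : ℕ → (ℕ → ℚ) → ℚ
Σ< zero    f = 0ℚ
Σ< (suc n) f = f 0 + Σ< n (f ∘ suc)

Σ-congˡ< : ∀ n {f g : ℕ → ℚ} → (∀ k → k < n → f k ≡ g k) → Σ< n f ≡ Σ< n g
Σ-congˡ< zero    e = refl
Σ-congˡ< (suc n) e = cong₂ _+_ (e 0 (s≤s z≤n)) (Σ-congˡ< n (λ k k<n → e (suc k) (s≤s k<n)))

Σ-congˡ : ∀ n {f g : ℕ → ℚ} → (∀ k → f k ≡ g k) → Σ< n f ≡ Σ< n g
Σ-congˡ n e = Σ-congˡ< n (λ k _ → e k)

Σ-+ : ∀ n f g → Σ< n (λ k → f k + g k) ≡ Σ< n f + Σ< n g
Σ-+ zero    f g = refl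
Σ-+ (suc n) f g = trans (cong (λ □ → (f 0 + g 0) + □) (Σ-+ n (f ∘ suc) (g ∘ suc)))
  (solve 4 (λ a b c d → a :+ b :+ (c :+ d) := a :+ c :+ (b :+ d)) refl (f 0) (g 0) (Σ< n (f ∘ suc)) (Σ< n (g ∘ suc)))

Σ-* : ∀ n x f → Σ< n (λ k → x * f k) ≡ x * Σ< n f
Σ-* zero    x f = sym (*-zeroʳ x)
Σ-* (suc n) x f = trans (cong (λ □ → (x * f 0) + □) (Σ-* n x (f ∘ suc))) (sym (*-distribˡ-+ x (f 0) (Σ< n (f ∘ suc))))

Σ-snoc : ∀ n f → Σ< (suc n) f ≡ Σ< n f + f n
Σ-snoc zero    f = trans (+-identityʳ (f 0)) (sym (+-identityˡ (f 0)))
Σ-snoc (suc n) f = trans (cong (λ □ → (f 0) + □) (Σ-snoc n (f ∘ suc))) (sym (+-assoc (f 0) (Σ< n (f ∘ suc)) (f (suc n))))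

-- Exponential generating functions and Bernoulli numbers

Seq : Set
Seq = ℕ → ℚ

shift : Seq → Seq
shift a n = a (suc n)

pow : ℚ → Seq
pow x n = x ^ n

-- The sequences with exponential generating functions 1 and t.
δ₀ δ₁ : Seq
δ₀ zero    = 1ℚ
δ₀ (suc _) = 0ℚ
δ₁ zero    = 0ℚ
δ₁ (suc n) = δ₀ n

infixl 7 _⋆_

-- The binomial convolution (a ⋆ b)_n = Σ_k C(n,k) a_k b_{n-k}, i.e. the product of exponential generating
-- functions, on which shift acts as a derivation.
_⋆_ : Seq → Seq → Seq
(a ⋆ b) zero    = a 0 * b 0
(a ⋆ b) (suc n) = (shift a ⋆ b) n + (a ⋆ shift b) n

⋆-cong : ∀ n {a a′ b b′ : Seq} → (∀ k → a k ≡ a′ k) → (∀ k → b k ≡ b′ k) → (a ⋆ b) n ≡ (a′ ⋆ b′) n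
⋆-cong zero    p q = cong₂ _*_ (p 0) (q 0)
⋆-cong (suc n) p q = cong₂ _+_ (⋆-cong n (p ∘ suc) q) (⋆-cong n p (q ∘ suc))

⋆-comm : ∀ n a b → (a ⋆ b) n ≡ (b ⋆ a) n
⋆-comm zero    a b = *-comm (a 0) (b 0)
⋆-comm (suc n) a b = trans (cong₂ _+_ (⋆-comm n (shift a) b) (⋆-comm n a (shift b)))
  (+-comm ((b ⋆ shift a) n) ((shift b ⋆ a) n))

⋆-distribʳ-+ : ∀ n a a′ b → ((λ k → a k + a′ k) ⋆ b) n ≡ (a ⋆ b) n + (a′ ⋆ b) n
⋆-distribʳ-+ zero    a a′ b = *-distribʳ-+ (b 0) (a 0) (a′ 0)
⋆-distribʳ-+ (suc n) a a′ b =
  trans (cong₂ _+_ (⋆-distribʳ-+ n (shift a) (shift a′) b) (⋆-distribʳ-+ n a a′ (shift b)))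
  (solve 4 (λ a b c d → a :+ b :+ (c :+ d) := a :+ c :+ (b :+ d)) refl
    ((shift a ⋆ b) n) ((shift a′ ⋆ b) n) ((a ⋆ shift b) n) ((a′ ⋆ shift b) n))

⋆-distribˡ-+ : ∀ n a b b′ → (a ⋆ (λ k → b k + b′ k)) n ≡ (a ⋆ b) n + (a ⋆ b′) n
⋆-distribˡ-+ n a b b′ = trans (⋆-comm n a _) (trans (⋆-distribʳ-+ n b b′ a) (cong₂ _+_ (⋆-comm n b a) (⋆-comm n b′ a)))

⋆-scaleˡ : ∀ n x a b → ((λ k → x * a k) ⋆ b) n ≡ x * (a ⋆ b) n
⋆-scaleˡ zero    x a b = *-assoc x (a 0) (b 0)
⋆-scaleˡ (suc n) x a b = trans (cong₂ _+_ (⋆-scaleˡ n x (shift a) b) (⋆-scaleˡ n x a (shift b)))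
  (sym (*-distribˡ-+ x _ _))

⋆-scaleʳ : ∀ n x a b → (a ⋆ (λ k → x * b k)) n ≡ x * (a ⋆ b) n
⋆-scaleʳ n x a b = trans (⋆-comm n a _) (trans (⋆-scaleˡ n x b a) (cong (x *_) (⋆-comm n b a)))

⋆-assoc : ∀ n a b c → ((a ⋆ b) ⋆ c) n ≡ (a ⋆ (b ⋆ c)) n
⋆-assoc zero    a b c = *-assoc (a 0) (b 0) (c 0)
⋆-assoc (suc n) a b c = begin
  ((λ k → (shift a ⋆ b) k + (a ⋆ shift b) k) ⋆ c) n + ((a ⋆ b) ⋆ shift c) n
    ≡⟨ cong (_+ ((a ⋆ b) ⋆ shift c) n) (⋆-distribʳ-+ n (shift a ⋆ b) (a ⋆ shift b) c) ⟩
  ((shift a ⋆ b) ⋆ c) n + ((a ⋆ shift b) ⋆ c) n + ((a ⋆ b) ⋆ shift c) n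
    ≡⟨ cong₂ _+_ (cong₂ _+_ (⋆-assoc n (shift a) b c) (⋆-assoc n a (shift b) c)) (⋆-assoc n a b (shift c)) ⟩
  (shift a ⋆ (b ⋆ c)) n + (a ⋆ (shift b ⋆ c)) n + (a ⋆ (b ⋆ shift c)) n
    ≡⟨ +-assoc ((shift a ⋆ (b ⋆ c)) n) _ _ ⟩
  (shift a ⋆ (b ⋆ c)) n + ((a ⋆ (shift b ⋆ c)) n + (a ⋆ (b ⋆ shift c)) n)
    ≡⟨ cong (λ □ → ((shift a ⋆ (b ⋆ c)) n) + □) (⋆-distribˡ-+ n a (shift b ⋆ c) (b ⋆ shift c)) ⟨
  (shift a ⋆ (b ⋆ c)) n + (a ⋆ shift (b ⋆ c)) n ∎
  where open ≡-Reasoning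

-- `pow x` has generating function e^(xt), so this is e^(xt) e^(yt) = e^((x+y)t).
pow-⋆ : ∀ n x y → (pow x ⋆ pow y) n ≡ (x + y) ^ n
pow-⋆ zero    x y = refl
pow-⋆ (suc n) x y = begin
  ((λ k → x * pow x k) ⋆ pow y) n + (pow x ⋆ (λ k → y * pow y k)) n
    ≡⟨ cong₂ _+_ (⋆-scaleˡ n x (pow x) (pow y)) (⋆-scaleʳ n y (pow x) (pow y)) ⟩
  x * (pow x ⋆ pow y) n + y * (pow x ⋆ pow y) n
    ≡⟨ *-distribʳ-+ ((pow x ⋆ pow y) n) x y ⟨
  (x + y) * (pow x ⋆ pow y) n
    ≡⟨ cong (λ □ → ((x + y)) * □) (pow-⋆ n x y) ⟩
  (x + y) * (x + y) ^ n ∎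
  where open ≡-Reasoning

-- The substitution of xt for t in the generating function.
dilate : ℚ → Seq → Seq
dilate x a k = x ^ k * a k

dilate-⋆ : ∀ n x a b → (dilate x a ⋆ dilate x b) n ≡ x ^ n * (a ⋆ b) n
dilate-⋆ zero    x a b = solve 2 (λ a b → con (+ 1) :* a :* (con (+ 1) :* b) := con (+ 1) :* (a :* b)) refl (a 0) (b 0)
dilate-⋆ (suc n) x a b = begin
  (shift (dilate x a) ⋆ dilate x b) n + (dilate x a ⋆ shift (dilate x b)) n
    ≡⟨ cong₂ _+_ (⋆-cong n (λ k → *-assoc x (x ^ k) (a (suc k))) (λ _ → refl))
                 (⋆-cong n (λ _ → refl) (λ k → *-assoc x (x ^ k) (b (suc k)))) ⟩
  ((λ k → x * dilate x (shift a) k) ⋆ dilate x b) n + (dilate x a ⋆ (λ k → x * dilate x (shift b) k)) n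
    ≡⟨ cong₂ _+_ (⋆-scaleˡ n x (dilate x (shift a)) (dilate x b)) (⋆-scaleʳ n x (dilate x a) (dilate x (shift b))) ⟩
  x * (dilate x (shift a) ⋆ dilate x b) n + x * (dilate x a ⋆ dilate x (shift b)) n
    ≡⟨ cong₂ (λ u v → x * u + x * v) (dilate-⋆ n x (shift a) b) (dilate-⋆ n x a (shift b)) ⟩
  x * (x ^ n * (shift a ⋆ b) n) + x * (x ^ n * (a ⋆ shift b) n)
    ≡⟨ solve 4 (λ x y u v → x :* (y :* u) :+ x :* (y :* v) := x :* y :* (u :+ v)) refl x (x ^ n) ((shift a ⋆ b) n) ((a ⋆ shift b) n) ⟩
  x * x ^ n * ((shift a ⋆ b) n + (a ⋆ shift b) n) ∎
  where open ≡-Reasoning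

⋆-zeroˡ : ∀ n b → ((λ _ → 0ℚ) ⋆ b) n ≡ 0ℚ
⋆-zeroˡ zero    b = *-zeroˡ (b 0)
⋆-zeroˡ (suc n) b = cong₂ _+_ (⋆-zeroˡ n b) (⋆-zeroˡ n (shift b))

δ₀-⋆ : ∀ n b → (δ₀ ⋆ b) n ≡ b n
δ₀-⋆ zero    b = *-identityˡ (b 0)
δ₀-⋆ (suc n) b = trans (cong₂ _+_ (⋆-zeroˡ n b) (δ₀-⋆ n (shift b))) (+-identityˡ (b (suc n)))

δ₁-⋆ : ∀ n b → (δ₁ ⋆ b) (suc n) ≡ ℕ→ℚ (suc n) * b n
δ₁-⋆ zero    b = solve 2 (λ x y → con (+ 1) :* x :+ con (+ 0) :* y := con (+ 1) :* x) refl (b 0) (b 1)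
δ₁-⋆ (suc n) b = begin
  (δ₀ ⋆ b) (suc n) + (δ₁ ⋆ shift b) (suc n)  ≡⟨ cong₂ _+_ (δ₀-⋆ (suc n) b) (δ₁-⋆ n (shift b)) ⟩
  b (suc n) + ℕ→ℚ (suc n) * b (suc n)        ≡⟨ solve 2 (λ c x → x :+ c :* x := (con (+ 1) :+ c) :* x) refl (ℕ→ℚ (suc n)) (b (suc n)) ⟩
  (1ℚ + ℕ→ℚ (suc n)) * b (suc n)             ≡⟨ cong (_* b (suc n)) (ℕ→ℚ-suc (suc n)) ⟨
  ℕ→ℚ (suc (suc n)) * b (suc n)              ∎
  where open ≡-Reasoning

choose : ℕ → ℕ → ℚ
choose n k = ℕ→ℚ (n C k)

choose-pascal : ∀ n k → choose (suc n) (suc k) ≡ choose n k + choose n (suc k)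
choose-pascal n k = trans (cong ℕ→ℚ (sym (nCk+nC[k+1]≡[n+1]C[k+1] n k))) (ℕ→ℚ-+ (n C k) (n C suc k))

choose-above : ∀ n → choose n (suc n) ≡ 0ℚ
choose-above n = cong ℕ→ℚ (k>n⇒nCk≡0 (ℕₚ.n<1+n n))

choose-absorb : ∀ n k → ℕ→ℚ (suc k) * choose (suc n) (suc k) ≡ ℕ→ℚ (suc n) * choose n k
choose-absorb n       zero    = trans (*-identityˡ _) (trans (cong ℕ→ℚ (nC1≡n (suc n))) (sym (*-identityʳ _)))
choose-absorb zero    (suc k) = trans (cong (ℕ→ℚ (suc (suc k)) *_) (cong ℕ→ℚ (k>n⇒nCk≡0 {1} {suc (suc k)} (s≤s (s≤s z≤n)))))
  (trans (*-zeroʳ (ℕ→ℚ (suc (suc k)))) (sym (trans (cong (1ℚ *_) (cong ℕ→ℚ (k>n⇒nCk≡0 {0} {suc k} (s≤s z≤n)))) (*-zeroʳ 1ℚ))))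
choose-absorb (suc n) (suc k) = begin
  ℕ→ℚ (suc (suc k)) * choose (suc (suc n)) (suc (suc k))
    ≡⟨ cong₂ _*_ (ℕ→ℚ-suc (suc k)) (choose-pascal (suc n) (suc k)) ⟩
  (1ℚ + ℕ→ℚ (suc k)) * (choose (suc n) (suc k) + choose (suc n) (suc (suc k)))
    ≡⟨ solve 3 (λ c x y → (con (+ 1) :+ c) :* (x :+ y) := x :+ (c :* x :+ (con (+ 1) :+ c) :* y)) refl
         (ℕ→ℚ (suc k)) (choose (suc n) (suc k)) (choose (suc n) (suc (suc k))) ⟩
  choose (suc n) (suc k) + (ℕ→ℚ (suc k) * choose (suc n) (suc k) + (1ℚ + ℕ→ℚ (suc k)) * choose (suc n) (suc (suc k)))
    ≡⟨ cong (λ z → choose (suc n) (suc k) + (ℕ→ℚ (suc k) * choose (suc n) (suc k) + z * choose (suc n) (suc (suc k)))) (ℕ→ℚ-suc (suc k)) ⟨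
  choose (suc n) (suc k) + (ℕ→ℚ (suc k) * choose (suc n) (suc k) + ℕ→ℚ (suc (suc k)) * choose (suc n) (suc (suc k)))
    ≡⟨ cong (λ □ → (choose (suc n) (suc k)) + □) (cong₂ _+_ (choose-absorb n k) (choose-absorb n (suc k))) ⟩
  choose (suc n) (suc k) + (ℕ→ℚ (suc n) * choose n k + ℕ→ℚ (suc n) * choose n (suc k))
    ≡⟨ cong (λ □ → (choose (suc n) (suc k)) + □) (trans (cong (ℕ→ℚ (suc n) *_) (choose-pascal n k)) (*-distribˡ-+ (ℕ→ℚ (suc n)) _ _)) ⟨
  choose (suc n) (suc k) + ℕ→ℚ (suc n) * choose (suc n) (suc k)
    ≡⟨ solve 2 (λ c x → x :+ c :* x := (con (+ 1) :+ c) :* x) refl (ℕ→ℚ (suc n)) (choose (suc n) (suc k)) ⟩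
  (1ℚ + ℕ→ℚ (suc n)) * choose (suc n) (suc k)
    ≡⟨ cong (_* choose (suc n) (suc k)) (ℕ→ℚ-suc (suc n)) ⟨
  ℕ→ℚ (suc (suc n)) * choose (suc n) (suc k) ∎
  where open ≡-Reasoning

⋆-Σ : ∀ n a b → (a ⋆ b) n ≡ Σ< (suc n) (λ k → choose n k * (a k * b (n ℕ.∸ k)))
⋆-Σ zero    a b = solve 2 (λ x y → x :* y := con (+ 1) :* (x :* y) :+ con (+ 0)) refl (a 0) (b 0)
⋆-Σ (suc n) a b = begin
  (shift a ⋆ b) n + (a ⋆ shift b) n
    ≡⟨ cong₂ _+_ (⋆-Σ n (shift a) b) (⋆-Σ n a (shift b)) ⟩
  Σ< (suc n) (λ k → choose n k * (a (suc k) * b (n ℕ.∸ k))) + Σ< (suc n) (λ k → choose n k * (a k * b (suc (n ℕ.∸ k))))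
    ≡⟨ cong (λ □ → (Σ< (suc n) (λ k → choose n k * (a (suc k) * b (n ℕ.∸ k)))) + □) second ⟩
  Σ< (suc n) (λ k → choose n k * (a (suc k) * b (n ℕ.∸ k))) + (t 0 + Σ< (suc n) (t ∘ suc))
    ≡⟨ solve 3 (λ x y z → x :+ (y :+ z) := y :+ (x :+ z)) refl (Σ< (suc n) (λ k → choose n k * (a (suc k) * b (n ℕ.∸ k)))) (t 0) (Σ< (suc n) (t ∘ suc)) ⟩
  t 0 + (Σ< (suc n) (λ k → choose n k * (a (suc k) * b (n ℕ.∸ k))) + Σ< (suc n) (t ∘ suc))
    ≡⟨ cong (λ z → t 0 + z) (trans (sym (Σ-+ (suc n) (λ k → choose n k * (a (suc k) * b (n ℕ.∸ k))) (t ∘ suc))) (Σ-congˡ (suc n) (λ k →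
         trans (sym (*-distribʳ-+ (a (suc k) * b (n ℕ.∸ k)) (choose n k) (choose n (suc k))))
               (cong (_* (a (suc k) * b (n ℕ.∸ k))) (sym (choose-pascal n k)))))) ⟩
  choose (suc n) 0 * (a 0 * b (suc n)) + Σ< (suc n) (λ k → choose (suc n) (suc k) * (a (suc k) * b (n ℕ.∸ k))) ∎
  where
  open ≡-Reasoning
  t : ℕ → ℚ
  t k = choose n k * (a k * b (suc n ℕ.∸ k))
  second : Σ< (suc n) (λ k → choose n k * (a k * b (suc (n ℕ.∸ k)))) ≡ Σ< (suc (suc n)) t
  second = begin
    Σ< (suc n) (λ k → choose n k * (a k * b (suc (n ℕ.∸ k))))
      ≡⟨ Σ-congˡ< (suc n) (λ { k (s≤s k≤n) → cong (λ i → choose n k * (a k * b i)) (sym (ℕₚ.+-∸-assoc 1 k≤n)) }) ⟩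
    Σ< (suc n) t                 ≡⟨ +-identityʳ _ ⟨
    Σ< (suc n) t + 0ℚ            ≡⟨ cong (λ □ → (Σ< (suc n) t) + □) (trans (cong (_* (a (suc n) * b (n ℕ.∸ n))) (choose-above n)) (*-zeroˡ (a (suc n) * b (n ℕ.∸ n)))) ⟨
    Σ< (suc n) t + t (suc n)     ≡⟨ Σ-snoc (suc n) t ⟨
    Σ< (suc (suc n)) t           ∎

private
  nth-length : ∀ xs x → nth (xs ++ (x ∷ [])) (length xs) ≡ x
  nth-length []       x = refl
  nth-length (_ ∷ xs) x = nth-length xs x

  sum-zipWith : ∀ n (h : ℕ → ℚ → ℚ) (f : ℕ → ℕ) (g : ℕ → ℚ) →
    sumℚ (zipWith h (applyUpTo f n) (applyUpTo g n)) ≡ Σ< n (λ k → h (f k) (g k))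
  sum-zipWith zero    h f g = refl
  sum-zipWith (suc n) h f g = cong (λ □ → (h (f 0) (g 0)) + □) (sum-zipWith n h (f ∘ suc) (g ∘ suc))

  length-bernoullis : ∀ n → length (bernoullis n) ≡ suc n
  length-bernoullis zero    = refl
  length-bernoullis (suc n) = trans (length-++ (bernoullis n)) (trans (ℕₚ.+-comm _ 1) (cong suc (length-bernoullis n)))

  B-last : ∀ n x → nth (bernoullis n ++ (x ∷ [])) (suc n) ≡ x
  B-last n x = trans (cong (nth (bernoullis n ++ (x ∷ []))) (sym (length-bernoullis n))) (nth-length (bernoullis n) x)

  -- Extending the list keeps its earlier entries; this turns the recurrence on list entries into
  -- one on values of `B`.
  bernoullis≡ : ∀ n → bernoullis n ≡ applyUpTo B (suc n)
  bernoullis≡ zero    = refl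
  bernoullis≡ (suc n) = trans (cong₂ (λ bs b → bs ++ (b ∷ [])) (bernoullis≡ n) (sym (B-last n _))) (applyUpTo-∷ʳ B (suc n))

B-recurrence : ∀ n → B (suc n) ≡ - (inv (suc (suc n)) * Σ< (suc n) (λ k → choose (suc (suc n)) k * B k))
B-recurrence n = trans (B-last n _) (cong (λ z → - (inv (suc (suc n)) * z))
  (trans (cong (λ bs → sumℚ (zipWith (λ k b → choose (suc (suc n)) k * b) (upTo (suc n)) bs)) (bernoullis≡ n))
         (sum-zipWith (suc n) (λ k b → choose (suc (suc n)) k * b) (λ k → k) B)))

1^n≡1 : ∀ n → 1ℚ ^ n ≡ 1ℚ
1^n≡1 zero    = refl
1^n≡1 (suc n) = trans (*-identityˡ (1ℚ ^ n)) (1^n≡1 n)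

⋆-1-Σ : ∀ n a → (a ⋆ pow 1ℚ) n ≡ Σ< (suc n) (λ k → choose n k * a k)
⋆-1-Σ n a = trans (⋆-Σ n a (pow 1ℚ))
  (Σ-congˡ (suc n) (λ k → cong (choose n k *_) (trans (cong (a k *_) (1^n≡1 (n ℕ.∸ k))) (*-identityʳ (a k)))))

-- (t / (e^t - 1)) e^t = t / (e^t - 1) + t.
B-⋆-1 : ∀ n → (B ⋆ pow 1ℚ) n ≡ B n + δ₁ n
B-⋆-1 0 = refl
B-⋆-1 1 = refl
B-⋆-1 (suc (suc n)) = begin
  (B ⋆ pow 1ℚ) (suc (suc n))                          ≡⟨ ⋆-1-Σ (suc (suc n)) B ⟩
  Σ< (suc (suc (suc n))) t                            ≡⟨ Σ-snoc (suc (suc n)) t ⟩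
  Σ< (suc (suc n)) t + choose N N * B N               ≡⟨ cong₂ _+_ (Σ-snoc (suc n) t) (trans (cong (λ z → ℕ→ℚ z * B N) (nCn≡1 N)) (*-identityˡ (B N))) ⟩
  Σ< (suc n) t + choose N (suc n) * B (suc n) + B N   ≡⟨ cong (λ z → Σ< (suc n) t + z + B N) last ⟩
  Σ< (suc n) t + - Σ< (suc n) t + B N                 ≡⟨ solve 2 (λ s b → s :+ (:- s) :+ b := b :+ con (+ 0)) refl (Σ< (suc n) t) (B N) ⟩
  B N + 0ℚ                                            ∎
  where
  open ≡-Reasoning
  N = suc (suc n)
  t : ℕ → ℚ
  t k = choose N k * B k
  -- The defining recurrence is solved for its last term, whose coefficient is C(n+2, n+1) = n+2.
  last : choose N (suc n) * B (suc n) ≡ - Σ< (suc n) t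
  last = begin
    choose N (suc n) * B (suc n)             ≡⟨ cong₂ _*_ (cong ℕ→ℚ (trans (nCk≡nC[n∸k] (ℕₚ.n≤1+n (suc n))) (trans (cong (N C_) (ℕₚ.m+n∸n≡m 1 n)) (nC1≡n N)))) (B-recurrence n) ⟩
    ℕ→ℚ N * - (inv N * Σ< (suc n) t)         ≡⟨ solve 3 (λ a b c → a :* (:- (b :* c)) := :- ((a :* b) :* c)) refl (ℕ→ℚ N) (inv N) (Σ< (suc n) t) ⟩
    - (ℕ→ℚ N * inv N * Σ< (suc n) t)         ≡⟨ cong (λ z → - (z * Σ< (suc n) t)) (*-inv N (λ ())) ⟩
    - (1ℚ * Σ< (suc n) t)                    ≡⟨ cong -_ (*-identityˡ _) ⟩
    - Σ< (suc n) t                           ∎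

pow-0 : ∀ n → pow 0ℚ n ≡ δ₀ n
pow-0 zero    = refl
pow-0 (suc n) = *-zeroˡ (0ℚ ^ n)

powerSum : ℕ → ℕ → ℚ
powerSum m N = Σ< N (λ a → ℕ→ℚ a ^ m)

-- Induction on N: when t/(e^t - 1) e^(Nt) is multiplied by e^t it gains t e^(Nt), whose coefficient
-- is (m+1) N^m.
powerSum-⋆ : ∀ m N → ℕ→ℚ (suc m) * powerSum m N + B (suc m) ≡ (pow (ℕ→ℚ N) ⋆ B) (suc m)
powerSum-⋆ m zero    = sym (trans (⋆-cong (suc m) pow-0 (λ _ → refl)) (trans (δ₀-⋆ (suc m) B)
  (solve 2 (λ a b → b := a :* con (+ 0) :+ b) refl (ℕ→ℚ (suc m)) (B (suc m)))))
powerSum-⋆ m (suc N) = begin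
  c * powerSum m (suc N) + B (suc m)
    ≡⟨ cong (λ z → c * z + B (suc m)) (Σ-snoc N (λ a → ℕ→ℚ a ^ m)) ⟩
  c * (powerSum m N + x ^ m) + B (suc m)
    ≡⟨ solve 4 (λ c s y b → c :* (s :+ y) :+ b := (c :* s :+ b) :+ c :* y) refl c (powerSum m N) (x ^ m) (B (suc m)) ⟩
  (c * powerSum m N + B (suc m)) + c * x ^ m
    ≡⟨ cong₂ _+_ (powerSum-⋆ m N) (sym (δ₁-⋆ m (pow x))) ⟩
  (pow x ⋆ B) (suc m) + (δ₁ ⋆ pow x) (suc m)
    ≡⟨ cong (λ z → (pow x ⋆ B) (suc m) + z) (⋆-comm (suc m) δ₁ (pow x)) ⟩
  (pow x ⋆ B) (suc m) + (pow x ⋆ δ₁) (suc m)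
    ≡⟨ ⋆-distribˡ-+ (suc m) (pow x) B δ₁ ⟨
  (pow x ⋆ (λ k → B k + δ₁ k)) (suc m)
    ≡⟨ ⋆-cong (suc m) (λ _ → refl) (λ k → trans (⋆-comm k (pow 1ℚ) B) (B-⋆-1 k)) ⟨
  (pow x ⋆ (pow 1ℚ ⋆ B)) (suc m)
    ≡⟨ ⋆-assoc (suc m) (pow x) (pow 1ℚ) B ⟨
  ((pow x ⋆ pow 1ℚ) ⋆ B) (suc m)
    ≡⟨ ⋆-cong (suc m) (λ k → trans (pow-⋆ k x 1ℚ) (cong (_^ k) (trans (+-comm x 1ℚ) (sym (ℕ→ℚ-suc N))))) (λ _ → refl) ⟩
  (pow (ℕ→ℚ (suc N)) ⋆ B) (suc m) ∎
  where
  open ≡-Reasoning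
  c = ℕ→ℚ (suc m)
  x = ℕ→ℚ N

-- Written with C(m,j)/(j+1) instead of C(m+1,j+1)/(m+1): the denominators are then j+1 and those of
-- the Bernoulli numbers, and N^(j+1) is there to pay for them.
faulhaber : ∀ m N → powerSum m N ≡ Σ< (suc m) (λ j → choose m j * inv (suc j) * (ℕ→ℚ N ^ suc j * B (m ℕ.∸ j)))
faulhaber m N = *-cancelˡ-ℕ→ℚ (suc m) (λ ()) (begin
  c * powerSum m N
    ≡⟨ solve 2 (λ s b → s := (s :+ b) :- b) refl (c * powerSum m N) (B (suc m)) ⟩
  (c * powerSum m N + B (suc m)) - B (suc m)
    ≡⟨ cong (_- B (suc m)) (trans (powerSum-⋆ m N) (⋆-Σ (suc m) (pow x) B)) ⟩
  (choose (suc m) 0 * (1ℚ * B (suc m)) + Σ< (suc m) (λ j → choose (suc m) (suc j) * (x ^ suc j * B (m ℕ.∸ j)))) - B (suc m)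
    ≡⟨ solve 2 (λ b s → (con (+ 1) :* (con (+ 1) :* b) :+ s) :- b := s) refl (B (suc m)) (Σ< (suc m) (λ j → choose (suc m) (suc j) * (x ^ suc j * B (m ℕ.∸ j)))) ⟩
  Σ< (suc m) (λ j → choose (suc m) (suc j) * (x ^ suc j * B (m ℕ.∸ j)))
    ≡⟨ Σ-congˡ (suc m) (λ j → trans (cong (_* (x ^ suc j * B (m ℕ.∸ j))) (coefficient j)) (*-assoc c (choose m j * inv (suc j)) (x ^ suc j * B (m ℕ.∸ j)))) ⟩
  Σ< (suc m) (λ j → c * (choose m j * inv (suc j) * (x ^ suc j * B (m ℕ.∸ j))))
    ≡⟨ Σ-* (suc m) c (λ j → choose m j * inv (suc j) * (x ^ suc j * B (m ℕ.∸ j))) ⟩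
  c * Σ< (suc m) (λ j → choose m j * inv (suc j) * (x ^ suc j * B (m ℕ.∸ j))) ∎)
  where
  open ≡-Reasoning
  c = ℕ→ℚ (suc m)
  x = ℕ→ℚ N
  coefficient : ∀ j → choose (suc m) (suc j) ≡ c * (choose m j * inv (suc j))
  coefficient j = *-cancelˡ-ℕ→ℚ (suc j) (λ ()) (begin
    ℕ→ℚ (suc j) * choose (suc m) (suc j)               ≡⟨ choose-absorb m j ⟩
    c * choose m j                                     ≡⟨ *-identityʳ (c * choose m j) ⟨
    c * choose m j * 1ℚ                                ≡⟨ cong (λ □ → (c * choose m j) * □) (*-inv (suc j) (λ ())) ⟨
    c * choose m j * (ℕ→ℚ (suc j) * inv (suc j))       ≡⟨ solve 4 (λ c d k i → c :* d :* (k :* i) := k :* (c :* (d :* i))) refl c (choose m j) (ℕ→ℚ (suc j)) (inv (suc j)) ⟩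
    ℕ→ℚ (suc j) * (c * (choose m j * inv (suc j)))     ∎)

-- F e^t = F forces F = 0: once a_0, ..., a_(N-1) vanish, the coefficient of index N+1 reads (N+1)
-- a_N + a_(N+1) = a_(N+1).
⋆-1-fixed⇒0 : ∀ a → (∀ n → (a ⋆ pow 1ℚ) n ≡ a n) → ∀ n → a n ≡ 0ℚ
⋆-1-fixed⇒0 a fixed n = below (suc n) n ℕₚ.≤-refl
  where
  open ≡-Reasoning
  below : ∀ N k → k < N → a k ≡ 0ℚ
  below (suc N) k k<1+N with ℕₚ.m<1+n⇒m<n∨m≡n k<1+N
  ... | inj₁ k<N  = below N k k<N
  ... | inj₂ refl = *-cancelˡ-ℕ→ℚ (suc N) (λ ()) (begin
    ℕ→ℚ (suc N) * a N                       ≡⟨ cong (λ z → ℕ→ℚ z * a N) (trans (nCk≡nC[n∸k] (ℕₚ.n≤1+n N)) (trans (cong (suc N C_) (ℕₚ.m+n∸n≡m 1 N)) (nC1≡n (suc N)))) ⟨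
    t N                                     ≡⟨ solve 2 (λ x y → x := (con (+ 0) :+ x :+ y) :- y) refl (t N) (a (suc N)) ⟩
    (0ℚ + t N + a (suc N)) - a (suc N)      ≡⟨ cong₂ (λ u v → (u + t N + v) - a (suc N)) (zeroes N (below N)) (trans (cong (λ z → ℕ→ℚ z * a (suc N)) (nCn≡1 (suc N))) (*-identityˡ _)) ⟨
    (Σ< N t + t N + t (suc N)) - a (suc N)  ≡⟨ cong (λ z → (z + t (suc N)) - a (suc N)) (Σ-snoc N t) ⟨
    (Σ< (suc N) t + t (suc N)) - a (suc N)  ≡⟨ cong (_- a (suc N)) (trans (sym (Σ-snoc (suc N) t)) (trans (sym (⋆-1-Σ (suc N) a)) (fixed (suc N)))) ⟩
    a (suc N) - a (suc N)                   ≡⟨ +-inverseʳ (a (suc N)) ⟩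
    0ℚ                                      ≡⟨ *-zeroʳ (ℕ→ℚ (suc N)) ⟨
    ℕ→ℚ (suc N) * 0ℚ                        ∎)
    where
    t : ℕ → ℚ
    t j = choose (suc N) j * a j
    zeroes : ∀ M → (∀ j → j < M → a j ≡ 0ℚ) → Σ< M t ≡ 0ℚ
    zeroes M z = trans (Σ-congˡ< M (λ j j<M → trans (cong (choose (suc N) j *_) (z j j<M)) (*-zeroʳ (choose (suc N) j)))) (zeroΣ M)
      where
      zeroΣ : ∀ M → Σ< M (λ _ → 0ℚ) ≡ 0ℚ
      zeroΣ zero    = refl
      zeroΣ (suc M) = trans (+-identityˡ _) (zeroΣ M)

-1ℚ : ℚ
-1ℚ = - 1ℚ

-- Replacing t by -t: (-t) / (e^(-t) - 1) = t / (e^t - 1) + t, because the difference D of both sides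
-- satisfies D e^t = D.
B-reflection : ∀ n → -1ℚ ^ n * B n ≡ B n + δ₁ n
B-reflection n = begin
  B⁻ n                       ≡⟨ solve 2 (λ x y → x := (x :+ con (-[1+ 0 ]) :* y) :+ y) refl (B⁻ n) (B⁺ n) ⟩
  (B⁻ n + -1ℚ * B⁺ n) + B⁺ n ≡⟨ cong (_+ B⁺ n) (⋆-1-fixed⇒0 (λ k → B⁻ k + -1ℚ * B⁺ k) fixed n) ⟩
  0ℚ + B⁺ n                  ≡⟨ +-identityˡ (B⁺ n) ⟩
  B⁺ n                       ∎
  where
  open ≡-Reasoning
  B⁻ B⁺ : Seq
  B⁻ = dilate -1ℚ B
  B⁺ k = B k + δ₁ k
  1⋆ : Seq → Seq
  1⋆ a = a ⋆ pow 1ℚ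
  neg-δ₁ : ∀ k → -1ℚ ^ k * δ₁ k ≡ -1ℚ * δ₁ k
  neg-δ₁ 0             = refl
  neg-δ₁ 1             = refl
  neg-δ₁ (suc (suc k)) = trans (*-zeroʳ (-1ℚ ^ suc (suc k))) (sym (*-zeroʳ -1ℚ))
  -- `B-⋆-1` after the substitution of -t for t.
  B⁻-⋆ : ∀ k → (B⁻ ⋆ pow -1ℚ) k ≡ B⁻ k + -1ℚ * δ₁ k
  B⁻-⋆ k = begin
    (B⁻ ⋆ pow -1ℚ) k                  ≡⟨ ⋆-cong k (λ _ → refl) (λ j → trans (cong (-1ℚ ^ j *_) (1^n≡1 j)) (*-identityʳ (-1ℚ ^ j))) ⟨
    (B⁻ ⋆ dilate -1ℚ (pow 1ℚ)) k      ≡⟨ dilate-⋆ k -1ℚ B (pow 1ℚ) ⟩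
    -1ℚ ^ k * (B ⋆ pow 1ℚ) k          ≡⟨ cong (-1ℚ ^ k *_) (B-⋆-1 k) ⟩
    -1ℚ ^ k * (B k + δ₁ k)            ≡⟨ *-distribˡ-+ (-1ℚ ^ k) (B k) (δ₁ k) ⟩
    B⁻ k + -1ℚ ^ k * δ₁ k             ≡⟨ cong (λ z → B⁻ k + z) (neg-δ₁ k) ⟩
    B⁻ k + -1ℚ * δ₁ k                 ∎
  -- A further factor e^t undoes the factor e^(-t).
  B⁻-1 : ∀ k → B⁻ k ≡ 1⋆ B⁻ k + -1ℚ * 1⋆ δ₁ k
  B⁻-1 k = begin
    B⁻ k                                        ≡⟨ δ₀-⋆ k B⁻ ⟨
    (δ₀ ⋆ B⁻) k                                 ≡⟨ ⋆-comm k δ₀ B⁻ ⟩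
    (B⁻ ⋆ δ₀) k                                 ≡⟨ ⋆-cong k (λ _ → refl) (λ j → trans (pow-⋆ j -1ℚ 1ℚ) (pow-0 j)) ⟨
    (B⁻ ⋆ (pow -1ℚ ⋆ pow 1ℚ)) k                 ≡⟨ ⋆-assoc k B⁻ (pow -1ℚ) (pow 1ℚ) ⟨
    1⋆ (B⁻ ⋆ pow -1ℚ) k                         ≡⟨ ⋆-cong k B⁻-⋆ (λ _ → refl) ⟩
    1⋆ (λ j → B⁻ j + -1ℚ * δ₁ j) k              ≡⟨ ⋆-distribʳ-+ k B⁻ (λ j → -1ℚ * δ₁ j) (pow 1ℚ) ⟩
    1⋆ B⁻ k + 1⋆ (λ j → -1ℚ * δ₁ j) k           ≡⟨ cong (λ z → 1⋆ B⁻ k + z) (⋆-scaleˡ k -1ℚ δ₁ (pow 1ℚ)) ⟩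
    1⋆ B⁻ k + -1ℚ * 1⋆ δ₁ k                     ∎
  fixed : ∀ k → 1⋆ (λ j → B⁻ j + -1ℚ * B⁺ j) k ≡ B⁻ k + -1ℚ * B⁺ k
  fixed k = begin
    1⋆ (λ j → B⁻ j + -1ℚ * B⁺ j) k              ≡⟨ ⋆-distribʳ-+ k B⁻ (λ j → -1ℚ * B⁺ j) (pow 1ℚ) ⟩
    1⋆ B⁻ k + 1⋆ (λ j → -1ℚ * B⁺ j) k           ≡⟨ cong (λ z → 1⋆ B⁻ k + z) (trans (⋆-scaleˡ k -1ℚ B⁺ (pow 1ℚ)) (cong (-1ℚ *_) (⋆-distribʳ-+ k B δ₁ (pow 1ℚ)))) ⟩
    1⋆ B⁻ k + -1ℚ * (1⋆ B k + 1⋆ δ₁ k)          ≡⟨ cong (λ z → 1⋆ B⁻ k + -1ℚ * (z + 1⋆ δ₁ k)) (B-⋆-1 k) ⟩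
    1⋆ B⁻ k + -1ℚ * (B⁺ k + 1⋆ δ₁ k)            ≡⟨ solve 3 (λ x y z → x :+ con (-[1+ 0 ]) :* (y :+ z) := (x :+ con (-[1+ 0 ]) :* z) :+ con (-[1+ 0 ]) :* y) refl (1⋆ B⁻ k) (B⁺ k) (1⋆ δ₁ k) ⟩
    (1⋆ B⁻ k + -1ℚ * 1⋆ δ₁ k) + -1ℚ * B⁺ k      ≡⟨ cong (_+ -1ℚ * B⁺ k) (B⁻-1 k) ⟨
    B⁻ k + -1ℚ * B⁺ k                           ∎

-1^2n≡1 : ∀ n → -1ℚ ^ (2 ℕ.* n) ≡ 1ℚ
-1^2n≡1 n = trans (sym (^-assocʳ -1ℚ 2 n)) (1^n≡1 n)

-- At an odd index other than 1 the reflection reads -B = B.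
B-odd : ∀ n → n ≢ 0 → B (suc (2 ℕ.* n)) ≡ 0ℚ
B-odd zero    n≢0 = ⊥-elim (n≢0 refl)
B-odd (suc n) _   = *-cancelˡ-ℕ→ℚ 2 (λ ()) (begin
  ℕ→ℚ 2 * b                  ≡⟨ solve 1 (λ x → con (+ 2) :* x := (x :+ con (+ 0)) :- con (-[1+ 0 ]) :* con (+ 1) :* x) refl b ⟩
  (b + 0ℚ) - -1ℚ * 1ℚ * b    ≡⟨ cong (λ z → (b + 0ℚ) - -1ℚ * z * b) (-1^2n≡1 (suc n)) ⟨
  (b + 0ℚ) - -1ℚ ^ suc (2 ℕ.* suc n) * b ≡⟨ cong (λ z → (b + 0ℚ) - z) (B-reflection (suc (2 ℕ.* suc n))) ⟩
  (b + 0ℚ) - (b + 0ℚ)        ≡⟨ +-inverseʳ (b + 0ℚ) ⟩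
  0ℚ                         ≡⟨ *-zeroʳ (ℕ→ℚ 2) ⟨
  ℕ→ℚ 2 * 0ℚ                 ∎)
  where
  open ≡-Reasoning
  b = B (suc (2 ℕ.* suc n))

-- Doubling the residues modulo an odd number

Σ-++ : ∀ m n f → Σ< (m ℕ.+ n) f ≡ Σ< m f + Σ< n (λ k → f (m ℕ.+ k))
Σ-++ zero    n f = sym (+-identityˡ _)
Σ-++ (suc m) n f = trans (cong (λ z → f 0 + z) (Σ-++ m n (f ∘ suc))) (sym (+-assoc (f 0) (Σ< m (f ∘ suc)) (Σ< n (λ k → f (suc m ℕ.+ k)))))

2*suc : ∀ n → 2 ℕ.* suc n ≡ suc (suc (2 ℕ.* n))
2*suc n = ℕₚ.*-suc 2 n

Σ-even-odd : ∀ n f → Σ< (suc (2 ℕ.* n)) f ≡ Σ< (suc n) (λ k → f (2 ℕ.* k)) + Σ< n (λ k → f (suc (2 ℕ.* k)))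
Σ-even-odd zero    f = sym (+-identityʳ (f 0 + 0ℚ))
Σ-even-odd (suc n) f = begin
  Σ< (suc (2 ℕ.* suc n)) f                          ≡⟨ cong (λ m → Σ< (suc m) f) (2*suc n) ⟩
  Σ< (suc (suc (suc (2 ℕ.* n)))) f                  ≡⟨ trans (Σ-snoc (suc (suc (2 ℕ.* n))) f) (cong (_+ f (suc (suc (2 ℕ.* n)))) (Σ-snoc (suc (2 ℕ.* n)) f)) ⟩
  Σ< (suc (2 ℕ.* n)) f + o n + f (suc (suc (2 ℕ.* n)))  ≡⟨ cong₂ (λ x m → x + o n + f m) (Σ-even-odd n f) (sym (2*suc n)) ⟩
  Σ< (suc n) e + Σ< n o + o n + e (suc n)           ≡⟨ solve 4 (λ x y z w → x :+ y :+ z :+ w := (x :+ w) :+ (y :+ z)) refl (Σ< (suc n) e) (Σ< n o) (o n) (e (suc n)) ⟩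
  (Σ< (suc n) e + e (suc n)) + (Σ< n o + o n)       ≡⟨ cong₂ _+_ (Σ-snoc (suc n) e) (Σ-snoc n o) ⟨
  Σ< (suc (suc n)) e + Σ< (suc n) o                 ∎
  where
  open ≡-Reasoning
  e o : ℕ → ℚ
  e k = f (2 ℕ.* k)
  o k = f (suc (2 ℕ.* k))

-- Doubling permutes the residues modulo the odd number N = 2n + 1: the products 2a with a > n are N plus an odd number.
powerSum-doubling : ∀ k n → let N = suc (2 ℕ.* n); odd = λ i → ℕ→ℚ (suc (2 ℕ.* i)) in
  (ℕ→ℚ 2 ^ k - 1ℚ) * powerSum k N ≡ Σ< n (λ i → (odd i + ℕ→ℚ N) ^ k + -1ℚ * odd i ^ k)
powerSum-doubling k n = begin
  (ℕ→ℚ 2 ^ k - 1ℚ) * powerSum k N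
    ≡⟨ solve 2 (λ x y → (x :- con (+ 1)) :* y := x :* y :+ con (-[1+ 0 ]) :* y) refl (ℕ→ℚ 2 ^ k) (powerSum k N) ⟩
  ℕ→ℚ 2 ^ k * powerSum k N + -1ℚ * powerSum k N
    ≡⟨ cong₂ (λ x y → x + -1ℚ * y) doubled (Σ-even-odd n (λ a → ℕ→ℚ a ^ k)) ⟩
  (Σ< (suc n) e + Σ< n o′) + -1ℚ * (Σ< (suc n) e + Σ< n o)
    ≡⟨ solve 3 (λ x y z → (x :+ y) :+ con (-[1+ 0 ]) :* (x :+ z) := y :+ con (-[1+ 0 ]) :* z) refl (Σ< (suc n) e) (Σ< n o′) (Σ< n o) ⟩
  Σ< n o′ + -1ℚ * Σ< n o
    ≡⟨ trans (Σ-+ n o′ (λ i → -1ℚ * o i)) (cong (λ z → Σ< n o′ + z) (Σ-* n -1ℚ o)) ⟨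
  Σ< n (λ i → o′ i + -1ℚ * o i) ∎
  where
  open ≡-Reasoning
  N = suc (2 ℕ.* n)
  e o o′ : ℕ → ℚ
  e i  = ℕ→ℚ (2 ℕ.* i) ^ k
  o i  = ℕ→ℚ (suc (2 ℕ.* i)) ^ k
  o′ i = (ℕ→ℚ (suc (2 ℕ.* i)) + ℕ→ℚ N) ^ k
  upper : ∀ i → 2 ℕ.* (suc n ℕ.+ i) ≡ suc (2 ℕ.* i) ℕ.+ N
  upper i = trans (ℕₚ.*-distribˡ-+ 2 (suc n) i) (trans (cong (ℕ._+ 2 ℕ.* i) (2*suc n)) (trans (ℕₚ.+-comm (suc N) (2 ℕ.* i)) (ℕₚ.+-suc (2 ℕ.* i) N)))
  doubled : ℕ→ℚ 2 ^ k * powerSum k N ≡ Σ< (suc n) e + Σ< n o′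
  doubled = begin
    ℕ→ℚ 2 ^ k * powerSum k N                        ≡⟨ Σ-* N (ℕ→ℚ 2 ^ k) (λ a → ℕ→ℚ a ^ k) ⟨
    Σ< N (λ a → ℕ→ℚ 2 ^ k * ℕ→ℚ a ^ k)              ≡⟨ Σ-congˡ N (λ a → trans (sym (^-distrib-* (ℕ→ℚ 2) (ℕ→ℚ a) k)) (cong (_^ k) (sym (ℕ→ℚ-* 2 a)))) ⟩
    Σ< N e                                          ≡⟨ cong (λ m → Σ< (suc (n ℕ.+ m)) e) (ℕₚ.+-identityʳ n) ⟩
    Σ< (suc n ℕ.+ n) e                              ≡⟨ Σ-++ (suc n) n e ⟩
    Σ< (suc n) e + Σ< n (λ i → e (suc n ℕ.+ i))     ≡⟨ cong (λ z → Σ< (suc n) e + z) (Σ-congˡ n (λ i → cong (_^ k) (trans (cong ℕ→ℚ (upper i)) (ℕ→ℚ-+ (suc (2 ℕ.* i)) N)))) ⟩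
    Σ< (suc n) e + Σ< n o′                          ∎

inv-* : ∀ m n → m ≢ 0 → n ≢ 0 → inv (m ℕ.* n) ≡ inv m * inv n
inv-* zero    n       m≢0 _   = ⊥-elim (m≢0 refl)
inv-* (suc m) zero    _   n≢0 = ⊥-elim (n≢0 refl)
inv-* (suc m) (suc n) m≢0 n≢0 = *-cancelˡ-ℕ→ℚ (suc m ℕ.* suc n) (λ ()) (begin
  ℕ→ℚ (suc m ℕ.* suc n) * inv (suc m ℕ.* suc n)             ≡⟨ *-inv (suc m ℕ.* suc n) (λ ()) ⟩
  1ℚ                                                        ≡⟨ cong₂ _*_ (*-inv (suc m) m≢0) (*-inv (suc n) n≢0) ⟨
  (ℕ→ℚ (suc m) * inv (suc m)) * (ℕ→ℚ (suc n) * inv (suc n)) ≡⟨ solve 4 (λ a b c d → (a :* b) :* (c :* d) := (a :* c) :* (b :* d)) refl (ℕ→ℚ (suc m)) (inv (suc m)) (ℕ→ℚ (suc n)) (inv (suc n)) ⟩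
  (ℕ→ℚ (suc m) * ℕ→ℚ (suc n)) * (inv (suc m) * inv (suc n)) ≡⟨ cong (_* (inv (suc m) * inv (suc n))) (ℕ→ℚ-* (suc m) (suc n)) ⟨
  ℕ→ℚ (suc m ℕ.* suc n) * (inv (suc m) * inv (suc n))       ∎)
  where open ≡-Reasoning

-- The n-th difference at 0 of the sequence k ↦ k^m, i.e. n! times a Stirling number of the second kind.
difference : ℕ → ℕ → ℚ
difference n m = (pow -1ℚ ⋆ (λ k → ℕ→ℚ k ^ m)) n

-- The sequence k b_k has generating function t b'(t), and the factor t can be pulled out of the
-- product.
⋆-index : ∀ n a b → (a ⋆ (λ k → ℕ→ℚ k * b k)) (suc n) ≡ ℕ→ℚ (suc n) * (a ⋆ shift b) n
⋆-index n a b = begin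
  (a ⋆ (λ k → ℕ→ℚ k * b k)) (suc n)   ≡⟨ ⋆-cong (suc n) (λ _ → refl) index ⟩
  (a ⋆ (δ₁ ⋆ shift b)) (suc n)        ≡⟨ ⋆-assoc (suc n) a δ₁ (shift b) ⟨
  ((a ⋆ δ₁) ⋆ shift b) (suc n)        ≡⟨ ⋆-cong (suc n) (λ k → ⋆-comm k a δ₁) (λ _ → refl) ⟩
  ((δ₁ ⋆ a) ⋆ shift b) (suc n)        ≡⟨ ⋆-assoc (suc n) δ₁ a (shift b) ⟩
  (δ₁ ⋆ (a ⋆ shift b)) (suc n)        ≡⟨ δ₁-⋆ n (a ⋆ shift b) ⟩
  ℕ→ℚ (suc n) * (a ⋆ shift b) n       ∎
  where
  open ≡-Reasoning
  index : ∀ k → ℕ→ℚ k * b k ≡ (δ₁ ⋆ shift b) k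
  index zero    = trans (*-zeroˡ (b 0)) (sym (*-zeroˡ (b 1)))
  index (suc k) = sym (δ₁-⋆ k (shift b))

-- `⋆-index` peels one factor k off k^(m+1), and the product rule gives e^(-t) a' = (e^(-t) a)' +
-- e^(-t) a. Up to factorials this is the recurrence of the Stirling numbers.
difference-rec : ∀ n m → difference (suc n) (suc m) ≡ ℕ→ℚ (suc n) * (difference (suc n) m + difference n m)
difference-rec n m = trans (⋆-index n (pow -1ℚ) a) (cong (ℕ→ℚ (suc n) *_) (begin
  (pow -1ℚ ⋆ shift a) n
    ≡⟨ solve 2 (λ x y → y := (con (-[1+ 0 ]) :* x :+ y) :+ x) refl (difference n m) ((pow -1ℚ ⋆ shift a) n) ⟩
  (-1ℚ * difference n m + (pow -1ℚ ⋆ shift a) n) + difference n m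
    ≡⟨ cong (λ z → (z + (pow -1ℚ ⋆ shift a) n) + difference n m) (⋆-scaleˡ n -1ℚ (pow -1ℚ) a) ⟨
  difference (suc n) m + difference n m ∎))
  where
  open ≡-Reasoning
  a : Seq
  a k = ℕ→ℚ k ^ m

difference-< : ∀ n m → m < n → difference n m ≡ 0ℚ
difference-< (suc n) zero    _         = trans (trans (⋆-cong (suc n) {pow -1ℚ} {pow -1ℚ} (λ _ → refl) (λ k → sym (1^n≡1 k))) (pow-⋆ (suc n) -1ℚ 1ℚ)) (pow-0 (suc n))
difference-< (suc n) (suc m) (s≤s m<n) = trans (difference-rec n m)
  (trans (cong₂ (λ x y → ℕ→ℚ (suc n) * (x + y)) (difference-< (suc n) m (ℕₚ.m<n⇒m<1+n m<n)) (difference-< n m m<n)) (*-zeroʳ (ℕ→ℚ (suc n))))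

difference-! : ∀ n → difference n n ≡ ℕ→ℚ (n !)
difference-! zero    = refl
difference-! (suc n) = trans (difference-rec n n)
  (trans (cong₂ (λ x y → ℕ→ℚ (suc n) * (x + y)) (difference-< (suc n) n (ℕₚ.n<1+n n)) (difference-! n))
  (trans (cong (ℕ→ℚ (suc n) *_) (+-identityˡ (ℕ→ℚ (n !)))) (sym (ℕ→ℚ-* (suc n) (n !)))))

-- Congruences between p-integral rationals

module Padic (p : ℕ) (p-prime : Prime p) (7≤p : 7 ≤ p) where

  P : ℚ
  P = ℕ→ℚ p

  p≢0 : p ≢ 0
  p≢0 = ℕ.≢-nonZero⁻¹ p {{prime⇒nonZero p-prime}}

  ∤-* : ∀ {m n} → ¬ p ∣ m → ¬ p ∣ n → ¬ p ∣ m ℕ.* n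
  ∤-* {m} {n} p∤m p∤n = [ p∤m , p∤n ]′ ∘ euclidsLemma m n p-prime

  ∤-< : ∀ {n} → n ≢ 0 → n < p → ¬ p ∣ n
  ∤-< {zero}  n≢0 _   = ⊥-elim (n≢0 refl)
  ∤-< {suc n} _   n<p p∣n = ℕₚ.<⇒≱ n<p (∣⇒≤ p∣n)

  ∤-<7 : ∀ n .{{_ : ℕ.NonZero n}} {_ : n ℕ.≤ 6} → ¬ p ∣ n
  ∤-<7 n {n≤6} = ∤-< (ℕ.≢-nonZero⁻¹ n) (ℕₚ.≤-trans (s≤s n≤6) 7≤p)

  -- Any denominator prime to p serves, reduced or not: sums and products only cross-multiply,
  -- without a gcd.
  record Integral (x : ℚ) : Set where
    constructor integral
    field
      num   : ℤ
      den   : ℕ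
      p∤den : ¬ p ∣ den
      den*  : ℕ→ℚ den * x ≡ ℤ→ℚ num

  p∤1 : ¬ p ∣ 1
  p∤1 = ∤-<7 1 {s≤s z≤n}

  ℤ-integral : ∀ z → Integral (ℤ→ℚ z)
  ℤ-integral z = integral z 1 p∤1 (*-identityˡ (ℤ→ℚ z))

  ℕ-integral : ∀ n → Integral (ℕ→ℚ n)
  ℕ-integral n = ℤ-integral (+ n)

  P-integral : Integral P
  P-integral = ℕ-integral p

  +-integral : ∀ {x y} → Integral x → Integral y → Integral (x + y)
  +-integral {x} {y} (integral a d p∤d dx) (integral b e p∤e ey) =
    integral (+ e ℤ.* a ℤ.+ + d ℤ.* b) (d ℕ.* e) (∤-* p∤d p∤e) (begin
      ℕ→ℚ (d ℕ.* e) * (x + y)                          ≡⟨ cong (_* (x + y)) (ℕ→ℚ-* d e) ⟩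
      ℕ→ℚ d * ℕ→ℚ e * (x + y)                          ≡⟨ solve 4 (λ d e x y → d :* e :* (x :+ y) := e :* (d :* x) :+ d :* (e :* y)) refl (ℕ→ℚ d) (ℕ→ℚ e) x y ⟩
      ℕ→ℚ e * (ℕ→ℚ d * x) + ℕ→ℚ d * (ℕ→ℚ e * y)        ≡⟨ cong₂ (λ u v → ℕ→ℚ e * u + ℕ→ℚ d * v) dx ey ⟩
      ℕ→ℚ e * ℤ→ℚ a + ℕ→ℚ d * ℤ→ℚ b                    ≡⟨ cong₂ _+_ (ℤ→ℚ-* (+ e) a) (ℤ→ℚ-* (+ d) b) ⟨
      ℤ→ℚ (+ e ℤ.* a) + ℤ→ℚ (+ d ℤ.* b)                ≡⟨ ℤ→ℚ-+ (+ e ℤ.* a) (+ d ℤ.* b) ⟨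
      ℤ→ℚ (+ e ℤ.* a ℤ.+ + d ℤ.* b)                    ∎)
    where open ≡-Reasoning

  *-integral : ∀ {x y} → Integral x → Integral y → Integral (x * y)
  *-integral {x} {y} (integral a d p∤d dx) (integral b e p∤e ey) =
    integral (a ℤ.* b) (d ℕ.* e) (∤-* p∤d p∤e) (begin
      ℕ→ℚ (d ℕ.* e) * (x * y)          ≡⟨ cong (_* (x * y)) (ℕ→ℚ-* d e) ⟩
      ℕ→ℚ d * ℕ→ℚ e * (x * y)          ≡⟨ solve 4 (λ d e x y → d :* e :* (x :* y) := (d :* x) :* (e :* y)) refl (ℕ→ℚ d) (ℕ→ℚ e) x y ⟩
      ℕ→ℚ d * x * (ℕ→ℚ e * y)          ≡⟨ cong₂ _*_ dx ey ⟩
      ℤ→ℚ a * ℤ→ℚ b                    ≡⟨ ℤ→ℚ-* a b ⟨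
      ℤ→ℚ (a ℤ.* b)                    ∎)
    where open ≡-Reasoning

  neg-integral : ∀ {x} → Integral x → Integral (- x)
  neg-integral {x} (integral a d p∤d dx) = integral (ℤ.- a) d p∤d
    (trans (sym (neg-distribʳ-* (ℕ→ℚ d) x)) (trans (cong -_ dx) (sym (ℤ→ℚ-neg a))))

  ^-integral : ∀ {x} k → Integral x → Integral (x ^ k)
  ^-integral zero    _  = ℤ-integral (+ 1)
  ^-integral (suc k) ix = *-integral ix (^-integral k ix)

  inv-integral : ∀ {n} → ¬ p ∣ n → Integral (inv n)
  inv-integral {zero}  p∤0 = ℤ-integral (+ 0)
  inv-integral {suc n} p∤n = integral (+ 1) (suc n) p∤n (*-inv (suc n) (λ ()))

  infix 4 _≈_[mod_]

  -- Integrality is demanded of the quotient alone, while x and y may have p in the denominator;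
  -- products therefore ask for integrality of the factors separately.
  record _≈_[mod_] (x y : ℚ) (r : ℕ) : Set where
    constructor _at_
    field
      {quot}        : ℚ
      quot-integral : Integral quot
      equation      : x ≡ y + P ^ r * quot

  module _ {r : ℕ} where

    ≡⇒≈ : ∀ {x y} → x ≡ y → x ≈ y [mod r ]
    ≡⇒≈ {x} refl = ℤ-integral (+ 0) at solve 2 (λ x q → x := x :+ q :* con (+ 0)) refl x (P ^ r)

    ≈-refl : ∀ {x} → x ≈ x [mod r ]
    ≈-refl = ≡⇒≈ refl

    ≈-sym : ∀ {x y} → x ≈ y [mod r ] → y ≈ x [mod r ]
    ≈-sym {y = y} (_at_ {z} iz refl) = neg-integral iz at
      solve 3 (λ y q z → y := (y :+ q :* z) :+ q :* (:- z)) refl y (P ^ r) z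

    ≈-trans : ∀ {x y z} → x ≈ y [mod r ] → y ≈ z [mod r ] → x ≈ z [mod r ]
    ≈-trans {z = z} (_at_ {a} ia refl) (_at_ {b} ib refl) = +-integral ib ia at
      solve 4 (λ z q a b → (z :+ q :* b) :+ q :* a := z :+ q :* (b :+ a)) refl z (P ^ r) a b

    ≈-+ : ∀ {x y u v} → x ≈ y [mod r ] → u ≈ v [mod r ] → x + u ≈ y + v [mod r ]
    ≈-+ {y = y} {v = v} (_at_ {a} ia refl) (_at_ {b} ib refl) = +-integral ia ib at
      solve 5 (λ y v q a b → (y :+ q :* a) :+ (v :+ q :* b) := (y :+ v) :+ q :* (a :+ b)) refl y v (P ^ r) a b

    ≈-neg : ∀ {x y} → x ≈ y [mod r ] → - x ≈ - y [mod r ]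
    ≈-neg {y = y} (_at_ {a} ia refl) = neg-integral ia at
      solve 3 (λ y q a → :- (y :+ q :* a) := (:- y) :+ q :* (:- a)) refl y (P ^ r) a

    ≈-- : ∀ {x y u v} → x ≈ y [mod r ] → u ≈ v [mod r ] → x - u ≈ y - v [mod r ]
    ≈-- p q = ≈-+ p (≈-neg q)

    ≈-*ˡ : ∀ {x y z} → Integral z → x ≈ y [mod r ] → z * x ≈ z * y [mod r ]
    ≈-*ˡ {y = y} {z} iz (_at_ {a} ia refl) = *-integral iz ia at
      solve 4 (λ y z q a → z :* (y :+ q :* a) := z :* y :+ q :* (z :* a)) refl y z (P ^ r) a

    ≈-*ʳ : ∀ {x y z} → Integral z → x ≈ y [mod r ] → x * z ≈ y * z [mod r ]
    ≈-*ʳ {x} {y} {z} iz e = subst₂ (_≈_[mod r ]) (*-comm z x) (*-comm z y) (≈-*ˡ iz e)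

    ≈-integral : ∀ {x y} → x ≈ y [mod r ] → Integral y → Integral x
    ≈-integral (ia at refl) iy = +-integral iy (*-integral (^-integral r P-integral) ia)

    ≈-* : ∀ {x y u v} → Integral y → Integral v → x ≈ y [mod r ] → u ≈ v [mod r ] → x * u ≈ y * v [mod r ]
    ≈-* iy iv xy uv = ≈-trans (≈-*ʳ (≈-integral uv iv) xy) (≈-*ˡ iy uv)

    ≈-^ : ∀ {x y} k → Integral y → x ≈ y [mod r ] → x ^ k ≈ y ^ k [mod r ]
    ≈-^ zero    _  _ = ≈-refl
    ≈-^ (suc k) iy e = ≈-* iy (^-integral k iy) e (≈-^ k iy e)

    ≈-P* : ∀ {x y} → x ≈ y [mod r ] → P * x ≈ P * y [mod suc r ]
    ≈-P* {y = y} (_at_ {a} ia refl) = ia at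
      solve 4 (λ P y q a → P :* (y :+ q :* a) := P :* y :+ P :* q :* a) refl P y (P ^ r) a

    ≈-P*⁻¹ : ∀ {x y} → P * x ≈ P * y [mod suc r ] → x ≈ y [mod r ]
    ≈-P*⁻¹ {y = y} (_at_ {a} ia e) = ia at *-cancelˡ-ℕ→ℚ p p≢0
      (trans e (solve 4 (λ P y q a → P :* y :+ P :* q :* a := P :* (y :+ q :* a)) refl P y (P ^ r) a))

    ≈-weaken : ∀ {x y} → x ≈ y [mod suc r ] → x ≈ y [mod r ]
    ≈-weaken {y = y} (_at_ {a} ia refl) = *-integral P-integral ia at
      solve 4 (λ P y q a → y :+ P :* q :* a := y :+ q :* (P :* a)) refl P y (P ^ r) a

    ≈-cancelˡ : ∀ {x y z w} → Integral w → w * z ≡ 1ℚ → z * x ≈ z * y [mod r ] → x ≈ y [mod r ]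
    ≈-cancelˡ {x} {y} {z} {w} iw wz e = subst₂ (_≈_[mod r ]) (lem x) (lem y) (≈-*ˡ iw e)
      where
      lem : ∀ x → w * (z * x) ≡ x
      lem x = trans (sym (*-assoc w z x)) (trans (cong (_* x) wz) (*-identityˡ x))

    ≈-cancelˡ-ℕ : ∀ n → ¬ p ∣ n → ∀ {x y} → ℕ→ℚ n * x ≈ ℕ→ℚ n * y [mod r ] → x ≈ y [mod r ]
    ≈-cancelˡ-ℕ zero    p∤n = ⊥-elim (p∤n (divides 0 refl))
    ≈-cancelˡ-ℕ (suc n) p∤n = ≈-cancelˡ (inv-integral p∤n) (trans (*-comm (inv (suc n)) (ℕ→ℚ (suc n))) (*-inv (suc n) (λ ())))

  ≈0⇒ : ∀ {r x} → Integral x → P ^ r * x ≈ 0ℚ [mod r ]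
  ≈0⇒ {r} {x} ix = ix at sym (+-identityˡ (P ^ r * x))

  -- A polynomial congruence modulo p^r holds as soon as the r lowest coefficients of the difference vanish,
  -- when p is taken as the outermost variable of the Horner normal form.

  private
    integralH : ∀ {n} (h : HNF (suc n)) {ρ} → All Integral ρ → Integral (⟦ h ⟧H ρ)
    integralN : ∀ {n} (f : Normal n) {ρ} → All Integral ρ → Integral (⟦ f ⟧N ρ)
    integralH ∅                 _         = ℤ-integral (+ 0)
    integralH (h *x+ c) {x ∷ ρ} (ix ∷ iρ) = +-integral (*-integral (integralH h (ix ∷ iρ)) ix) (integralN c iρ)
    integralN (con c)  _  = ℤ-integral c
    integralN (poly h) iρ = integralH h iρ

    vanishesH? : ∀ {n} r (h : HNF (suc n)) → Maybe (∀ {ρ} → All Integral ρ → ⟦ h ⟧H (P ∷ ρ) ≈ 0ℚ [mod r ])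
    vanishesH? zero    h         = just λ {ρ} iρ → integralH h (P-integral ∷ iρ) at
      solve 1 (λ x → x := con (+ 0) :+ con (+ 1) :* x) refl (⟦ h ⟧H (P ∷ ρ))
    vanishesH? (suc r) ∅         = just (λ _ → ≈-refl)
    vanishesH? (suc r) (h *x+ c) = Maybe.zipWith
      (λ vh c≈0 {ρ} iρ → subst₂ (_≈_[mod suc r ])
        (trans (*-comm P _) (trans (sym (+-identityʳ _)) (cong (λ z → ⟦ h ⟧H (P ∷ ρ) * P + z) (0≈⟦0⟧ c≈0 ρ))))
        (*-zeroʳ P) (≈-P* (vh iρ)))
      (vanishesH? r h) (c ≟N 0N)

    vanishes? : ∀ {n} r (f : Normal (suc n)) → Maybe (∀ {ρ} → All Integral ρ → ⟦ f ⟧N (P ∷ ρ) ≈ 0ℚ [mod r ])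
    vanishes? r (poly h) = vanishesH? r h

  -- The constants of a polynomial are integers; this is why denominators are cleared before any
  -- congruence is handed to the solver.
  ⟦_⟧-integral : ∀ {n} (f : Polynomial n) {ρ} → All Integral ρ → Integral (⟦ f ⟧ ρ)
  ⟦ f ⟧-integral {ρ} iρ = subst Integral (correct f ρ) (integralN (normalise f) iρ)

  solveMod : ∀ {n} r (f g : Polynomial (suc n)) {_ : T (is-just (vanishes? r (normalise (f :- g))))} →
             ∀ {ρ} → All Integral ρ → ⟦ f ⟧ (P ∷ ρ) ≈ ⟦ g ⟧ (P ∷ ρ) [mod r ]
  solveMod r f g {v} {ρ} iρ = subst₂ (_≈_[mod r ])
    (solve 2 (λ a b → (a :- b) :+ b := a) refl (⟦ f ⟧ (P ∷ ρ)) (⟦ g ⟧ (P ∷ ρ))) (+-identityˡ _)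
    (≈-+ (subst (_≈ 0ℚ [mod r ]) (correct (f :- g) (P ∷ ρ)) (to-witness-T _ v iρ)) ≈-refl)

  Σ-≈ : ∀ {r} n f g → (∀ k → k < n → f k ≈ g k [mod r ]) → Σ< n f ≈ Σ< n g [mod r ]
  Σ-≈ zero    f g e = ≈-refl
  Σ-≈ (suc n) f g e = ≈-+ (e 0 (s≤s z≤n)) (Σ-≈ n (f ∘ suc) (g ∘ suc) (λ k k<n → e (suc k) (s≤s k<n)))

  Σ-≈0 : ∀ {r} n f → (∀ k → k < n → f k ≈ 0ℚ [mod r ]) → Σ< n f ≈ 0ℚ [mod r ]
  Σ-≈0 zero    f e = ≈-refl
  Σ-≈0 (suc n) f e = ≈-+ (e 0 (s≤s z≤n)) (Σ-≈0 n (f ∘ suc) (λ k k<n → e (suc k) (s≤s k<n)))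

  Σ-integral : ∀ n f → (∀ k → k < n → Integral (f k)) → Integral (Σ< n f)
  Σ-integral zero    f i = ℤ-integral (+ 0)
  Σ-integral (suc n) f i = +-integral (i 0 (s≤s z≤n)) (Σ-integral n (f ∘ suc) (λ k k<n → i (suc k) (s≤s k<n)))

  ≈0⇒∣ : ∀ n → ℕ→ℚ n ≈ 0ℚ [mod 1 ] → p ∣ n
  ≈0⇒∣ n (_at_ {z} (integral a d p∤d dz) n≡) = [ (λ p∣d → ⊥-elim (p∤d p∣d)) , (λ p∣n → p∣n) ]′ (euclidsLemma d n p-prime
    (divides ℤ.∣ a ∣ (trans (cong ℤ.∣_∣ (ℤ→ℚ-injective {+ (d ℕ.* n)} {a ℤ.* + p} (begin
      ℕ→ℚ (d ℕ.* n)                   ≡⟨ ℕ→ℚ-* d n ⟩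
      ℕ→ℚ d * ℕ→ℚ n                   ≡⟨ cong (ℕ→ℚ d *_) n≡ ⟩
      ℕ→ℚ d * (0ℚ + P * 1ℚ * z)       ≡⟨ solve 3 (λ d q z → d :* (con (+ 0) :+ q :* con (+ 1) :* z) := (d :* z) :* q) refl (ℕ→ℚ d) P z ⟩
      ℕ→ℚ d * z * P                   ≡⟨ cong (_* P) dz ⟩
      ℤ→ℚ a * P                       ≡⟨ ℤ→ℚ-* a (+ p) ⟨
      ℤ→ℚ (a ℤ.* + p)                 ∎))) (ℤₚ.abs-* a (+ p)))))
    where open ≡-Reasoning

  ∣⇒≈0 : ∀ {n} → p ∣ n → ℕ→ℚ n ≈ 0ℚ [mod 1 ]
  ∣⇒≈0 (divides q refl) = subst (_≈ 0ℚ [mod 1 ])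
    (trans (cong (_* ℕ→ℚ q) (*-identityʳ P)) (trans (*-comm P (ℕ→ℚ q)) (sym (ℕ→ℚ-* q p)))) (≈0⇒ (ℕ-integral q))

  -- The exponent of p in n is at most n - 6 as soon as it is positive, because p ≥ 7.
  P^*inv-integral : ∀ n → n ≢ 0 → ∀ e → n ℕ.∸ 6 ≤ e → Integral (P ^ e * inv n)
  P^*inv-integral n = below (suc n) n ℕₚ.≤-refl
    where
    below : ∀ N n → n < N → n ≢ 0 → ∀ e → n ℕ.∸ 6 ≤ e → Integral (P ^ e * inv n)
    below (suc N) n n<N n≢0 e n-6≤e with p ∣? n
    ... | no  p∤n = *-integral (^-integral e P-integral) (inv-integral p∤n)
    ... | yes (divides zero    refl) = ⊥-elim (n≢0 refl)
    ... | yes (divides (suc q) refl) = peel e n-6≤e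
      where
      2+q≤n : suc (suc q) ≤ suc q ℕ.* p
      2+q≤n = ℕₚ.≤-trans (ℕₚ.+-mono-≤ (ℕₚ.≤-trans (s≤s (s≤s z≤n)) 7≤p) (ℕₚ.≤-trans (ℕₚ.≤-reflexive (sym (ℕₚ.*-identityʳ q))) (ℕₚ.*-monoʳ-≤ q (ℕₚ.≤-trans (s≤s z≤n) 7≤p)))) ℕₚ.≤-refl
      7≤n : 7 ≤ suc q ℕ.* p
      7≤n = ℕₚ.≤-trans 7≤p (ℕₚ.m≤m+n p (q ℕ.* p))
      peel : ∀ e → suc q ℕ.* p ℕ.∸ 6 ≤ e → Integral (P ^ e * inv (suc q ℕ.* p))
      peel zero    n-6≤0 = ⊥-elim (ℕₚ.<⇒≱ 7≤n (ℕₚ.m∸n≡0⇒m≤n (ℕₚ.n≤0⇒n≡0 n-6≤0)))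
      -- One factor p of n = (q+1)p cancels against one of p^(e+1). Since q+2 ≤ n, the bound passes
      -- on to q+1 and e.
      peel (suc e) n-6≤1+e = subst Integral (sym split)
        (below N (suc q) (ℕₚ.≤-trans 2+q≤n (ℕₚ.≤-pred n<N)) (λ ()) e
          (ℕₚ.≤-trans (ℕₚ.∸-monoˡ-≤ 7 2+q≤n) (ℕₚ.≤-trans (ℕₚ.≤-reflexive (sym (ℕₚ.∸-+-assoc (suc q ℕ.* p) 6 1))) (ℕₚ.∸-monoˡ-≤ 1 n-6≤1+e))))
        where
        open ≡-Reasoning
        split : P ^ suc e * inv (suc q ℕ.* p) ≡ P ^ e * inv (suc q)
        split = begin
          P * P ^ e * inv (suc q ℕ.* p)          ≡⟨ cong (P * P ^ e *_) (inv-* (suc q) p (λ ()) p≢0) ⟩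
          P * P ^ e * (inv (suc q) * inv p)      ≡⟨ solve 4 (λ x y z w → x :* y :* (z :* w) := (x :* w) :* (y :* z)) refl P (P ^ e) (inv (suc q)) (inv p) ⟩
          (P * inv p) * (P ^ e * inv (suc q))    ≡⟨ cong (_* (P ^ e * inv (suc q))) (*-inv p p≢0) ⟩
          1ℚ * (P ^ e * inv (suc q))             ≡⟨ *-identityˡ _ ⟩
          P ^ e * inv (suc q)                    ∎

  -- Faulhaber's formula modulo powers of p

  faulhaberTerm : ℕ → ℕ → ℕ → ℚ
  faulhaberTerm N m j = choose m j * inv (suc j) * (ℕ→ℚ N ^ suc j * B (m ℕ.∸ j))

  -- The factor N^(j+1) = p^(r+1+e) is spent threefold: p^r for the congruence, p on the denominator
  -- of the Bernoulli number, p^e on that of 1/(j+1).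
  faulhaberTerm-≈0 : ∀ r e N m j → ℕ→ℚ N ^ suc j ≡ P ^ (r ℕ.+ suc e) → suc j ℕ.∸ 6 ≤ e →
    Integral (P * B (m ℕ.∸ j)) → faulhaberTerm N m j ≈ 0ℚ [mod r ]
  faulhaberTerm-≈0 r e N m j N^≡ j-5≤e iPB = subst (_≈ 0ℚ [mod r ]) (sym eq)
    (≈0⇒ (*-integral (*-integral (ℕ-integral (m C j)) (P^*inv-integral (suc j) (λ ()) e j-5≤e)) iPB))
    where
    open ≡-Reasoning
    c = choose m j
    i = inv (suc j)
    b = B (m ℕ.∸ j)
    eq : faulhaberTerm N m j ≡ P ^ r * (c * (P ^ e * i) * (P * b))
    eq = begin
      c * i * (ℕ→ℚ N ^ suc j * b)             ≡⟨ cong (λ z → c * i * (z * b)) (trans N^≡ (^-homo-* P r (suc e))) ⟩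
      c * i * (P ^ r * (P * P ^ e) * b)       ≡⟨ solve 6 (λ c i q P e b → c :* i :* (q :* (P :* e) :* b) := q :* (c :* (e :* i) :* (P :* b))) refl c i (P ^ r) P (P ^ e) b ⟩
      P ^ r * (c * (P ^ e * i) * (P * b))     ∎

  faulhaberTerm-0 : ∀ N m → faulhaberTerm N m 0 ≡ ℕ→ℚ N * B m
  faulhaberTerm-0 N m = solve 2 (λ x b → con (+ 1) :* con (+ 1) :* (x :* con (+ 1) :* b) := x :* b) refl (ℕ→ℚ N) (B m)

  -- The part of von Staudt-Clausen that bounds the denominator, by strong induction: Faulhaber's
  -- formula for N = p expresses p B_m as an integral power sum minus terms with lower Bernoulli
  -- numbers.
  P*B-integral : ∀ m → Integral (P * B m)
  P*B-integral m = below (suc m) m ℕₚ.≤-refl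
    where
    below : ∀ M m → m < M → Integral (P * B m)
    below (suc M) m m<M = subst Integral first
      (+-integral (Σ-integral p (λ a → ℕ→ℚ a ^ m) (λ a _ → ^-integral m (ℕ-integral a))) (neg-integral rest))
      where
      t = faulhaberTerm p m
      rest : Integral (Σ< m (t ∘ suc))
      rest = Σ-integral m (t ∘ suc) (λ j j<m → ≈-integral
        (faulhaberTerm-≈0 1 j p m (suc j) refl (ℕₚ.m∸n≤m j 4)
          (below M (m ℕ.∸ suc j) (ℕₚ.≤-trans (ℕₚ.∸-monoʳ-< (s≤s z≤n) j<m) (ℕₚ.≤-pred m<M))))
        (ℤ-integral (+ 0)))
      first : powerSum m p - Σ< m (t ∘ suc) ≡ P * B m
      first = trans (cong (_- Σ< m (t ∘ suc)) (faulhaber m p))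
        (trans (solve 2 (λ x y → (x :+ y) :- y := x) refl (t 0) (Σ< m (t ∘ suc))) (faulhaberTerm-0 p m))

  powerSum-p-mod1 : ∀ m → powerSum m p ≈ P * B m [mod 1 ]
  powerSum-p-mod1 m = subst₂ (_≈_[mod 1 ]) (sym (faulhaber m p)) (trans (+-identityʳ (t 0)) (faulhaberTerm-0 p m))
    (≈-+ (≈-refl {x = t 0}) (Σ-≈0 m (t ∘ suc) (λ j _ → faulhaberTerm-≈0 1 j p m (suc j) refl (ℕₚ.m∸n≤m j 4) (P*B-integral (m ℕ.∸ suc j)))))
    where t = faulhaberTerm p m

  -- Of the first five terms, j = 1 and j = 3 carry Bernoulli numbers assumed to vanish. The term j
  -- = 4 has exactly p^5, with nothing left over for denominators, so B_k itself must be integral;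
  -- its factor 1/5 is integral as p ≥ 7.
  powerSum-p-mod5 : ∀ k → B (3 ℕ.+ k) ≡ 0ℚ → B (1 ℕ.+ k) ≡ 0ℚ → Integral (B k) →
    powerSum (4 ℕ.+ k) p ≈ P * B (4 ℕ.+ k) + choose (4 ℕ.+ k) 2 * inv 3 * (P ^ 3 * B (2 ℕ.+ k)) [mod 5 ]
  powerSum-p-mod5 k B₃≡0 B₁≡0 iB = subst₂ (_≈_[mod 5 ]) (sym (faulhaber m p)) total
    (≈-+ (≈-refl {x = t 0}) (≈-+ (≡⇒≈ {x = t 1} (vanish 1 B₃≡0)) (≈-+ (≈-refl {x = t 2}) (≈-+ (≡⇒≈ {x = t 3} (vanish 3 B₁≡0)) (≈-+ t₄≈0
      -- At index 5+j the power p^(6+j) leaves p^j for the denominator 6+j, exactly what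
      -- `P^*inv-integral` asks for.
      (Σ-≈0 k (λ j → t (5 ℕ.+ j)) (λ j _ → faulhaberTerm-≈0 5 j p m (5 ℕ.+ j) refl ℕₚ.≤-refl (P*B-integral (m ℕ.∸ (5 ℕ.+ j))))))))))
    where
    m = 4 ℕ.+ k
    t = faulhaberTerm p m
    vanish : ∀ j → B (m ℕ.∸ j) ≡ 0ℚ → t j ≡ 0ℚ
    vanish j e = trans (cong (λ b → choose m j * inv (suc j) * (P ^ suc j * b)) e)
      (solve 2 (λ x y → x :* (y :* con (+ 0)) := con (+ 0)) refl (choose m j * inv (suc j)) (P ^ suc j))
    t₄≈0 : t 4 ≈ 0ℚ [mod 5 ]
    t₄≈0 = subst (_≈ 0ℚ [mod 5 ])
      (solve 3 (λ x y b → y :* (x :* b) := x :* (y :* b)) refl (choose m 4 * inv 5) (P ^ 5) (B k))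
      (≈0⇒ (*-integral (*-integral (ℕ-integral (m C 4)) (inv-integral (∤-<7 5 {s≤s (s≤s (s≤s (s≤s (s≤s z≤n))))}))) iB))
    total : t 0 + (0ℚ + (t 2 + (0ℚ + (0ℚ + 0ℚ)))) ≡ P * B m + choose m 2 * inv 3 * (P ^ 3 * B (2 ℕ.+ k))
    total = trans (solve 2 (λ x y → x :+ (con (+ 0) :+ (y :+ (con (+ 0) :+ (con (+ 0) :+ con (+ 0))))) := x :+ y) refl (t 0) (t 2))
      (cong (_+ t 2) (faulhaberTerm-0 p m))

  -- The range is p^2 rather than p so that a congruence modulo p^2 survives division by the range,
  -- as Kummer's congruence requires.
  powerSum-p²-mod4 : ∀ k → B k ≡ 0ℚ → powerSum (suc k) (p ℕ.^ 2) ≈ P ^ 2 * B (suc k) [mod 4 ]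
  powerSum-p²-mod4 k B≡0 = subst₂ (_≈_[mod 4 ]) (sym (faulhaber (suc k) N)) total
    (≈-+ (≈-refl {x = t 0}) (≈-+ (≡⇒≈ {x = t 1} t₁≡0)
      (Σ-≈0 k (λ j → t (2 ℕ.+ j)) (λ j _ → faulhaberTerm-≈0 4 (suc (2 ℕ.* j)) N (suc k) (2 ℕ.+ j) (exponent j)
        (ℕₚ.≤-trans (ℕₚ.m∸n≤m j 3) (ℕₚ.≤-trans (ℕₚ.m≤m+n j (j ℕ.+ 0)) (ℕₚ.n≤1+n (2 ℕ.* j)))) (P*B-integral (suc k ℕ.∸ (2 ℕ.+ j)))))))
    where
    N = p ℕ.^ 2
    t = faulhaberTerm N (suc k)
    exponent : ∀ j → ℕ→ℚ N ^ (3 ℕ.+ j) ≡ P ^ (4 ℕ.+ suc (suc (2 ℕ.* j)))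
    exponent j = trans (cong (_^ (3 ℕ.+ j)) (ℕ→ℚ-^ p 2)) (trans (^-assocʳ P 2 (3 ℕ.+ j))
      (cong (P ^_) (trans (2*suc (2 ℕ.+ j)) (cong (2 ℕ.+_) (trans (2*suc (1 ℕ.+ j)) (cong (2 ℕ.+_) (2*suc j)))))))
    t₁≡0 : t 1 ≡ 0ℚ
    t₁≡0 = trans (cong (λ b → choose (suc k) 1 * inv 2 * (ℕ→ℚ N ^ 2 * b)) B≡0)
      (solve 2 (λ x y → x :* (y :* con (+ 0)) := con (+ 0)) refl (choose (suc k) 1 * inv 2) (ℕ→ℚ N ^ 2))
    total : t 0 + (0ℚ + 0ℚ) ≡ P ^ 2 * B (suc k)
    total = trans (+-identityʳ (t 0)) (trans (faulhaberTerm-0 N (suc k)) (cong (_* B (suc k)) (ℕ→ℚ-^ p 2)))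

  -- The doubling congruence and the integrality of Bernoulli numbers

  ^-first-order : ∀ k {x y} → Integral x → Integral y →
    ∃ λ z → Integral z × (x + y) ^ suc k ≡ x ^ suc k + y * (ℕ→ℚ (suc k) * x ^ k) + y * y * z
  ^-first-order zero    {x} {y} ix iy = 0ℚ , ℤ-integral (+ 0) ,
    solve 2 (λ x y → (x :+ y) :* con (+ 1) := x :* con (+ 1) :+ y :* (con (+ 1) :* con (+ 1)) :+ y :* y :* con (+ 0)) refl x y
  ^-first-order (suc k) {x} {y} ix iy with ^-first-order k ix iy
  ... | z , iz , e = c * x ^ k + x * z + y * z ,
    +-integral (+-integral (*-integral (ℕ-integral (suc k)) (^-integral k ix)) (*-integral ix iz)) (*-integral iy iz) , (begin
    (x + y) * (x + y) ^ suc k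
      ≡⟨ cong ((x + y) *_) e ⟩
    (x + y) * (x * x ^ k + y * (c * x ^ k) + y * y * z)
      ≡⟨ solve 5 (λ x y c w z → (x :+ y) :* (x :* w :+ y :* (c :* w) :+ y :* y :* z)
           := x :* (x :* w) :+ y :* ((con (+ 1) :+ c) :* (x :* w)) :+ y :* y :* (c :* w :+ x :* z :+ y :* z)) refl x y c (x ^ k) z ⟩
    x * (x * x ^ k) + y * ((1ℚ + c) * (x * x ^ k)) + y * y * (c * x ^ k + x * z + y * z)
      ≡⟨ cong (λ d → x * (x * x ^ k) + y * (d * (x * x ^ k)) + y * y * (c * x ^ k + x * z + y * z)) (ℕ→ℚ-suc (suc k)) ⟨
    x * (x * x ^ k) + y * (ℕ→ℚ (suc (suc k)) * (x * x ^ k)) + y * y * (c * x ^ k + x * z + y * z) ∎)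
    where
    open ≡-Reasoning
    c = ℕ→ℚ (suc k)

  oddPowerSum : ℕ → ℕ → ℚ
  oddPowerSum n k = Σ< n (λ i → ℕ→ℚ (suc (2 ℕ.* i)) ^ k)

  -- Each difference (o + N)^(k+1) - o^(k+1) in `powerSum-doubling` is expanded to first order in N
  -- = p^s; the remainder is a multiple of N^2.
  doubling-mod : ∀ s N n k → ℕ→ℚ N ≡ P ^ s → N ≡ suc (2 ℕ.* n) →
    (ℕ→ℚ 2 ^ suc k - 1ℚ) * powerSum (suc k) N ≈ P ^ s * (ℕ→ℚ (suc k) * oddPowerSum n k) [mod s ℕ.+ s ]
  doubling-mod s N n k N≡P^s refl = subst₂ (_≈_[mod s ℕ.+ s ]) (sym (powerSum-doubling (suc k) n)) factor
    (Σ-≈ n (λ i → (o i + ℕ→ℚ N) ^ suc k + -1ℚ * o i ^ suc k) (λ i → P ^ s * (ℕ→ℚ (suc k) * o i ^ k)) (λ i _ → step i))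
    where
    o : ℕ → ℚ
    o i = ℕ→ℚ (suc (2 ℕ.* i))
    factor : Σ< n (λ i → P ^ s * (ℕ→ℚ (suc k) * o i ^ k)) ≡ P ^ s * (ℕ→ℚ (suc k) * oddPowerSum n k)
    factor = trans (Σ-* n (P ^ s) (λ i → ℕ→ℚ (suc k) * o i ^ k)) (cong (P ^ s *_) (Σ-* n (ℕ→ℚ (suc k)) (λ i → o i ^ k)))
    step : ∀ i → (o i + ℕ→ℚ N) ^ suc k + -1ℚ * o i ^ suc k ≈ P ^ s * (ℕ→ℚ (suc k) * o i ^ k) [mod s ℕ.+ s ]
    step i with ^-first-order k (ℕ-integral (suc (2 ℕ.* i))) (^-integral s P-integral)
    ... | z , iz , e = iz at (begin
      (o i + ℕ→ℚ N) ^ suc k + -1ℚ * o i ^ suc k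
        ≡⟨ cong (λ y → (o i + y) ^ suc k + -1ℚ * o i ^ suc k) N≡P^s ⟩
      (o i + P ^ s) ^ suc k + -1ℚ * o i ^ suc k
        ≡⟨ cong (_+ -1ℚ * o i ^ suc k) e ⟩
      (o i ^ suc k + P ^ s * (ℕ→ℚ (suc k) * o i ^ k) + P ^ s * P ^ s * z) + -1ℚ * o i ^ suc k
        ≡⟨ solve 3 (λ x y z → (x :+ y :+ z) :+ con (-[1+ 0 ]) :* x := y :+ z) refl (o i ^ suc k) (P ^ s * (ℕ→ℚ (suc k) * o i ^ k)) (P ^ s * P ^ s * z) ⟩
      P ^ s * (ℕ→ℚ (suc k) * o i ^ k) + P ^ s * P ^ s * z
        ≡⟨ cong (λ q → P ^ s * (ℕ→ℚ (suc k) * o i ^ k) + q * z) (^-homo-* P s s) ⟨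
      P ^ s * (ℕ→ℚ (suc k) * o i ^ k) + P ^ (s ℕ.+ s) * z ∎)
      where open ≡-Reasoning

  2^ : ℕ → ℕ
  2^ k = 2 ℕ.^ k ℕ.∸ 1

  2^-1 : ∀ k → ℕ→ℚ (2^ k) ≡ ℕ→ℚ 2 ^ k - 1ℚ
  2^-1 k = begin
    ℕ→ℚ (2^ k)                 ≡⟨ solve 1 (λ x → x := (con (+ 1) :+ x) :- con (+ 1)) refl (ℕ→ℚ (2^ k)) ⟩
    (1ℚ + ℕ→ℚ (2^ k)) - 1ℚ     ≡⟨ cong (_- 1ℚ) (ℕ→ℚ-+ 1 (2^ k)) ⟨
    ℕ→ℚ (1 ℕ.+ 2^ k) - 1ℚ      ≡⟨ cong (λ n → ℕ→ℚ n - 1ℚ) (ℕₚ.m+[n∸m]≡n (ℕₚ.m^n>0 2 k)) ⟩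
    ℕ→ℚ (2 ℕ.^ k) - 1ℚ         ≡⟨ cong (_- 1ℚ) (ℕ→ℚ-^ 2 k) ⟩
    ℕ→ℚ 2 ^ k - 1ℚ             ∎
    where open ≡-Reasoning

  p-odd : ∃ λ M → p ≡ suc (2 ℕ.* M)
  p-odd with p ℕ.% 2 in r | m≡m%n+[m/n]*n p 2 | m%n<n p 2
  ... | 0 | e | _ = ⊥-elim ([ (λ ()) , (λ 2≡p → ℕₚ.<⇒≢ (ℕₚ.≤-trans (s≤s (s≤s (s≤s z≤n))) 7≤p) 2≡p) ]′
                      (prime⇒irreducible p-prime (divides (p ℕ./ 2) e)))
  ... | 1 | e | _ = p ℕ./ 2 , trans e (cong suc (ℕₚ.*-comm (p ℕ./ 2) 2))
  ... | suc (suc _) | _ | s≤s (s≤s ())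

  halfP : ℕ
  halfP = proj₁ p-odd

  p²-odd : p ℕ.^ 2 ≡ suc (2 ℕ.* (p ℕ.* halfP ℕ.+ halfP))
  p²-odd = begin
    p ℕ.* (p ℕ.* 1)                          ≡⟨ cong (λ q → p ℕ.* q) (trans (ℕₚ.*-identityʳ p) (proj₂ p-odd)) ⟩
    p ℕ.* suc (2 ℕ.* halfP)                  ≡⟨ ℕₚ.*-suc p (2 ℕ.* halfP) ⟩
    p ℕ.+ p ℕ.* (2 ℕ.* halfP)                ≡⟨ cong (ℕ._+ p ℕ.* (2 ℕ.* halfP)) (proj₂ p-odd) ⟩
    suc (2 ℕ.* halfP ℕ.+ p ℕ.* (2 ℕ.* halfP)) ≡⟨ cong suc (NS.solve 2 (λ p h → NS.con 2 NS.:* h NS.:+ p NS.:* (NS.con 2 NS.:* h) NS.:= NS.con 2 NS.:* (p NS.:* h NS.:+ h)) refl p halfP) ⟩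
    suc (2 ℕ.* (p ℕ.* halfP ℕ.+ halfP))      ∎
    where open ≡-Reasoning

  *-reassoc : ∀ x y z → x * (y * z) ≡ y * (x * z)
  *-reassoc = solve 3 (λ x y z → x :* (y :* z) := y :* (x :* z)) refl

  -- Modulo p, p B_(k+1) is a power sum, and doubling shows that 2^(k+1) - 1 times this sum is 0.
  -- Dividing by p makes (2^(k+1) - 1) B_(k+1) integral, and the factor is a unit.
  B-integral : ∀ k → ¬ p ∣ 2^ (suc k) → Integral (B (suc k))
  B-integral k p∤ = subst Integral cancel (*-integral (inv-integral p∤) product)
    where
    u = ℕ→ℚ 2 ^ suc k - 1ℚ
    b = B (suc k)
    u-integral : Integral u
    u-integral = +-integral (^-integral (suc k) (ℕ-integral 2)) (neg-integral (ℤ-integral (+ 1)))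
    P*≈0 : P * (u * b) ≈ P * 0ℚ [mod 1 ]
    P*≈0 = subst₂ (_≈_[mod 1 ]) (*-reassoc u P b) (sym (*-zeroʳ P))
      (≈-trans (≈-*ˡ u-integral (≈-sym (powerSum-p-mod1 (suc k))))
      (≈-trans (≈-weaken (doubling-mod 1 p halfP k (sym (*-identityʳ P)) (proj₂ p-odd)))
               (≈0⇒ (*-integral (ℕ-integral (suc k)) (Σ-integral halfP _ (λ i _ → ^-integral k (ℕ-integral (suc (2 ℕ.* i)))))))))
    product : Integral (u * b)
    product = ≈-integral (≈-P*⁻¹ {r = 0} P*≈0) (ℤ-integral (+ 0))
    2^≢0 : 2^ (suc k) ≢ 0
    2^≢0 e = p∤ (divides 0 e)
    cancel : inv (2^ (suc k)) * (u * b) ≡ b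
    cancel = begin
      inv (2^ (suc k)) * (u * b)                  ≡⟨ cong (λ v → inv (2^ (suc k)) * (v * b)) (2^-1 (suc k)) ⟨
      inv (2^ (suc k)) * (ℕ→ℚ (2^ (suc k)) * b)   ≡⟨ solve 3 (λ i v b → i :* (v :* b) := (v :* i) :* b) refl (inv (2^ (suc k))) (ℕ→ℚ (2^ (suc k))) b ⟩
      (ℕ→ℚ (2^ (suc k)) * inv (2^ (suc k))) * b   ≡⟨ cong (_* b) (*-inv (2^ (suc k)) 2^≢0) ⟩
      1ℚ * b                                      ≡⟨ *-identityˡ b ⟩
      b                                           ∎
      where open ≡-Reasoning

  -- Fermat's theorem and Fermat quotients

  -- Induction on a by the binomial theorem: (k+1) C(p,k+1) = p C(p-1,k) makes the middle
  -- coefficients vanish modulo p.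
  fermat : ∀ a → ℕ→ℚ a ^ p ≈ ℕ→ℚ a [mod 1 ]
  fermat a = subst (λ q → ℕ→ℚ a ^ q ≈ ℕ→ℚ a [mod 1 ]) (ℕₚ.suc-pred p {{prime⇒nonZero p-prime}}) (go a)
    where
    p₁ = ℕ.pred p
    p≡ : suc p₁ ≡ p
    p≡ = ℕₚ.suc-pred p {{prime⇒nonZero p-prime}}
    choose≈0 : ∀ k → k < p₁ → choose (suc p₁) (suc k) ≈ 0ℚ [mod 1 ]
    choose≈0 k k<p₁ = ≈-cancelˡ-ℕ (suc k) (∤-< (λ ()) (subst (suc k <_) p≡ (s≤s k<p₁)))
      (subst₂ (_≈_[mod 1 ]) (sym (choose-absorb p₁ k)) (sym (*-zeroʳ (ℕ→ℚ (suc k))))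
        (subst (λ q → ℕ→ℚ q * choose p₁ k ≈ 0ℚ [mod 1 ]) (sym p≡)
          (subst (λ q → q * choose p₁ k ≈ 0ℚ [mod 1 ]) (*-identityʳ P) (≈0⇒ (ℕ-integral (p₁ C k))))))
    go : ∀ a → ℕ→ℚ a ^ suc p₁ ≈ ℕ→ℚ a [mod 1 ]
    go zero    = ≡⇒≈ (pow-0 (suc p₁))
    go (suc a) = subst₂ (_≈_[mod 1 ]) lhs rhs′
      (≈-+ (≈-refl {x = t 0}) (≈-+ (Σ-≈0 p₁ (t ∘ suc) middle) (≈-trans (≡⇒≈ top) (go a))))
      where
      open ≡-Reasoning
      x = ℕ→ℚ a
      t : ℕ → ℚ
      t k = choose (suc p₁) k * (x ^ k * 1ℚ ^ (suc p₁ ℕ.∸ k))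
      middle : ∀ k → k < p₁ → t (suc k) ≈ 0ℚ [mod 1 ]
      middle k k<p₁ = subst (t (suc k) ≈_[mod 1 ]) (*-zeroˡ (x ^ suc k * 1ℚ ^ (p₁ ℕ.∸ k)))
        (≈-*ʳ (*-integral (^-integral (suc k) (ℕ-integral a)) (^-integral (p₁ ℕ.∸ k) (ℤ-integral (+ 1)))) (choose≈0 k k<p₁))
      top : t (suc p₁) ≡ x ^ suc p₁
      top = trans (cong₂ (λ c o → ℕ→ℚ c * (x ^ suc p₁ * o)) (nCn≡1 (suc p₁)) (1^n≡1 (p₁ ℕ.∸ p₁)))
        (solve 1 (λ y → con (+ 1) :* (y :* con (+ 1)) := y) refl (x ^ suc p₁))
      lhs : t 0 + (Σ< p₁ (t ∘ suc) + t (suc p₁)) ≡ ℕ→ℚ (suc a) ^ suc p₁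
      lhs = begin
        t 0 + (Σ< p₁ (t ∘ suc) + t (suc p₁))   ≡⟨ cong (λ z → t 0 + z) (Σ-snoc p₁ (t ∘ suc)) ⟨
        Σ< (suc (suc p₁)) t                    ≡⟨ ⋆-Σ (suc p₁) (pow x) (pow 1ℚ) ⟨
        (pow x ⋆ pow 1ℚ) (suc p₁)              ≡⟨ pow-⋆ (suc p₁) x 1ℚ ⟩
        (x + 1ℚ) ^ suc p₁                      ≡⟨ cong (_^ suc p₁) (trans (+-comm x 1ℚ) (sym (ℕ→ℚ-suc a))) ⟩
        ℕ→ℚ (suc a) ^ suc p₁                   ∎
      rhs′ : t 0 + (0ℚ + x) ≡ ℕ→ℚ (suc a)
      rhs′ = trans (cong₂ _+_ (trans (*-identityˡ (1ℚ * 1ℚ ^ suc p₁)) (trans (*-identityˡ (1ℚ ^ suc p₁)) (1^n≡1 (suc p₁)))) (+-identityˡ x)) (sym (ℕ→ℚ-suc a))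

  opaque
    fermatQuotient : ℕ → ℚ
    fermatQuotient a = (ℕ→ℚ a ^ (p ℕ.∸ 1) - 1ℚ) * inv p

    ^[p-1] : ∀ a → ℕ→ℚ a ^ (p ℕ.∸ 1) ≡ 1ℚ + P * fermatQuotient a
    ^[p-1] a = begin
      x                             ≡⟨ solve 1 (λ x → x := con (+ 1) :+ con (+ 1) :* (x :- con (+ 1))) refl x ⟩
      1ℚ + 1ℚ * (x - 1ℚ)            ≡⟨ cong (λ z → 1ℚ + z * (x - 1ℚ)) (*-inv p p≢0) ⟨
      1ℚ + P * inv p * (x - 1ℚ)     ≡⟨ solve 3 (λ p i y → con (+ 1) :+ p :* i :* y := con (+ 1) :+ p :* (y :* i)) refl P (inv p) (x - 1ℚ) ⟩
      1ℚ + P * ((x - 1ℚ) * inv p)   ∎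
      where
      open ≡-Reasoning
      x : ℚ
      x = ℕ→ℚ a ^ (p ℕ.∸ 1)

    fermatQuotient-integral : ∀ a → ¬ p ∣ a → Integral (fermatQuotient a)
    fermatQuotient-integral a p∤a = ≈-integral (≈-P*⁻¹ {r = 0} {y = 0ℚ}
      (subst₂ (_≈_[mod 1 ]) (trans (cong (_- 1ℚ) (^[p-1] a)) (solve 1 (λ x → (con (+ 1) :+ x) :- con (+ 1) := x) refl (P * fermatQuotient a))) (sym (*-zeroʳ P))
        (≈-- ^[p-1]≈1 (≈-refl {x = 1ℚ})))) (ℤ-integral (+ 0))
      where
      ^[p-1]≈1 : ℕ→ℚ a ^ (p ℕ.∸ 1) ≈ 1ℚ [mod 1 ]
      ^[p-1]≈1 = ≈-cancelˡ-ℕ a p∤a (subst₂ (_≈_[mod 1 ])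
        (cong (ℕ→ℚ a ^_) (sym (ℕₚ.suc-pred p {{prime⇒nonZero p-prime}}))) (sym (*-identityʳ (ℕ→ℚ a))) (fermat a))

  ^≈1 : ∀ a n → ¬ p ∣ a → ℕ→ℚ a ^ (n ℕ.* (p ℕ.∸ 1)) ≈ 1ℚ [mod 1 ]
  ^≈1 a n p∤a = subst₂ (_≈_[mod 1 ]) (trans (^-assocʳ (ℕ→ℚ a) (p ℕ.∸ 1) n) (cong (ℕ→ℚ a ^_) (ℕₚ.*-comm (p ℕ.∸ 1) n))) (1^n≡1 n)
    (≈-^ n (ℤ-integral (+ 1)) (subst (_≈ 1ℚ [mod 1 ]) (sym (^[p-1] a))
      (subst (1ℚ + P * fermatQuotient a ≈_[mod 1 ]) (+-identityʳ 1ℚ)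
        (≈-+ (≈-refl {x = 1ℚ}) (subst (_≈ 0ℚ [mod 1 ]) (cong (_* fermatQuotient a) (*-identityʳ P)) (≈0⇒ (fermatQuotient-integral a p∤a)))))))

  -- Modulo p the numbers 2^k and 2^i are inverse to each other, so 2^k = 1 would force 2^i = 1.
  -- This trades the large exponents n(p-1) - 2 and n(p-1) - 4 for 2 and 4.
  ∤-2^ : ∀ k i n → k ℕ.+ i ≡ n ℕ.* (p ℕ.∸ 1) → ¬ p ∣ 2^ i → ¬ p ∣ 2^ k
  ∤-2^ k i n k+i≡ p∤2^i p∣2^k = p∤2^i (≈0⇒∣ (2^ i) (subst (_≈ 0ℚ [mod 1 ]) (sym (2^-1 i))
    (≈-trans (≈-- (≈-sym 1≈2^i) (≈-refl {x = 1ℚ})) (≡⇒≈ refl))))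
    where
    2^k≈1 : ℕ→ℚ 2 ^ k ≈ 1ℚ [mod 1 ]
    2^k≈1 = subst₂ (_≈_[mod 1 ]) (trans (cong (_+ 1ℚ) (2^-1 k)) (solve 1 (λ x → (x :- con (+ 1)) :+ con (+ 1) := x) refl (ℕ→ℚ 2 ^ k))) (+-identityˡ 1ℚ)
      (≈-+ (∣⇒≈0 p∣2^k) (≈-refl {x = 1ℚ}))
    1≈2^i : 1ℚ ≈ ℕ→ℚ 2 ^ i [mod 1 ]
    1≈2^i = ≈-trans (≈-sym (^≈1 2 n (∤-<7 2 {s≤s (s≤s z≤n)}))) (subst₂ (_≈_[mod 1 ])
      (trans (sym (^-homo-* (ℕ→ℚ 2) k i)) (cong (ℕ→ℚ 2 ^_) k+i≡)) (*-identityˡ (ℕ→ℚ 2 ^ i))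
      (≈-*ʳ (^-integral i (ℕ-integral 2)) 2^k≈1))

  -- The indices n(p-1), n(p-1) - 2 and n(p-1) - 4 for n = j + 1

  -- p = 2s + 5 with s > 0. In terms of s the three indices become 4 + 2t, 2 + 2t and 2t, free of
  -- truncated subtraction and with visible parity.
  s : ℕ
  s = halfP ℕ.∸ 2

  3≤halfP : 3 ≤ halfP
  3≤halfP = ℕₚ.*-cancelˡ-≤ 2 (ℕₚ.≤-pred (subst (7 ≤_) (proj₂ p-odd) 7≤p))

  halfP≡ : 2 ℕ.+ s ≡ halfP
  halfP≡ = ℕₚ.m+[n∸m]≡n (ℕₚ.≤-trans (s≤s (s≤s z≤n)) 3≤halfP)

  s≢0 : s ≢ 0
  s≢0 e = ℕₚ.<⇒≢ 3≤halfP (trans (cong (2 ℕ.+_) (sym e)) halfP≡)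

  p≡ : p ≡ suc (2 ℕ.* (2 ℕ.+ s))
  p≡ = trans (proj₂ p-odd) (cong (λ h → suc (2 ℕ.* h)) (sym halfP≡))

  p∸1≡ : p ℕ.∸ 1 ≡ 2 ℕ.* (2 ℕ.+ s)
  p∸1≡ = cong ℕ.pred p≡

  -- (j + 1)(p - 1) = 4 + 2 t j
  t : ℕ → ℕ
  t j = s ℕ.+ j ℕ.* (2 ℕ.+ s)

  t≢0 : ∀ j → t j ≢ 0
  t≢0 j e = s≢0 (ℕₚ.m+n≡0⇒m≡0 s e)

  *[p-1]≡ : ∀ j → suc j ℕ.* (p ℕ.∸ 1) ≡ 4 ℕ.+ 2 ℕ.* t j
  *[p-1]≡ j = trans (cong (suc j ℕ.*_) p∸1≡)
    (NS.solve 2 (λ s j → (NS.con 1 NS.:+ j) NS.:* (NS.con 2 NS.:* (NS.con 2 NS.:+ s)) NS.:= NS.con 4 NS.:+ NS.con 2 NS.:* (s NS.:+ j NS.:* (NS.con 2 NS.:+ s))) refl s j)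

  *p≡ : ∀ j → (2 ℕ.+ 2 ℕ.* t j) ℕ.+ (3 ℕ.+ j) ≡ suc j ℕ.* p
  *p≡ j = sym (trans (cong (suc j ℕ.*_) p≡)
    (NS.solve 2 (λ s j → (NS.con 1 NS.:+ j) NS.:* (NS.con 1 NS.:+ NS.con 2 NS.:* (NS.con 2 NS.:+ s)) NS.:= (NS.con 2 NS.:+ NS.con 2 NS.:* (s NS.:+ j NS.:* (NS.con 2 NS.:+ s))) NS.:+ (NS.con 3 NS.:+ j)) refl s j))

  t-step : ∀ j → suc (2 ℕ.* t j) ≡ suc (2 ℕ.* s) ℕ.+ j ℕ.* (p ℕ.∸ 1)
  t-step j = sym (trans (cong (λ q → suc (2 ℕ.* s) ℕ.+ j ℕ.* q) p∸1≡)
    (NS.solve 2 (λ s j → (NS.con 1 NS.:+ NS.con 2 NS.:* s) NS.:+ j NS.:* (NS.con 2 NS.:* (NS.con 2 NS.:+ s)) NS.:= NS.con 1 NS.:+ NS.con 2 NS.:* (s NS.:+ j NS.:* (NS.con 2 NS.:+ s))) refl s j))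

  -- The index equals (j+1)p - (j+3), and 3 ≤ j+3 ≤ 6 < p.
  p∤2+2t : ∀ j → j < 4 → ¬ p ∣ 2 ℕ.+ 2 ℕ.* t j
  p∤2+2t j j<4 p∣ = ∤-<7 (3 ℕ.+ j) {s≤s (s≤s (s≤s (ℕₚ.≤-pred j<4)))}
    (∣m+n∣m⇒∣n (subst (p ∣_) (sym (*p≡ j)) (divides (suc j) refl)) p∣)

  p∤2^[2+2t] : ∀ j → ¬ p ∣ 2^ (2 ℕ.+ 2 ℕ.* t j)
  p∤2^[2+2t] j = ∤-2^ (2 ℕ.+ 2 ℕ.* t j) 2 (suc j) (trans (ℕₚ.+-comm (2 ℕ.+ 2 ℕ.* t j) 2) (sym (*[p-1]≡ j))) (∤-<7 3 {s≤s (s≤s (s≤s z≤n))})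

  -- By `∤-2^` it suffices that p not divide 2^4 - 1 = 3 * 5.
  B[2t]-integral : ∀ j → Integral (B (2 ℕ.* t j))
  B[2t]-integral j with t j in tj
  ... | zero  = ⊥-elim (t≢0 j tj)
  ... | suc i = B-integral (i ℕ.+ suc (i ℕ.+ 0)) (∤-2^ (2 ℕ.* suc i) 4 (suc j)
    (trans (ℕₚ.+-comm (2 ℕ.* suc i) 4) (trans (cong (λ u → 4 ℕ.+ 2 ℕ.* u) (sym tj)) (sym (*[p-1]≡ j))))
    (∤-* {3} {5} (∤-<7 3 {s≤s (s≤s (s≤s z≤n))}) (∤-<7 5 {s≤s (s≤s (s≤s (s≤s (s≤s z≤n))))})))

  B[1+2t]≡0 : ∀ j → B (1 ℕ.+ 2 ℕ.* t j) ≡ 0ℚ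
  B[1+2t]≡0 j = B-odd (t j) (t≢0 j)

  B[3+2t]≡0 : ∀ j → B (3 ℕ.+ 2 ℕ.* t j) ≡ 0ℚ
  B[3+2t]≡0 j = trans (cong (B ∘ suc) (sym (2*suc (t j)))) (B-odd (suc (t j)) (λ ()))

  -- Kummer's congruence modulo p^2

  -- The shape that (1 + pq)^j takes modulo p^2. It is stable under sums and integral multiples, so
  -- whole power sums inherit it from their terms.
  record Affine (f : ℕ → ℚ) : Set where
    constructor affine
    field
      base-integral  : Integral (f 0)
      slope          : ℚ
      slope-integral : Integral slope
      approx         : ∀ j → f j ≈ f 0 + ℕ→ℚ j * (P * slope) [mod 2 ]

  affine-cong : ∀ {f g} → (∀ j → f j ≡ g j) → Affine f → Affine g
  affine-cong f≡g (affine ib d id a) = affine (subst Integral (f≡g 0) ib) d id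
    (λ j → subst₂ (λ u v → u ≈ v + ℕ→ℚ j * (P * d) [mod 2 ]) (f≡g j) (f≡g 0) (a j))

  affine-const : ∀ {c} → Integral c → Affine (λ _ → c)
  affine-const {c} ic = affine ic 0ℚ (ℤ-integral (+ 0))
    (λ j → ≡⇒≈ (solve 3 (λ c n p → c := c :+ n :* (p :* con (+ 0))) refl c (ℕ→ℚ j) P))

  affine-+ : ∀ {f g} → Affine f → Affine g → Affine (λ j → f j + g j)
  affine-+ {f} {g} (affine ib d id a) (affine ib′ d′ id′ a′) = affine (+-integral ib ib′) (d + d′) (+-integral id id′)
    (λ j → subst (f j + g j ≈_[mod 2 ])
      (solve 6 (λ f g n p d e → (f :+ n :* (p :* d)) :+ (g :+ n :* (p :* e)) := (f :+ g) :+ n :* (p :* (d :+ e))) refl (f 0) (g 0) (ℕ→ℚ j) P d d′)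
      (≈-+ (a j) (a′ j)))

  affine-* : ∀ {c f} → Integral c → Affine f → Affine (λ j → c * f j)
  affine-* {c} {f} ic (affine ib d id a) = affine (*-integral ic ib) (c * d) (*-integral ic id)
    (λ j → subst (c * f j ≈_[mod 2 ])
      (solve 5 (λ c f n p d → c :* (f :+ n :* (p :* d)) := c :* f :+ n :* (p :* (c :* d))) refl c (f 0) (ℕ→ℚ j) P d)
      (≈-*ˡ ic (a j)))

  affine-Σ : ∀ n (f : ℕ → ℕ → ℚ) → (∀ i → Affine (f i)) → Affine (λ j → Σ< n (λ i → f i j))
  affine-Σ zero    f a = affine-const (ℤ-integral (+ 0))
  affine-Σ (suc n) f a = affine-+ (a 0) (affine-Σ n (f ∘ suc) (a ∘ suc))

  affine-≈0 : ∀ f → (∀ j → f j ≈ 0ℚ [mod 2 ]) → Affine f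
  affine-≈0 f f≈0 = affine (≈-integral (f≈0 0) (ℤ-integral (+ 0))) 0ℚ (ℤ-integral (+ 0))
    (λ j → subst (f j ≈_[mod 2 ]) (solve 3 (λ c n p → c := c :+ n :* (p :* con (+ 0))) refl (f 0) (ℕ→ℚ j) P) (≈-trans (f≈0 j) (≈-sym (f≈0 0))))

  [1+Pq]^-affine : ∀ {q} → Integral q → ∀ j → (1ℚ + P * q) ^ j ≈ 1ℚ + ℕ→ℚ j * (P * q) [mod 2 ]
  [1+Pq]^-affine {q} iq zero    = ≡⇒≈ (solve 1 (λ x → con (+ 1) := con (+ 1) :+ con (+ 0) :* x) refl (P * q))
  [1+Pq]^-affine {q} iq (suc j) = ≈-trans
    (≈-*ˡ (+-integral (ℤ-integral (+ 1)) (*-integral P-integral iq)) ([1+Pq]^-affine iq j))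
    (subst (λ n → (1ℚ + P * q) * (1ℚ + ℕ→ℚ j * (P * q)) ≈ 1ℚ + n * (P * q) [mod 2 ]) (sym (ℕ→ℚ-suc j))
      (solveMod 2 ((con (+ 1) :+ p′ :* q′) :* (con (+ 1) :+ j′ :* (p′ :* q′))) (con (+ 1) :+ (con (+ 1) :+ j′) :* (p′ :* q′))
        (iq ∷ ℕ-integral j ∷ [])))
    where
    p′ q′ j′ : Polynomial 3
    p′ = var fz
    q′ = var (fs fz)
    j′ = var (fs (fs fz))

  -- Each step in j raises the exponent by p-1, i.e. multiplies by 1 + p q_a. If p divides a, the
  -- power is 0 modulo p^2, since the exponent is at least 2.
  affine-^ : ∀ a → Affine (λ j → ℕ→ℚ a ^ suc (2 ℕ.* t j))
  affine-^ a with p ∣? a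
  ... | yes (divides q refl) = affine-≈0 _ (λ j → divisible (2 ℕ.* t j) (2t≢0 j))
    where
    2t≢0 : ∀ j → 2 ℕ.* t j ≢ 0
    2t≢0 j e = t≢0 j (ℕₚ.m+n≡0⇒m≡0 (t j) e)
    divisible : ∀ k → k ≢ 0 → ℕ→ℚ (q ℕ.* p) ^ suc k ≈ 0ℚ [mod 2 ]
    divisible zero    k≢0 = ⊥-elim (k≢0 refl)
    divisible (suc k) _   = subst (λ x → x * (x * ℕ→ℚ (q ℕ.* p) ^ k) ≈ 0ℚ [mod 2 ]) (sym (ℕ→ℚ-* q p))
      (subst (_≈ 0ℚ [mod 2 ]) (solve 3 (λ p q y → p :* (p :* con (+ 1)) :* (q :* q :* y) := (q :* p) :* ((q :* p) :* y)) refl P (ℕ→ℚ q) (ℕ→ℚ (q ℕ.* p) ^ k))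
        (≈0⇒ (*-integral (*-integral (ℕ-integral q) (ℕ-integral q)) (^-integral k (ℕ-integral (q ℕ.* p))))))
  ... | no p∤a = affine-cong (λ j → sym (split j)) (affine-* (^-integral (suc (2 ℕ.* s)) (ℕ-integral a))
          (affine (ℤ-integral (+ 1)) (fermatQuotient a) (fermatQuotient-integral a p∤a) ([1+Pq]^-affine (fermatQuotient-integral a p∤a))))
    where
    split : ∀ j → ℕ→ℚ a ^ suc (2 ℕ.* t j) ≡ ℕ→ℚ a ^ suc (2 ℕ.* s) * (1ℚ + P * fermatQuotient a) ^ j
    split j = begin
      ℕ→ℚ a ^ suc (2 ℕ.* t j)                                       ≡⟨ cong (ℕ→ℚ a ^_) (t-step j) ⟩
      ℕ→ℚ a ^ (suc (2 ℕ.* s) ℕ.+ j ℕ.* (p ℕ.∸ 1))                   ≡⟨ ^-homo-* (ℕ→ℚ a) (suc (2 ℕ.* s)) (j ℕ.* (p ℕ.∸ 1)) ⟩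
      ℕ→ℚ a ^ suc (2 ℕ.* s) * ℕ→ℚ a ^ (j ℕ.* (p ℕ.∸ 1))             ≡⟨ cong (λ e → ℕ→ℚ a ^ suc (2 ℕ.* s) * ℕ→ℚ a ^ e) (ℕₚ.*-comm j (p ℕ.∸ 1)) ⟩
      ℕ→ℚ a ^ suc (2 ℕ.* s) * ℕ→ℚ a ^ ((p ℕ.∸ 1) ℕ.* j)             ≡⟨ cong (ℕ→ℚ a ^ suc (2 ℕ.* s) *_) (^-assocʳ (ℕ→ℚ a) (p ℕ.∸ 1) j) ⟨
      ℕ→ℚ a ^ suc (2 ℕ.* s) * (ℕ→ℚ a ^ (p ℕ.∸ 1)) ^ j               ≡⟨ cong (λ x → ℕ→ℚ a ^ suc (2 ℕ.* s) * x ^ j) (^[p-1] a) ⟩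
      ℕ→ℚ a ^ suc (2 ℕ.* s) * (1ℚ + P * fermatQuotient a) ^ j       ∎
      where open ≡-Reasoning

  opaque
    g : ℕ → ℚ
    g j = B (2 ℕ.+ 2 ℕ.* t j) * inv (2 ℕ.+ 2 ℕ.* t j)

    Bbar2≡g : ∀ j → Bbar2 p (suc j) ≡ g j
    Bbar2≡g j = cong (λ m → B (m ℕ.∸ 2) * inv (m ℕ.∸ 2)) (*[p-1]≡ j)

    g-integral : ∀ j → j < 4 → Integral (g j)
    g-integral j j<4 = *-integral (B-integral (suc (2 ℕ.* t j)) (p∤2^[2+2t] j)) (inv-integral (p∤2+2t j j<4))

    *g≡B : ∀ j → ℕ→ℚ (2 ℕ.+ 2 ℕ.* t j) * g j ≡ B (2 ℕ.+ 2 ℕ.* t j)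
    *g≡B j = begin
      k * (b * inv K)    ≡⟨ solve 3 (λ k b i → k :* (b :* i) := (k :* i) :* b) refl k b (inv K) ⟩
      (k * inv K) * b    ≡⟨ cong (_* b) (*-inv K (λ ())) ⟩
      1ℚ * b             ≡⟨ *-identityˡ b ⟩
      b                  ∎
      where
      open ≡-Reasoning
      K : ℕ
      K = 2 ℕ.+ 2 ℕ.* t j
      k b : ℚ
      k = ℕ→ℚ K
      b = B K

  private
    n₂ : ℕ
    n₂ = p ℕ.* halfP ℕ.+ halfP
    u : ℕ → ℚ
    u j = ℕ→ℚ 2 ^ (2 ℕ.+ 2 ℕ.* t j) + -1ℚ

  -- With K = 2 + 2t, Faulhaber's formula and doubling for N = p^2 give p^2 (2^K - 1) B_K ≡ p^2 K Σ
  -- o^(K-1) modulo p^4, over the odd o < p^2. Then p^2 and the unit K are cancelled.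
  voronoi : ∀ j → j < 4 → u j * g j ≈ oddPowerSum n₂ (suc (2 ℕ.* t j)) [mod 2 ]
  voronoi j j<4 = ≈-cancelˡ-ℕ K (p∤2+2t j j<4) (subst (_≈ ℕ→ℚ K * h [mod 2 ])
    (trans (cong (u j *_) (sym (*g≡B j))) (*-reassoc (u j) (ℕ→ℚ K) (g j)))
    (≈-P*⁻¹ (≈-P*⁻¹ (subst₂ (_≈_[mod 4 ])
      (solve 3 (λ u p b → u :* (p :* (p :* con (+ 1)) :* b) := p :* (p :* (u :* b))) refl (u j) P (B K))
      (solve 2 (λ p h → p :* (p :* con (+ 1)) :* h := p :* (p :* h)) refl P (ℕ→ℚ K * h))
      (≈-trans (≈-*ˡ u-integral (≈-sym (powerSum-p²-mod4 (suc (2 ℕ.* t j)) (B[1+2t]≡0 j))))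
               (doubling-mod 2 (p ℕ.^ 2) n₂ (suc (2 ℕ.* t j)) (ℕ→ℚ-^ p 2) p²-odd))))))
    where
    K = 2 ℕ.+ 2 ℕ.* t j
    h = oddPowerSum n₂ (suc (2 ℕ.* t j))
    u-integral : Integral (u j)
    u-integral = +-integral (^-integral K (ℕ-integral 2)) (ℤ-integral -[1+ 0 ])

  -- Kummer's congruence: both factors of Voronoi's congruence are affine in j modulo p^2 with slope divisible by p.
  kummer : ∃ λ f → Integral f × (∀ j → j < 4 → g j ≈ g 0 + ℕ→ℚ j * (P * f) [mod 2 ])
  kummer = f , f-integral , λ j j<4 → ≈-cancelˡ-ℕ (2^ (K j)) (p∤2^[2+2t] j)
    (subst (λ w → w * g j ≈ w * (g 0 + ℕ→ℚ j * (P * f)) [mod 2 ]) (sym (2^-1 (K j)))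
      (≈-trans (≈-trans (voronoi j j<4) (≈-trans (H.approx j) (≈-+ (≈-sym (voronoi 0 (s≤s z≤n))) (≈-refl {x = ℕ→ℚ j * (P * d)}))))
        (≈-sym (≈-trans (≈-*ʳ (+-integral g₀-integral (*-integral (ℕ-integral j) (*-integral P-integral f-integral))) (U.approx j))
          (≈-trans (solveMod 2
            ((u′ :+ j′ :* (p′ :* e′)) :* (g′ :+ j′ :* (p′ :* f′)))
            (u′ :* g′ :+ j′ :* (p′ :* (u′ :* f′ :+ e′ :* g′)))
            (U.base-integral ∷ U.slope-integral ∷ g₀-integral ∷ f-integral ∷ ℕ-integral j ∷ []))
            (≡⇒≈ (cong (λ z → u 0 * g 0 + ℕ→ℚ j * (P * z)) uf+eg≡d)))))))
    where
    K : ℕ → ℕ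
    K j = 2 ℕ.+ 2 ℕ.* t j
    H-affine : Affine (λ j → oddPowerSum n₂ (suc (2 ℕ.* t j)))
    H-affine = affine-Σ n₂ (λ i j → ℕ→ℚ (suc (2 ℕ.* i)) ^ suc (2 ℕ.* t j)) (λ i → affine-^ (suc (2 ℕ.* i)))
    U-affine : Affine u
    U-affine = affine-+ (affine-* (ℕ-integral 2) (affine-^ 2)) (affine-const (ℤ-integral -[1+ 0 ]))
    module H = Affine H-affine
    module U = Affine U-affine
    d e : ℚ
    d = H.slope
    e = U.slope
    w f : ℚ
    w = inv (2^ (K 0))
    -- The solution of u_0 f + e g_0 = d: comparing terms of first order in p in (u_0 + jpe)(g_0 +
    -- jpf) ≡ u_0 g_0 + jpd.
    f = w * (d - e * g 0)
    g₀-integral : Integral (g 0)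
    g₀-integral = g-integral 0 (s≤s z≤n)
    f-integral : Integral f
    f-integral = *-integral (inv-integral (p∤2^[2+2t] 0)) (+-integral H.slope-integral (neg-integral (*-integral U.slope-integral g₀-integral)))
    uf+eg≡d : u 0 * f + e * g 0 ≡ d
    uf+eg≡d = begin
      u 0 * (w * (d - e * g 0)) + e * g 0              ≡⟨ solve 4 (λ u w d x → u :* (w :* (d :- x)) :+ x := (u :* w) :* (d :- x) :+ x) refl (u 0) w d (e * g 0) ⟩
      (u 0 * w) * (d - e * g 0) + e * g 0              ≡⟨ cong (λ z → z * (d - e * g 0) + e * g 0) (trans (cong (_* w) (sym (2^-1 (K 0)))) (*-inv (2^ (K 0)) (λ z → p∤2^[2+2t] 0 (divides 0 z)))) ⟩
      1ℚ * (d - e * g 0) + e * g 0                     ≡⟨ solve 2 (λ d x → con (+ 1) :* (d :- x) :+ x := d) refl d (e * g 0) ⟩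
      d                                                ∎
      where open ≡-Reasoning
    p′ u′ e′ g′ f′ j′ : Polynomial 6
    p′ = var fz
    u′ = var (fs fz)
    e′ = var (fs (fs fz))
    g′ = var (fs (fs (fs fz)))
    f′ = var (fs (fs (fs (fs fz))))
    j′ = var (fs (fs (fs (fs (fs fz)))))

  -- Return to lowest terms, and Wilson's theorem

  ∣-cancel-∤ : ∀ r {d n} → ¬ p ∣ d → p ℕ.^ r ∣ d ℕ.* n → p ℕ.^ r ∣ n
  ∣-cancel-∤ zero    {n = n}     p∤d _ = divides n (sym (ℕₚ.*-identityʳ n))
  ∣-cancel-∤ (suc r) {d} {n} p∤d pᵣ∣dn with euclidsLemma d n p-prime (∣-trans (divides (p ℕ.^ r) (ℕₚ.*-comm p (p ℕ.^ r))) pᵣ∣dn)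
  ... | inj₁ p∣d              = ⊥-elim (p∤d p∣d)
  ... | inj₂ (divides q refl) = subst (p ℕ.* p ℕ.^ r ∣_) (ℕₚ.*-comm p q)
    (*-monoʳ-∣ p (∣-cancel-∤ r p∤d (*-cancelˡ-∣ p {{prime⇒nonZero p-prime}} (subst (p ℕ.* p ℕ.^ r ∣_) reorder pᵣ∣dn))))
    where
    reorder : d ℕ.* (q ℕ.* p) ≡ p ℕ.* (d ℕ.* q)
    reorder = trans (sym (ℕₚ.*-assoc d q p)) (ℕₚ.*-comm (d ℕ.* q) p)

  -- Cross-multiplication gives d n = p^r e a for the reduced fraction n/e = x - y. As p does not
  -- divide d, p^r divides n; and p dividing e would also divide n, against coprimality.
  ≈⇒modℚ : ∀ r x y → x ≈ y [mod r ] → x ≡ y [modℚ p ^ r ]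
  ≈⇒modℚ r x y (_at_ {z} (integral a d p∤d dz) x≡) = pʳ∣num , p∤den
    where
    open ≡-Reasoning
    n = ↥ (x - y)
    e = ↧ₙ (x - y)
    cross : + d ℤ.* n ≡ + (p ℕ.^ r) ℤ.* (+ e ℤ.* a)
    cross = ℤ→ℚ-injective (begin
      ℤ→ℚ (+ d ℤ.* n)                             ≡⟨ ℤ→ℚ-* (+ d) n ⟩
      ℕ→ℚ d * ℤ→ℚ n                               ≡⟨ cong (ℕ→ℚ d *_) (↧*≡↥ (x - y)) ⟨
      ℕ→ℚ d * (ℕ→ℚ e * (x - y))                   ≡⟨ cong (λ v → ℕ→ℚ d * (ℕ→ℚ e * v)) (trans (cong (_- y) x≡) (solve 2 (λ y q → (y :+ q) :- y := q) refl y (P ^ r * z))) ⟩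
      ℕ→ℚ d * (ℕ→ℚ e * (P ^ r * z))               ≡⟨ solve 4 (λ d e q z → d :* (e :* (q :* z)) := q :* (e :* (d :* z))) refl (ℕ→ℚ d) (ℕ→ℚ e) (P ^ r) z ⟩
      P ^ r * (ℕ→ℚ e * (ℕ→ℚ d * z))               ≡⟨ cong₂ (λ q v → q * (ℕ→ℚ e * v)) (ℕ→ℚ-^ p r) (sym dz) ⟨
      ℕ→ℚ (p ℕ.^ r) * (ℕ→ℚ e * ℤ→ℚ a)             ≡⟨ trans (ℤ→ℚ-* (+ (p ℕ.^ r)) (+ e ℤ.* a)) (cong (ℕ→ℚ (p ℕ.^ r) *_) (ℤ→ℚ-* (+ e) a)) ⟨
      ℤ→ℚ (+ (p ℕ.^ r) ℤ.* (+ e ℤ.* a))           ∎)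
    cross-ℕ : d ℕ.* ℤ.∣ n ∣ ≡ p ℕ.^ r ℕ.* (e ℕ.* ℤ.∣ a ∣)
    cross-ℕ = trans (sym (ℤₚ.abs-* (+ d) n)) (trans (cong ℤ.∣_∣ cross)
      (trans (ℤₚ.abs-* (+ (p ℕ.^ r)) (+ e ℤ.* a)) (cong (p ℕ.^ r ℕ.*_) (ℤₚ.abs-* (+ e) a))))
    pʳ∣num : p ℕ.^ r ∣ ℤ.∣ n ∣
    pʳ∣num = ∣-cancel-∤ r p∤d (divides (e ℕ.* ℤ.∣ a ∣) (trans cross-ℕ (ℕₚ.*-comm (p ℕ.^ r) (e ℕ.* ℤ.∣ a ∣))))
    coprime : ∀ (v : ℚ) → Coprime ℤ.∣ ↥ v ∣ (↧ₙ v)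
    coprime (mkℚ _ _ c) = recompute c
    p∤den : ¬ p ∣ e
    p∤den p∣e = ℕₚ.<⇒≢ (ℕₚ.≤-trans (s≤s (s≤s z≤n)) 7≤p) (sym (coprime (x - y) (p∣n , p∣e)))
      where
      p∣n : p ∣ ℤ.∣ n ∣
      p∣n = [ (λ p∣d → ⊥-elim (p∤d p∣d)) , (λ p∣ → p∣) ]′ (euclidsLemma d ℤ.∣ n ∣ p-prime
        (subst (p ∣_) (sym cross-ℕ) (∣n⇒∣m*n (p ℕ.^ r) (∣m⇒∣m*n ℤ.∣ a ∣ p∣e))))

  p-1∸ : ℕ→ℚ (p ℕ.∸ 1) ≡ P - 1ℚ
  p-1∸ = trans (solve 1 (λ x → x := (con (+ 1) :+ x) :- con (+ 1)) refl (ℕ→ℚ (p ℕ.∸ 1)))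
    (cong (_- 1ℚ) (trans (sym (ℕ→ℚ-suc (p ℕ.∸ 1))) (cong ℕ→ℚ (ℕₚ.suc-pred p {{prime⇒nonZero p-prime}}))))

  suc[p∸1] : suc (p ℕ.∸ 1) ≡ p
  suc[p∸1] = ℕₚ.suc-pred p {{prime⇒nonZero p-prime}}

  p∤p∸1 : ¬ p ∣ p ℕ.∸ 1
  p∤p∸1 = ∤-< (λ e → p≢1 (trans (sym suc[p∸1]) (cong suc e))) (subst (p ℕ.∸ 1 <_) suc[p∸1] (ℕₚ.n<1+n (p ℕ.∸ 1)))
    where
    p≢1 : p ≢ 1
    p≢1 e = ℕₚ.<⇒≢ (ℕₚ.≤-trans (s≤s (s≤s z≤n)) 7≤p) (sym e)

  -1^[p-1] : -1ℚ ^ (p ℕ.∸ 1) ≡ 1ℚ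
  -1^[p-1] = trans (cong (-1ℚ ^_) p∸1≡) (-1^2n≡1 (2 ℕ.+ s))

  -- (p-1)! is the (p-1)-th difference of k^(p-1) at 0. By Fermat k^(p-1) may be replaced by 1 -
  -- δ₀(k), whose difference is (1-1)^(p-1) - (-1)^(p-1) = -1.
  wilson : ℕ→ℚ ((p ℕ.∸ 1) !) ≈ -1ℚ [mod 1 ]
  wilson = subst₂ (_≈_[mod 1 ]) (trans (sym (⋆-Σ n a (pow -1ℚ))) (trans (⋆-comm n a (pow -1ℚ)) (difference-! n))) value
    (Σ-≈ (suc n) (λ k → choose n k * (a k * -1ℚ ^ (n ℕ.∸ k))) (λ k → choose n k * ((1ℚ ^ k + -1ℚ * δ₀ k) * -1ℚ ^ (n ℕ.∸ k)))
      (λ k k≤n → ≈-*ˡ (ℕ-integral (n C k)) (≈-*ʳ (^-integral (n ℕ.∸ k) (ℤ-integral -[1+ 0 ])) (power k k≤n))))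
    where
    n = p ℕ.∸ 1
    a : Seq
    a k = ℕ→ℚ k ^ n
    n≡ : ∃ λ i → n ≡ suc i
    n≡ = _ , p∸1≡
    power : ∀ k → k < suc n → a k ≈ 1ℚ ^ k + -1ℚ * δ₀ k [mod 1 ]
    power zero    _   = ≡⇒≈ (trans (cong (0ℚ ^_) (proj₂ n≡)) (pow-0 (suc (proj₁ n≡))))
    power (suc k) k<n = subst₂ (_≈_[mod 1 ]) (cong (ℕ→ℚ (suc k) ^_) (ℕₚ.*-identityˡ n))
      (sym (trans (+-identityʳ (1ℚ ^ suc k)) (1^n≡1 (suc k))))
      (^≈1 (suc k) 1 (∤-< (λ ()) (subst (suc k <_) suc[p∸1] k<n)))
    open ≡-Reasoning
    value : Σ< (suc n) (λ k → choose n k * ((1ℚ ^ k + -1ℚ * δ₀ k) * -1ℚ ^ (n ℕ.∸ k))) ≡ -1ℚ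
    value = begin
      Σ< (suc n) (λ k → choose n k * ((1ℚ ^ k + -1ℚ * δ₀ k) * -1ℚ ^ (n ℕ.∸ k)))
        ≡⟨ ⋆-Σ n (λ k → 1ℚ ^ k + -1ℚ * δ₀ k) (pow -1ℚ) ⟨
      ((λ k → 1ℚ ^ k + -1ℚ * δ₀ k) ⋆ pow -1ℚ) n
        ≡⟨ ⋆-distribʳ-+ n (pow 1ℚ) (λ k → -1ℚ * δ₀ k) (pow -1ℚ) ⟩
      (pow 1ℚ ⋆ pow -1ℚ) n + ((λ k → -1ℚ * δ₀ k) ⋆ pow -1ℚ) n
        ≡⟨ cong₂ _+_ (trans (pow-⋆ n 1ℚ -1ℚ) (trans (cong (0ℚ ^_) (proj₂ n≡)) (pow-0 (suc (proj₁ n≡))))) (trans (⋆-scaleˡ n -1ℚ δ₀ (pow -1ℚ)) (cong (-1ℚ *_) (trans (δ₀-⋆ n (pow -1ℚ)) -1^[p-1]))) ⟩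
      0ℚ + -1ℚ * 1ℚ ≡⟨⟩
      -1ℚ ∎

  P*W≡ : P * W p ≡ ℕ→ℚ ((p ℕ.∸ 1) !) + 1ℚ
  P*W≡ = begin
    P * (ℕ→ℚ ((p ℕ.∸ 1) ! ℕ.+ 1) * inv p)   ≡⟨ solve 3 (λ x y z → x :* (y :* z) := (x :* z) :* y) refl P (ℕ→ℚ ((p ℕ.∸ 1) ! ℕ.+ 1)) (inv p) ⟩
    (P * inv p) * ℕ→ℚ ((p ℕ.∸ 1) ! ℕ.+ 1)   ≡⟨ cong₂ _*_ (*-inv p p≢0) (ℕ→ℚ-+ ((p ℕ.∸ 1) !) 1) ⟩
    1ℚ * (ℕ→ℚ ((p ℕ.∸ 1) !) + 1ℚ)           ≡⟨ *-identityˡ _ ⟩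
    ℕ→ℚ ((p ℕ.∸ 1) !) + 1ℚ                  ∎
    where open ≡-Reasoning

  W-integral : Integral (W p)
  W-integral = ≈-integral (≈-P*⁻¹ {r = 0} {y = 0ℚ} (subst₂ (_≈_[mod 1 ]) (sym P*W≡) (sym (*-zeroʳ P))
    (≈-+ wilson (≈-refl {x = 1ℚ})))) (ℤ-integral (+ 0))

  -- Logarithms

  infixr 9 _·_
  _·_ : ∀ {n} → ℕ → Polynomial n → Polynomial n
  c · f = con (+ c) :* f

  -- 12 log(1 + p y) / p, truncated after the fourth power.
  logPoly : ∀ {n} → Polynomial n → Polynomial n → Polynomial n
  logPoly p y = 12 · y :- 6 · (p :* (y :* y)) :+ 4 · (p :* p :* (y :* y :* y)) :- 3 · (p :* p :* p :* (y :* y :* y :* y))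

  opaque
    log : ℚ → ℚ
    log y = ⟦ logPoly (var fz) (var (fs fz)) ⟧ (P ∷ y ∷ [])

    log≡ : ∀ y → log y ≡ ⟦ logPoly (var fz) (var (fs fz)) ⟧ (P ∷ y ∷ [])
    log≡ y = refl

    log-0 : log 0ℚ ≡ 0ℚ
    log-0 = solve 1 (λ p → logPoly p (con (+ 0)) := con (+ 0)) refl P

    -- The argument on the left comes from (1 + py)(1 + pz). A monomial of degree d in y and z
    -- carries p^(d-1); the true logarithm makes degrees up to 4 cancel, and the rest has p^4.
    log-additive : ∀ {y z} → Integral y → Integral z → log (y + z + P * (y * z)) ≈ log y + log z [mod 4 ]
    log-additive iy iz = solveMod 4 (logPoly p′ (y′ :+ z′ :+ p′ :* (y′ :* z′))) (logPoly p′ y′ :+ logPoly p′ z′) (iy ∷ iz ∷ [])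
      where
      p′ y′ z′ : Polynomial 3
      p′ = var fz
      y′ = var (fs fz)
      z′ = var (fs (fs fz))

  Π< : ℕ → (ℕ → ℚ) → ℚ
  Π< zero    f = 1ℚ
  Π< (suc n) f = f n * Π< n f

  Π-cong : ∀ n {f g} → (∀ k → f k ≡ g k) → Π< n f ≡ Π< n g
  Π-cong zero    e = refl
  Π-cong (suc n) e = cong₂ _*_ (e n) (Π-cong n e)

  Π-const : ∀ n x → Π< n (λ _ → x) ≡ x ^ n
  Π-const zero    x = refl
  Π-const (suc n) x = cong (x *_) (Π-const n x)

  Π-! : ∀ n k → Π< n (λ i → ℕ→ℚ (suc i) ^ k) ≡ ℕ→ℚ (n !) ^ k
  Π-! zero    k = sym (1^n≡1 k)
  Π-! (suc n) k = trans (cong (ℕ→ℚ (suc n) ^ k *_) (Π-! n k))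
    (trans (sym (^-distrib-* (ℕ→ℚ (suc n)) (ℕ→ℚ (n !)) k)) (cong (_^ k) (sym (ℕ→ℚ-* (suc n) (n !)))))

  log-Π : ∀ n (q : ℕ → ℚ) → (∀ i → i < n → Integral (q i)) →
    ∃ λ y → Integral y × Π< n (λ i → 1ℚ + P * q i) ≡ 1ℚ + P * y × log y ≈ Σ< n (log ∘ q) [mod 4 ]
  log-Π zero    q iq = 0ℚ , ℤ-integral (+ 0) , solve 1 (λ p → con (+ 1) := con (+ 1) :+ p :* con (+ 0)) refl P ,
    ≡⇒≈ log-0
  log-Π (suc n) q iq with log-Π n q (λ i i<n → iq i (ℕₚ.m<n⇒m<1+n i<n))
  ... | y , iy , Π≡ , log≈ = y + x + P * (y * x) ,
    +-integral (+-integral iy ix) (*-integral P-integral (*-integral iy ix)) ,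
    trans (cong ((1ℚ + P * x) *_) Π≡) (solve 3 (λ p x y → (con (+ 1) :+ p :* x) :* (con (+ 1) :+ p :* y) := con (+ 1) :+ p :* (y :+ x :+ p :* (y :* x))) refl P x y) ,
    ≈-trans (log-additive iy ix) (subst (log y + log x ≈_[mod 4 ]) (sym (Σ-snoc n (log ∘ q))) (≈-+ log≈ (≈-refl {x = log x})))
    where
    x = q n
    ix = iq n (ℕₚ.n<1+n n)

  p-1 : ℕ
  p-1 = p ℕ.∸ 1

  q : ℕ → ℚ
  q i = fermatQuotient (suc i)

  q-integral : ∀ i → i < p-1 → Integral (q i)
  q-integral i i<n = fermatQuotient-integral (suc i) (∤-< (λ ()) (subst (suc i <_) suc[p∸1] (s≤s i<n)))

  Σ-const : ∀ k x → Σ< k (λ _ → x) ≡ ℕ→ℚ k * x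
  Σ-const zero    x = sym (*-zeroˡ x)
  Σ-const (suc k) x = trans (cong (λ z → x + z) (Σ-const k x))
    (trans (solve 2 (λ x k → x :+ k :* x := (con (+ 1) :+ k) :* x) refl x (ℕ→ℚ k)) (cong (_* x) (sym (ℕ→ℚ-suc k))))

  -- Both products have the form 1 + py with the same y, whose logarithm `log-Π` evaluates in two
  -- ways.
  log-root : ∀ k (q : ℕ → ℚ) w → (∀ i → i < k → Integral (q i)) → Integral w →
    Π< k (λ i → 1ℚ + P * q i) ≡ (1ℚ + P * w) ^ k → ℕ→ℚ k * log w ≈ Σ< k (log ∘ q) [mod 4 ]
  log-root k q w iq iw Π≡ with log-Π k q iq | log-Π k (λ _ → w) (λ _ _ → iw)
  ... | y , _ , Πy , logy | z , _ , Πz , logz =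
    ≈-trans (≈-sym (subst (log z ≈_[mod 4 ]) (Σ-const k (log w)) logz)) (subst (λ v → log v ≈ Σ< k (log ∘ q) [mod 4 ]) y≡z logy)
    where
    open ≡-Reasoning
    y≡z : y ≡ z
    y≡z = *-cancelˡ-ℕ→ℚ p p≢0 (begin
      P * y                 ≡⟨ solve 1 (λ x → x := (con (+ 1) :+ x) :- con (+ 1)) refl (P * y) ⟩
      (1ℚ + P * y) - 1ℚ     ≡⟨ cong (_- 1ℚ) (trans (sym Πy) (trans Π≡ (trans (sym (Π-const k (1ℚ + P * w))) Πz))) ⟩
      (1ℚ + P * z) - 1ℚ     ≡⟨ solve 1 (λ x → (con (+ 1) :+ x) :- con (+ 1) := x) refl (P * z) ⟩
      P * z                 ∎)

  -- Both sides are the logarithm of (p-1)!^(p-1) = (1 - p W)^(p-1).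
  log-W : ℕ→ℚ p-1 * log (- W p) ≈ Σ< p-1 (log ∘ q) [mod 4 ]
  log-W = log-root p-1 q (- W p) q-integral (neg-integral W-integral) (begin
      Π< p-1 (λ i → 1ℚ + P * q i)              ≡⟨ Π-cong p-1 (λ i → sym (^[p-1] (suc i))) ⟩
      Π< p-1 (λ i → ℕ→ℚ (suc i) ^ p-1)           ≡⟨ Π-! p-1 p-1 ⟩
      F ^ p-1                                  ≡⟨ *-identityˡ (F ^ p-1) ⟨
      1ℚ * F ^ p-1                             ≡⟨ cong (_* F ^ p-1) -1^[p-1] ⟨
      -1ℚ ^ p-1 * F ^ p-1                        ≡⟨ ^-distrib-* -1ℚ F p-1 ⟨
      (-1ℚ * F) ^ p-1                          ≡⟨ cong (_^ p-1) 1-PW ⟨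
      (1ℚ + P * - W p) ^ p-1                   ∎)
    where
    open ≡-Reasoning
    F = ℕ→ℚ (p-1 !)
    1-PW : 1ℚ + P * - W p ≡ -1ℚ * F
    1-PW = begin
      1ℚ + P * - W p        ≡⟨ solve 2 (λ p w → con (+ 1) :+ p :* (:- w) := con (+ 1) :- p :* w) refl P (W p) ⟩
      1ℚ - P * W p          ≡⟨ cong (λ z → 1ℚ - z) P*W≡ ⟩
      1ℚ - (F + 1ℚ)         ≡⟨ solve 1 (λ f → con (+ 1) :- (f :+ con (+ 1)) := con (-[1+ 0 ]) :* f) refl F ⟩
      -1ℚ * F               ∎

  -- Moments of the Fermat quotients

  moment : ℕ → ℚ
  moment k = Σ< p-1 (λ i → q i ^ k)

  Σ-quartic : ∀ N (q : ℕ → ℚ) c₀ c₁ c₂ c₃ c₄ →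
    Σ< N (λ i → c₀ + c₁ * q i ^ 1 + c₂ * q i ^ 2 + c₃ * q i ^ 3 + c₄ * q i ^ 4) ≡
    ℕ→ℚ N * c₀ + c₁ * Σ< N (λ i → q i ^ 1) + c₂ * Σ< N (λ i → q i ^ 2) + c₃ * Σ< N (λ i → q i ^ 3) + c₄ * Σ< N (λ i → q i ^ 4)
  Σ-quartic zero    q c₀ c₁ c₂ c₃ c₄ = solve 5 (λ c₀ c₁ c₂ c₃ c₄ →
    con (+ 0) := con (+ 0) :* c₀ :+ c₁ :* con (+ 0) :+ c₂ :* con (+ 0) :+ c₃ :* con (+ 0) :+ c₄ :* con (+ 0)) refl c₀ c₁ c₂ c₃ c₄
  Σ-quartic (suc N) q c₀ c₁ c₂ c₃ c₄ = begin
    head + Σ< N (λ i → c₀ + c₁ * q (suc i) ^ 1 + c₂ * q (suc i) ^ 2 + c₃ * q (suc i) ^ 3 + c₄ * q (suc i) ^ 4)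
      ≡⟨ cong (λ z → head + z) (Σ-quartic N (q ∘ suc) c₀ c₁ c₂ c₃ c₄) ⟩
    head + (ℕ→ℚ N * c₀ + c₁ * σ 1 + c₂ * σ 2 + c₃ * σ 3 + c₄ * σ 4)
      ≡⟨ prove (c₀ ∷ c₁ ∷ c₂ ∷ c₃ ∷ c₄ ∷ ℕ→ℚ N ∷ σ 1 ∷ σ 2 ∷ σ 3 ∷ σ 4 ∷ q 0 ^ 1 ∷ q 0 ^ 2 ∷ q 0 ^ 3 ∷ q 0 ^ 4 ∷ [])
           ((v0 :+ v1 :* w1 :+ v2 :* w2 :+ v3 :* w3 :+ v4 :* w4) :+ (vN :* v0 :+ v1 :* s1 :+ v2 :* s2 :+ v3 :* s3 :+ v4 :* s4))
           ((con (+ 1) :+ vN) :* v0 :+ v1 :* (w1 :+ s1) :+ v2 :* (w2 :+ s2) :+ v3 :* (w3 :+ s3) :+ v4 :* (w4 :+ s4)) refl ⟩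
    (1ℚ + ℕ→ℚ N) * c₀ + c₁ * (q 0 ^ 1 + σ 1) + c₂ * (q 0 ^ 2 + σ 2) + c₃ * (q 0 ^ 3 + σ 3) + c₄ * (q 0 ^ 4 + σ 4)
      ≡⟨ cong (λ z → z * c₀ + c₁ * (q 0 ^ 1 + σ 1) + c₂ * (q 0 ^ 2 + σ 2) + c₃ * (q 0 ^ 3 + σ 3) + c₄ * (q 0 ^ 4 + σ 4)) (ℕ→ℚ-suc N) ⟨
    ℕ→ℚ (suc N) * c₀ + c₁ * (q 0 ^ 1 + σ 1) + c₂ * (q 0 ^ 2 + σ 2) + c₃ * (q 0 ^ 3 + σ 3) + c₄ * (q 0 ^ 4 + σ 4) ∎
    where
    open ≡-Reasoning
    head = c₀ + c₁ * q 0 ^ 1 + c₂ * q 0 ^ 2 + c₃ * q 0 ^ 3 + c₄ * q 0 ^ 4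
    σ : ℕ → ℚ
    σ k = Σ< N (λ i → q (suc i) ^ k)
    v0 v1 v2 v3 v4 vN s1 s2 s3 s4 w1 w2 w3 w4 : Polynomial 14
    v0 = var (# 0)
    v1 = var (# 1)
    v2 = var (# 2)
    v3 = var (# 3)
    v4 = var (# 4)
    vN = var (# 5)
    s1 = var (# 6)
    s2 = var (# 7)
    s3 = var (# 8)
    s4 = var (# 9)
    w1 = var (# 10)
    w2 = var (# 11)
    w3 = var (# 12)
    w4 = var (# 13)

  p∤12n : ¬ p ∣ 12 ℕ.* p-1
  p∤12n = ∤-* {12} (∤-* {3} {4} (∤-<7 3 {s≤s (s≤s (s≤s z≤n))}) (∤-<7 4 {s≤s (s≤s (s≤s (s≤s z≤n)))})) p∤p∸1

  opaque
    -- Dividing by p-1 takes the root in the logarithm; dividing by 12 makes the coefficients 1,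
    -- 1/2, 1/3, 1/4 of its series integers.
    r : ℕ → ℚ
    r k = inv (12 ℕ.* p-1) * moment k

    r-integral : ∀ k → Integral (r k)
    r-integral k = *-integral (inv-integral p∤12n) (Σ-integral p-1 (λ i → q i ^ k) (λ i i<n → ^-integral k (q-integral i i<n)))

    moment≡ : ∀ k → moment k ≡ ℕ→ℚ 12 * ((P - 1ℚ) * r k)
    moment≡ k = begin
      Q                                    ≡⟨ *-identityˡ Q ⟨
      1ℚ * Q                               ≡⟨ cong (_* Q) (*-inv (12 ℕ.* p-1) (λ e → p∤12n (divides 0 e))) ⟨
      (ℕ→ℚ (12 ℕ.* p-1) * inv (12 ℕ.* p-1)) * Q ≡⟨ cong (λ z → (z * inv (12 ℕ.* p-1)) * Q) (trans (ℕ→ℚ-* 12 p-1) (cong (ℕ→ℚ 12 *_) p-1∸)) ⟩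
      (ℕ→ℚ 12 * (P - 1ℚ) * inv (12 ℕ.* p-1)) * Q ≡⟨ solve 4 (λ c d i q → (c :* d :* i) :* q := c :* (d :* (i :* q))) refl (ℕ→ℚ 12) (P - 1ℚ) (inv (12 ℕ.* p-1)) Q ⟩
      ℕ→ℚ 12 * ((P - 1ℚ) * (inv (12 ℕ.* p-1) * Q)) ∎
      where
      open ≡-Reasoning
      Q : ℚ
      Q = moment k

  -- Coordinates in which all quantities are integer polynomials

  -- Equality is required at j = 1 because g 1 occurs in the right-hand side, where all entries are
  -- later replaced modulo the same p^4; Kummer's congruence alone gives it modulo p^2.
  Slope : ℚ → Set
  Slope h = Integral h × g 1 ≡ g 0 + P * h × (∀ j → j < 4 → g j ≈ g 0 + ℕ→ℚ j * (P * h) [mod 2 ])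

  -- The error p^2 z at j = 1 is absorbed into the slope, which moves the other values by multiples
  -- of p^2 only.
  slope-exact : ∀ f z → Integral f → Integral z → g 1 ≡ g 0 + ℕ→ℚ 1 * (P * f) + P ^ 2 * z →
    (∀ j → j < 4 → g j ≈ g 0 + ℕ→ℚ j * (P * f) [mod 2 ]) → Slope (f + P * z)
  slope-exact f z f-integral iz g₁≡ g≈ = +-integral f-integral (*-integral P-integral iz) ,
    trans g₁≡ (solve 4 (λ g p f z → (g :+ con (+ 1) :* (p :* f)) :+ (p :* (p :* con (+ 1))) :* z := g :+ p :* (f :+ p :* z)) refl (g 0) P f z) ,
    λ j j<4 → ≈-trans (g≈ j j<4) (solveMod 2 (g′ :+ j′ :* (p′ :* f′)) (g′ :+ j′ :* (p′ :* (f′ :+ p′ :* z′)))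
      (g-integral 0 (s≤s z≤n) ∷ f-integral ∷ iz ∷ ℕ-integral j ∷ []))
    where
    p′ g′ f′ z′ j′ : Polynomial 5
    p′ = var (# 0)
    g′ = var (# 1)
    f′ = var (# 2)
    z′ = var (# 3)
    j′ = var (# 4)

  opaque
    h-exact : ∃ Slope
    h-exact = _ , slope-exact f quot f-integral quot-integral equation g≈
      where
      f : ℚ
      f = proj₁ kummer
      f-integral : Integral f
      f-integral = proj₁ (proj₂ kummer)
      g≈ : ∀ j → j < 4 → g j ≈ g 0 + ℕ→ℚ j * (P * f) [mod 2 ]
      g≈ = proj₂ (proj₂ kummer)
      open _≈_[mod_] (g≈ 1 (s≤s (s≤s z≤n)))

  h : ℚ
  h = proj₁ h-exact

  6* : ∀ x → ℕ→ℚ 6 * (inv 6 * x) ≡ x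
  6* x = trans (sym (*-assoc (ℕ→ℚ 6) (inv 6) x)) (*-identityˡ x)

  -- The last two coordinates are divided by 6 to absorb the denominator of the Faulhaber
  -- coefficient m(m-1)(m-2)/6.
  ρ : Vec ℚ 7
  ρ = P ∷ r 1 ∷ r 2 ∷ r 3 ∷ r 4 ∷ inv 6 * g 0 ∷ inv 6 * h ∷ []

  ρ-integral : All Integral (r 1 ∷ r 2 ∷ r 3 ∷ r 4 ∷ inv 6 * g 0 ∷ inv 6 * h ∷ [])
  ρ-integral = r-integral 1 ∷ r-integral 2 ∷ r-integral 3 ∷ r-integral 4 ∷
    *-integral 1/6 (g-integral 0 (s≤s z≤n)) ∷ *-integral 1/6 (proj₁ (proj₂ h-exact)) ∷ []
    where
    1/6 : Integral (inv 6)
    1/6 = inv-integral (∤-<7 6 {ℕₚ.≤-refl})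

  p′ : ∀ {k} → Polynomial (suc k)
  p′ = var fz

  r₁ r₂ r₃ r₄ γ η : Polynomial 7
  r₁ = var (# 1)
  r₂ = var (# 2)
  r₃ = var (# 3)
  r₄ = var (# 4)
  γ  = var (# 5)
  η  = var (# 6)

  momentP : Polynomial 7 → Polynomial 7
  momentP x = 12 · ((p′ :- con (+ 1)) :* x)

  -- Σ_a ((1 + p q_a)^k - 1) / p
  sumP : ℕ → Polynomial 7
  sumP k = k · momentP r₁ :+ (k C 2) · (p′ :* momentP r₂) :+ (k C 3) · (p′ :* p′ :* momentP r₃) :+ (k C 4) · (p′ :* p′ :* p′ :* momentP r₄)

  indexP : ℕ → Polynomial 7
  indexP k = k · (p′ :- con (+ 1))

  gP : ℕ → Polynomial 7
  gP j = 6 · (γ :+ j · (p′ :* η))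

  -- The quotient of `sumP` by the index m, less the Faulhaber term p^2 (m-1)(m-2) g/6. The factor 3
  -- (j ∸ 2) is j(j-1)(j-2)/2 for j ≤ 3, without a division. At j = -1 the cubic in the r's would be
  -- log(1 - pW)/p.
  bP : ℕ → Polynomial 7
  bP j = 12 · r₁ :+ (6 ℕ.* j) · (p′ :* r₂) :+ (2 ℕ.* (j ℕ.* (j ℕ.∸ 1))) · (p′ :* p′ :* r₃) :+ (3 ℕ.* (j ℕ.∸ 2)) · (p′ :* p′ :* p′ :* r₄)
    :- p′ :* p′ :* (m :- con (+ 1)) :* (m :- con (+ 2)) :* (γ :+ j · (p′ :* η))
    where m = indexP (suc j)

  -- Checked for each j separately, so that all coefficients are numerals.
  bP-equation : ∀ j → j < 4 → let m = indexP (suc j) in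
    ⟦ 6 · sumP (suc j) :- p′ :* p′ :* (m :* (m :- con (+ 1)) :* (m :- con (+ 2))) :* gP j ⟧ ρ ≡ ⟦ 6 · (m :* bP j) ⟧ ρ
  bP-equation 0 _ = prove ρ (6 · sumP 1 :- p′ :* p′ :* (indexP 1 :* (indexP 1 :- con (+ 1)) :* (indexP 1 :- con (+ 2))) :* gP 0) (6 · (indexP 1 :* bP 0)) refl
  bP-equation 1 _ = prove ρ (6 · sumP 2 :- p′ :* p′ :* (indexP 2 :* (indexP 2 :- con (+ 1)) :* (indexP 2 :- con (+ 2))) :* gP 1) (6 · (indexP 2 :* bP 1)) refl
  bP-equation 2 _ = prove ρ (6 · sumP 3 :- p′ :* p′ :* (indexP 3 :* (indexP 3 :- con (+ 1)) :* (indexP 3 :- con (+ 2))) :* gP 2) (6 · (indexP 3 :* bP 2)) refl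
  bP-equation 3 _ = prove ρ (6 · sumP 4 :- p′ :* p′ :* (indexP 4 :* (indexP 4 :- con (+ 1)) :* (indexP 4 :- con (+ 2))) :* gP 3) (6 · (indexP 4 :* bP 3)) refl
  bP-equation (suc (suc (suc (suc _)))) (s≤s (s≤s (s≤s (s≤s ()))))

  binomial≤4 : ∀ k → k < 5 → ∀ x → (1ℚ + P * x) ^ k ≡
    1ℚ + ℕ→ℚ k * P * x ^ 1 + choose k 2 * (P * P) * x ^ 2 + choose k 3 * (P * P * P) * x ^ 3 + choose k 4 * (P * P * P * P) * x ^ 4
  binomial≤4 k k<5 x = byCases k k<5
    where
    v w : Polynomial 2
    v = var (# 0)
    w = var (# 1)
    _^′_ : Polynomial 2 → ℕ → Polynomial 2
    f ^′ zero  = con (+ 1)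
    f ^′ suc k = f :* (f ^′ k)
    expansion : ℕ → Polynomial 2
    expansion k = con (+ 1) :+ con (+ k) :* v :* (w ^′ 1) :+ con (+ (k C 2)) :* (v :* v) :* (w ^′ 2)
      :+ con (+ (k C 3)) :* (v :* v :* v) :* (w ^′ 3) :+ con (+ (k C 4)) :* (v :* v :* v :* v) :* (w ^′ 4)
    byCases : ∀ k → k < 5 → (1ℚ + P * x) ^ k ≡ ⟦ expansion k ⟧ (P ∷ x ∷ [])
    byCases 0 _ = prove (P ∷ x ∷ []) ((con (+ 1) :+ v :* w) ^′ 0) (expansion 0) refl
    byCases 1 _ = prove (P ∷ x ∷ []) ((con (+ 1) :+ v :* w) ^′ 1) (expansion 1) refl
    byCases 2 _ = prove (P ∷ x ∷ []) ((con (+ 1) :+ v :* w) ^′ 2) (expansion 2) refl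
    byCases 3 _ = prove (P ∷ x ∷ []) ((con (+ 1) :+ v :* w) ^′ 3) (expansion 3) refl
    byCases 4 _ = prove (P ∷ x ∷ []) ((con (+ 1) :+ v :* w) ^′ 4) (expansion 4) refl
    byCases (suc (suc (suc (suc (suc _))))) (s≤s (s≤s (s≤s (s≤s (s≤s ())))))

  powerSum-moments : ∀ k → 0 < k → k < 5 → powerSum (k ℕ.* p-1) p ≡ (P - 1ℚ) + P * ⟦ sumP k ⟧ ρ
  powerSum-moments k 0<k k<5 = begin
    powerSum (k ℕ.* p-1) p
      ≡⟨ cong (powerSum (k ℕ.* p-1)) suc[p∸1] ⟨
    0ℚ ^ (k ℕ.* p-1) + Σ< p-1 (λ i → ℕ→ℚ (suc i) ^ (k ℕ.* p-1))
      ≡⟨ cong₂ _+_ (0^ (k ℕ.* p-1) kn≢0) (Σ-congˡ p-1 (λ i → expand i)) ⟩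
    0ℚ + Σ< p-1 (λ i → 1ℚ + c₁ * q i ^ 1 + c₂ * q i ^ 2 + c₃ * q i ^ 3 + c₄ * q i ^ 4)
      ≡⟨ trans (+-identityˡ _) (Σ-quartic p-1 q 1ℚ c₁ c₂ c₃ c₄) ⟩
    ℕ→ℚ p-1 * 1ℚ + c₁ * moment 1 + c₂ * moment 2 + c₃ * moment 3 + c₄ * moment 4
      ≡⟨ cong (λ z → z + c₁ * moment 1 + c₂ * moment 2 + c₃ * moment 3 + c₄ * moment 4) (trans (*-identityʳ (ℕ→ℚ p-1)) p-1∸) ⟩
    (P - 1ℚ) + c₁ * moment 1 + c₂ * moment 2 + c₃ * moment 3 + c₄ * moment 4
      ≡⟨ cong₂ (λ x y → (P - 1ℚ) + c₁ * x + c₂ * y + c₃ * moment 3 + c₄ * moment 4) (moment≡ 1) (moment≡ 2) ⟩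
    (P - 1ℚ) + c₁ * M 1 + c₂ * M 2 + c₃ * moment 3 + c₄ * moment 4
      ≡⟨ cong₂ (λ x y → (P - 1ℚ) + c₁ * M 1 + c₂ * M 2 + c₃ * x + c₄ * y) (moment≡ 3) (moment≡ 4) ⟩
    (P - 1ℚ) + c₁ * M 1 + c₂ * M 2 + c₃ * M 3 + c₄ * M 4
      ≡⟨ solve 10 (λ p d k₁ k₂ k₃ k₄ m₁ m₂ m₃ m₄ →
           d :+ k₁ :* p :* m₁ :+ k₂ :* (p :* p) :* m₂ :+ k₃ :* (p :* p :* p) :* m₃ :+ k₄ :* (p :* p :* p :* p) :* m₄
           := d :+ p :* (k₁ :* m₁ :+ k₂ :* (p :* m₂) :+ k₃ :* (p :* p :* m₃) :+ k₄ :* (p :* p :* p :* m₄)))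
           refl P (P - 1ℚ) (ℕ→ℚ k) (choose k 2) (choose k 3) (choose k 4) (M 1) (M 2) (M 3) (M 4) ⟩
    (P - 1ℚ) + P * ⟦ sumP k ⟧ ρ ∎
    where
    open ≡-Reasoning
    c₁ = ℕ→ℚ k * P
    c₂ = choose k 2 * (P * P)
    c₃ = choose k 3 * (P * P * P)
    c₄ = choose k 4 * (P * P * P * P)
    M : ℕ → ℚ
    M i = ℕ→ℚ 12 * ((P - 1ℚ) * r i)
    kn≢0 : k ℕ.* p-1 ≢ 0
    kn≢0 e = [ (λ { refl → ℕₚ.<-irrefl refl 0<k }) , (λ n≡0 → p∤p∸1 (divides 0 n≡0)) ]′ (ℕₚ.m*n≡0⇒m≡0∨n≡0 k e)
    0^ : ∀ e → e ≢ 0 → 0ℚ ^ e ≡ 0ℚ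
    0^ zero    e≢0 = ⊥-elim (e≢0 refl)
    0^ (suc e) _   = pow-0 (suc e)
    expand : ∀ i → ℕ→ℚ (suc i) ^ (k ℕ.* p-1) ≡ 1ℚ + c₁ * q i ^ 1 + c₂ * q i ^ 2 + c₃ * q i ^ 3 + c₄ * q i ^ 4
    expand i = trans (cong (ℕ→ℚ (suc i) ^_) (ℕₚ.*-comm k p-1)) (trans (sym (^-assocʳ (ℕ→ℚ (suc i)) p-1 k))
      (trans (cong (_^ k) (^[p-1] (suc i))) (binomial≤4 k k<5 (q i))))

  indexP≡ : ∀ j → ℕ→ℚ (4 ℕ.+ 2 ℕ.* t j) ≡ ⟦ indexP (suc j) ⟧ ρ
  indexP≡ j = trans (cong ℕ→ℚ (sym (*[p-1]≡ j))) (trans (ℕ→ℚ-* (suc j) p-1) (cong (ℕ→ℚ (suc j) *_) p-1∸))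

  -- The factor m-2 stems from B_(m-2) = (m-2) g; it completes C(m,2)/3 to m(m-1)(m-2)/6.
  faulhaberCoefficient : ∀ i → let m = ℕ→ℚ (4 ℕ.+ i) in
    ℕ→ℚ 6 * (choose (4 ℕ.+ i) 2 * inv 3 * ℕ→ℚ (2 ℕ.+ i)) ≡ m * (m - 1ℚ) * (m - ℕ→ℚ 2)
  faulhaberCoefficient i = begin
    ℕ→ℚ 6 * (c * inv 3 * k)                     ≡⟨ solve 3 (λ c t k → con (+ 6) :* (c :* t :* k) := (con (+ 2) :* c) :* (con (+ 3) :* t) :* k) refl c (inv 3) k ⟩
    ℕ→ℚ 2 * c * (ℕ→ℚ 3 * inv 3) * k             ≡⟨ cong (λ z → z * 1ℚ * k) (trans (choose-absorb (3 ℕ.+ i) 1) (cong (λ z → m * ℕ→ℚ z) (nC1≡n (3 ℕ.+ i)))) ⟩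
    m * ℕ→ℚ (3 ℕ.+ i) * 1ℚ * k                  ≡⟨ cong₂ (λ x y → m * x * 1ℚ * y) (minus 1 (3 ℕ.+ i)) (minus 2 (2 ℕ.+ i)) ⟩
    m * (m - 1ℚ) * 1ℚ * (m - ℕ→ℚ 2)             ≡⟨ solve 2 (λ x y → x :* con (+ 1) :* y := x :* y) refl (m * (m - 1ℚ)) (m - ℕ→ℚ 2) ⟩
    m * (m - 1ℚ) * (m - ℕ→ℚ 2)                  ∎
    where
    open ≡-Reasoning
    c = choose (4 ℕ.+ i) 2
    k = ℕ→ℚ (2 ℕ.+ i)
    m = ℕ→ℚ (4 ℕ.+ i)
    minus : ∀ a b → ℕ→ℚ b ≡ ℕ→ℚ (a ℕ.+ b) - ℕ→ℚ a
    minus a b = trans (solve 2 (λ a b → b := (a :+ b) :- a) refl (ℕ→ℚ a) (ℕ→ℚ b)) (cong (_- ℕ→ℚ a) (sym (ℕ→ℚ-+ a b)))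

  -- The power sum of exponent m is evaluated by moments and by Faulhaber's formula modulo p^5. The
  -- summand p-1 appears on both sides and cancels, division by p leaves modulus p^4, and 6m is a
  -- unit.
  Bbar≈ : ∀ j → j < 4 → Bbar p (suc j) ≈ ⟦ bP j ⟧ ρ [mod 4 ]
  Bbar≈ j j<4 = ≈-cancelˡ-ℕ (6 ℕ.* m) p∤6m (subst₂ (_≈_[mod 4 ]) (sym (6m* b)) (sym (6m* (⟦ bP j ⟧ ρ)))
    (≈-trans (≈-*ˡ (ℕ-integral 6) mb≈) (≈-trans (≡⇒≈ distribute) (≈-trans gTerm (≡⇒≈ (bP-equation j j<4))))))
    where
    open ≡-Reasoning
    m = suc j ℕ.* p-1
    m≡ = *[p-1]≡ j
    K = 2 ℕ.+ 2 ℕ.* t j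
    b = Bbar p (suc j)
    X = ⟦ sumP (suc j) ⟧ ρ
    I = ⟦ indexP (suc j) ⟧ ρ
    c = choose (4 ℕ.+ 2 ℕ.* t j) 2 * inv 3 * ℕ→ℚ K
    m≡I : ℕ→ℚ m ≡ I
    m≡I = trans (cong ℕ→ℚ m≡) (indexP≡ j)
    p∤6m : ¬ p ∣ 6 ℕ.* m
    p∤6m = ∤-* {6} (∤-<7 6 {ℕₚ.≤-refl}) (∤-* {suc j} (∤-<7 (suc j) {ℕₚ.≤-trans j<4 (s≤s (s≤s (s≤s (s≤s z≤n))))}) p∤p∸1)
    6m* : ∀ x → ℕ→ℚ (6 ℕ.* m) * x ≡ ℕ→ℚ 6 * (I * x)
    6m* x = trans (cong (_* x) (trans (ℕ→ℚ-* 6 m) (cong (ℕ→ℚ 6 *_) m≡I))) (*-assoc (ℕ→ℚ 6) I x)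
    I*b≡ : I * b ≡ B m + inv p - 1ℚ
    I*b≡ = begin
      I * ((B m + inv p - 1ℚ) * inv m)        ≡⟨ cong (_* ((B m + inv p - 1ℚ) * inv m)) m≡I ⟨
      ℕ→ℚ m * ((B m + inv p - 1ℚ) * inv m)    ≡⟨ solve 3 (λ m x i → m :* (x :* i) := (m :* i) :* x) refl (ℕ→ℚ m) (B m + inv p - 1ℚ) (inv m) ⟩
      (ℕ→ℚ m * inv m) * (B m + inv p - 1ℚ)    ≡⟨ cong (_* (B m + inv p - 1ℚ)) (*-inv m (λ e → p∤6m (subst (λ z → p ∣ 6 ℕ.* z) (sym e) (divides 0 refl)))) ⟩
      1ℚ * (B m + inv p - 1ℚ)                 ≡⟨ *-identityˡ _ ⟩
      B m + inv p - 1ℚ                        ∎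
    -- The correction 1/p - 1 in the definition of `Bbar` is what produces the summand p-1.
    P*B≡ : P * B m ≡ P * (I * b) - 1ℚ + P
    P*B≡ = sym (begin
      P * (I * b) - 1ℚ + P                    ≡⟨ cong (λ z → P * z - 1ℚ + P) I*b≡ ⟩
      P * (B m + inv p - 1ℚ) - 1ℚ + P         ≡⟨ solve 3 (λ p b i → p :* (b :+ i :- con (+ 1)) :- con (+ 1) :+ p := p :* b :+ (p :* i) :- con (+ 1)) refl P (B m) (inv p) ⟩
      P * B m + P * inv p - 1ℚ                ≡⟨ cong (λ z → P * B m + z - 1ℚ) (*-inv p p≢0) ⟩
      P * B m + 1ℚ - 1ℚ                       ≡⟨ solve 1 (λ x → x :+ con (+ 1) :- con (+ 1) := x) refl (P * B m) ⟩
      P * B m                                 ∎)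
    power : (P - 1ℚ) + P * X ≈ (P * (I * b) - 1ℚ + P) + P * (P * (P * (c * g j))) [mod 5 ]
    power = subst₂ (_≈_[mod 5 ])
      (trans (cong (λ k → powerSum k p) (sym m≡)) (powerSum-moments (suc j) (s≤s z≤n) (s≤s j<4)))
      (cong₂ _+_ (trans (cong (λ k → P * B k) (sym m≡)) P*B≡)
        (trans (cong (λ z → choose (4 ℕ.+ 2 ℕ.* t j) 2 * inv 3 * (P ^ 3 * z)) (sym (*g≡B j)))
          (solve 4 (λ x p k g → x :* ((p :* (p :* (p :* con (+ 1)))) :* (k :* g)) := p :* (p :* (p :* (x :* k :* g)))) refl
            (choose (4 ℕ.+ 2 ℕ.* t j) 2 * inv 3) P (ℕ→ℚ K) (g j))))
      (powerSum-p-mod5 (2 ℕ.* t j) (B[3+2t]≡0 j) (B[1+2t]≡0 j) (B[2t]-integral j))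
    mb≈ : I * b ≈ X - P * (P * (c * g j)) [mod 4 ]
    mb≈ = ≈-P*⁻¹ (subst₂ (_≈_[mod 5 ])
      (solve 3 (λ p y z → ((p :* y :- con (+ 1) :+ p) :+ p :* z) :- ((p :- con (+ 1)) :+ p :* z) := p :* y) refl P (I * b) (P * (P * (c * g j))))
      (solve 3 (λ p x z → ((p :- con (+ 1)) :+ p :* x) :- ((p :- con (+ 1)) :+ p :* z) := p :* (x :- z)) refl P X (P * (P * (c * g j))))
      (≈-- (≈-sym power) (≈-refl {x = (P - 1ℚ) + P * (P * (P * (c * g j)))})))
    6c≡ : ℕ→ℚ 6 * c ≡ I * (I - 1ℚ) * (I - ℕ→ℚ 2)
    6c≡ = trans (faulhaberCoefficient (2 ℕ.* t j)) (cong (λ i → i * (i - 1ℚ) * (i - ℕ→ℚ 2)) (indexP≡ j))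
    distribute : ℕ→ℚ 6 * (X - P * (P * (c * g j))) ≡ ℕ→ℚ 6 * X - I * (I - 1ℚ) * (I - ℕ→ℚ 2) * (P * (P * g j))
    distribute = trans (solve 4 (λ x p c g → con (+ 6) :* (x :- p :* (p :* (c :* g))) := con (+ 6) :* x :- (con (+ 6) :* c) :* (p :* (p :* g))) refl X P c (g j))
      (cong (λ z → ℕ→ℚ 6 * X - z * (P * (P * g j))) 6c≡)
    I-integral : Integral (I * (I - 1ℚ) * (I - ℕ→ℚ 2))
    I-integral = ⟦ indexP (suc j) :* (indexP (suc j) :- con (+ 1)) :* (indexP (suc j) :- con (+ 2)) ⟧-integral (P-integral ∷ ρ-integral)
    gP≡ : g 0 + ℕ→ℚ j * (P * h) ≡ ⟦ gP j ⟧ ρ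
    gP≡ = trans (cong₂ (λ x y → x + ℕ→ℚ j * (P * y)) (sym (6* (g 0))) (sym (6* h)))
      (solve 4 (λ p γ j η → con (+ 6) :* γ :+ j :* (p :* (con (+ 6) :* η)) := con (+ 6) :* (γ :+ j :* (p :* η))) refl P (inv 6 * g 0) (ℕ→ℚ j) (inv 6 * h))
    -- Kummer's congruence holds modulo p^2 only; the factor p^2 in front raises it to p^4.
    gTerm : ℕ→ℚ 6 * X - I * (I - 1ℚ) * (I - ℕ→ℚ 2) * (P * (P * g j)) ≈ ℕ→ℚ 6 * X - P * P * (I * (I - 1ℚ) * (I - ℕ→ℚ 2)) * ⟦ gP j ⟧ ρ [mod 4 ]
    gTerm = ≈-- (≈-refl {x = ℕ→ℚ 6 * X}) (≈-trans
      (≈-*ˡ I-integral (≈-P* (≈-P* (≈-trans (proj₂ (proj₂ (proj₂ h-exact)) j j<4) (≡⇒≈ gP≡)))))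
      (≡⇒≈ (solve 3 (λ i p g → i :* (p :* (p :* g)) := p :* p :* i :* g) refl (I * (I - 1ℚ) * (I - ℕ→ℚ 2)) P (⟦ gP j ⟧ ρ))))

  -- Substitution into the right-hand side, and exponentiation

  ⟦⟧-≈ : ∀ {k r} (f : Polynomial k) {σ τ : Vec ℚ k} → All Integral τ → (∀ i → lookup σ i ≈ lookup τ i [mod r ]) →
    ⟦ f ⟧ σ ≈ ⟦ f ⟧ τ [mod r ]
  ⟦⟧-≈ (op [+] f₁ f₂) iτ e = ≈-+ (⟦⟧-≈ f₁ iτ e) (⟦⟧-≈ f₂ iτ e)
  ⟦⟧-≈ (op [*] f₁ f₂) iτ e = ≈-* (⟦ f₁ ⟧-integral iτ) (⟦ f₂ ⟧-integral iτ) (⟦⟧-≈ f₁ iτ e) (⟦⟧-≈ f₂ iτ e)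
  ⟦⟧-≈ (con c)        iτ e = ≈-refl
  ⟦⟧-≈ (var i)        iτ e = e i
  ⟦⟧-≈ (f :^ k)       iτ e = ≈-^ k (⟦ f ⟧-integral iτ) (⟦⟧-≈ f iτ e)
  ⟦⟧-≈ (:- f)         iτ e = ≈-neg (⟦⟧-≈ f iτ e)

  -- 24 rhs p, where κ₂, κ₃, κ₂₄ stand for 24/2, 24/3, 24/24.
  rhsPoly : ∀ {k} → (κ₂ κ₃ κ₂₄ p b₁ b₂ b₃ b₄ b₁₂ b₂₂ : Polynomial k) → Polynomial k
  rhsPoly κ₂ κ₃ κ₂₄ p b₁ b₂ b₃ b₄ b₁₂ b₂₂ =
       24 · (:- (4 · b₁) :+ 6 · b₂ :- 4 · b₃ :+ b₄)
    :+ p :* (:- (72 · (b₁ :* b₁)) :+ 96 · (b₁ :* b₂) :- 24 · (b₁ :* b₃) :- κ₂ :* (b₂ :* b₂))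
    :+ p :* p :* (:- (2 · (κ₃ :* (b₁ :* b₁ :* b₁))) :+ κ₂ :* (b₁ :* b₁ :* b₂) :- 2 · (κ₃ :* b₁₂) :+ κ₃ :* b₂₂)
    :- p :* p :* p :* (κ₂₄ :* (b₁ :* b₁ :* b₁ :* b₁) :+ κ₃ :* (b₁ :* b₁₂))

  rhsPoly′ : ∀ {k} → (p b₁ b₂ b₃ b₄ b₁₂ b₂₂ : Polynomial k) → Polynomial k
  rhsPoly′ = rhsPoly (con (+ 12)) (con (+ 8)) (con (+ 1))

  bs : Vec ℚ 7
  bs = P ∷ Bbar p 1 ∷ Bbar p 2 ∷ Bbar p 3 ∷ Bbar p 4 ∷ Bbar2 p 1 ∷ Bbar2 p 2 ∷ []

  -- The reciprocals of 2, 3, 24 enter as unknowns, since only integer constants are allowed; their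
  -- products with 24 are then computed.
  24*rhs : ℕ→ℚ 24 * rhs p ≡ ⟦ rhsPoly′ (var (# 0)) (var (# 1)) (var (# 2)) (var (# 3)) (var (# 4)) (var (# 5)) (var (# 6)) ⟧ bs
  24*rhs = solve 10 (λ p b₁ b₂ b₃ b₄ b₁₂ b₂₂ i₂ i₃ i₂₄ →
    con (+ 24) :* ((:- (con (+ 4) :* b₁) :+ con (+ 6) :* b₂ :- con (+ 4) :* b₃ :+ b₄)
        :+ p :* (:- (con (+ 3) :* b₁ :* b₁) :+ con (+ 4) :* b₁ :* b₂ :- b₁ :* b₃ :- i₂ :* b₂ :* b₂)
        :+ p :* p :* (:- (con (+ 2) :* i₃ :* b₁ :* b₁ :* b₁) :+ i₂ :* b₁ :* b₁ :* b₂ :- con (+ 2) :* i₃ :* b₁₂ :+ i₃ :* b₂₂)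
        :- p :* p :* p :* (i₂₄ :* b₁ :* b₁ :* b₁ :* b₁ :+ i₃ :* b₁ :* b₁₂))
    := rhsPoly (24 · i₂) (24 · i₃) (24 · i₂₄) p b₁ b₂ b₃ b₄ b₁₂ b₂₂) refl
    P (Bbar p 1) (Bbar p 2) (Bbar p 3) (Bbar p 4) (Bbar2 p 1) (Bbar2 p 2) (inv 2) (inv 3) (inv 24)

  bs′ : Vec ℚ 7
  bs′ = P ∷ ⟦ bP 0 ⟧ ρ ∷ ⟦ bP 1 ⟧ ρ ∷ ⟦ bP 2 ⟧ ρ ∷ ⟦ bP 3 ⟧ ρ ∷ ⟦ gP 0 ⟧ ρ ∷ ⟦ gP 1 ⟧ ρ ∷ []

  bs≈bs′ : ∀ i → lookup bs i ≈ lookup bs′ i [mod 4 ]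
  bs≈bs′ fz                                    = ≈-refl
  bs≈bs′ (fs fz)                               = Bbar≈ 0 (s≤s z≤n)
  bs≈bs′ (fs (fs fz))                          = Bbar≈ 1 (s≤s (s≤s z≤n))
  bs≈bs′ (fs (fs (fs fz)))                     = Bbar≈ 2 (s≤s (s≤s (s≤s z≤n)))
  bs≈bs′ (fs (fs (fs (fs fz))))                = Bbar≈ 3 (s≤s (s≤s (s≤s (s≤s z≤n))))
  bs≈bs′ (fs (fs (fs (fs (fs fz)))))           = ≡⇒≈ (trans (Bbar2≡g 0) (trans (sym (6* (g 0)))
    (solve 3 (λ γ p η → con (+ 6) :* γ := con (+ 6) :* (γ :+ con (+ 0) :* (p :* η))) refl (inv 6 * g 0) P (inv 6 * h))))
  bs≈bs′ (fs (fs (fs (fs (fs (fs fz))))))      = ≡⇒≈ (trans (Bbar2≡g 1) (trans (proj₁ (proj₂ (proj₂ h-exact)))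
    (trans (cong₂ (λ x y → x + P * y) (sym (6* (g 0))) (sym (6* h)))
    (solve 3 (λ γ p η → con (+ 6) :* γ :+ p :* (con (+ 6) :* η) := con (+ 6) :* (γ :+ con (+ 1) :* (p :* η))) refl (inv 6 * g 0) P (inv 6 * h)))))

  bs′-integral : All Integral bs′
  bs′-integral = P-integral ∷ ⟦ bP 0 ⟧-integral iρ ∷ ⟦ bP 1 ⟧-integral iρ ∷ ⟦ bP 2 ⟧-integral iρ ∷ ⟦ bP 3 ⟧-integral iρ
    ∷ ⟦ gP 0 ⟧-integral iρ ∷ ⟦ gP 1 ⟧-integral iρ ∷ []
    where
    iρ : All Integral ρ
    iρ = P-integral ∷ ρ-integral

  -- 24 (1 - exp(p c)) / p, truncated after the fourth power.
  expPoly : ∀ {k} → Polynomial k → Polynomial k → Polynomial k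
  expPoly p c = :- (24 · c) :- 12 · (p :* (c :* c)) :- 4 · (p :* p :* (c :* c :* c)) :- p :* p :* p :* (c :* c :* c :* c)

  -- log(1 - p W) / p
  c₀ : Polynomial 7
  c₀ = 12 · r₁ :- 6 · (p′ :* r₂) :+ 4 · (p′ :* p′ :* r₃) :- 3 · (p′ :* p′ :* p′ :* r₄)

  log-W≈c₀ : log (- W p) ≈ ⟦ 12 · c₀ ⟧ ρ [mod 4 ]
  log-W≈c₀ = ≈-cancelˡ-ℕ p-1 p∤p∸1 (subst (ℕ→ℚ p-1 * log (- W p) ≈_[mod 4 ]) total log-W)
    where
    open ≡-Reasoning
    M : ℕ → ℚ
    M i = ℕ→ℚ 12 * ((P - 1ℚ) * r i)
    k₁ k₂ k₃ k₄ : ℚ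
    k₁ = ℕ→ℚ 12
    k₂ = - (ℕ→ℚ 6 * P)
    k₃ = ℕ→ℚ 4 * (P * P)
    k₄ = - (ℕ→ℚ 3 * (P * P * P))
    total : Σ< p-1 (log ∘ q) ≡ ℕ→ℚ p-1 * ⟦ 12 · c₀ ⟧ ρ
    total = begin
      Σ< p-1 (log ∘ q)
        ≡⟨ Σ-congˡ p-1 (λ i → trans (log≡ (q i)) (solve 2 (λ p y → logPoly p y := con (+ 0) :+ con (+ 12) :* (y :* con (+ 1)) :+ (:- (con (+ 6) :* p)) :* (y :* (y :* con (+ 1)))
             :+ con (+ 4) :* (p :* p) :* (y :* (y :* (y :* con (+ 1)))) :+ (:- (con (+ 3) :* (p :* p :* p))) :* (y :* (y :* (y :* (y :* con (+ 1)))))) refl P (q i))) ⟩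
      Σ< p-1 (λ i → 0ℚ + k₁ * q i ^ 1 + k₂ * q i ^ 2 + k₃ * q i ^ 3 + k₄ * q i ^ 4)
        ≡⟨ Σ-quartic p-1 q 0ℚ k₁ k₂ k₃ k₄ ⟩
      ℕ→ℚ p-1 * 0ℚ + k₁ * moment 1 + k₂ * moment 2 + k₃ * moment 3 + k₄ * moment 4
        ≡⟨ cong₂ (λ x y → ℕ→ℚ p-1 * 0ℚ + k₁ * x + k₂ * y + k₃ * moment 3 + k₄ * moment 4) (moment≡ 1) (moment≡ 2) ⟩
      ℕ→ℚ p-1 * 0ℚ + k₁ * M 1 + k₂ * M 2 + k₃ * moment 3 + k₄ * moment 4
        ≡⟨ cong₂ (λ x y → ℕ→ℚ p-1 * 0ℚ + k₁ * M 1 + k₂ * M 2 + k₃ * x + k₄ * y) (moment≡ 3) (moment≡ 4) ⟩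
      ℕ→ℚ p-1 * 0ℚ + k₁ * M 1 + k₂ * M 2 + k₃ * M 3 + k₄ * M 4
        ≡⟨ solve 6 (λ p-1 p x y z w → p-1 :* con (+ 0)
             :+ con (+ 12) :* (con (+ 12) :* ((p :- con (+ 1)) :* x))
             :+ (:- (con (+ 6) :* p)) :* (con (+ 12) :* ((p :- con (+ 1)) :* y))
             :+ con (+ 4) :* (p :* p) :* (con (+ 12) :* ((p :- con (+ 1)) :* z))
             :+ (:- (con (+ 3) :* (p :* p :* p))) :* (con (+ 12) :* ((p :- con (+ 1)) :* w))
             := (p :- con (+ 1)) :* (con (+ 12) :* (con (+ 12) :* x :- con (+ 6) :* (p :* y) :+ con (+ 4) :* (p :* p :* z) :- con (+ 3) :* (p :* p :* p :* w))))
             refl (ℕ→ℚ p-1) P (r 1) (r 2) (r 3) (r 4) ⟩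
      (P - 1ℚ) * ⟦ 12 · c₀ ⟧ ρ
        ≡⟨ cong (_* ⟦ 12 · c₀ ⟧ ρ) p-1∸ ⟨
      ℕ→ℚ p-1 * ⟦ 12 · c₀ ⟧ ρ ∎

  -- The truncated exponential inverts the truncated logarithm modulo p^4, and `c₀` is the logarithm
  -- of 1 - pW divided by p.
  24W≈ : ℕ→ℚ 24 * W p ≈ ⟦ expPoly p′ c₀ ⟧ ρ [mod 4 ]
  24W≈ = ≈-trans (≡⇒≈ 24W≡) (≈-trans (≈-sym (solveMod 4 (expPoly p′ logω) (:- (24 · (12 · ω′))) (ω-integral ∷ [])))
    (⟦⟧-≈ (expPoly p′ (var (# 1))) {P ∷ ⟦ logω ⟧ (P ∷ ω ∷ []) ∷ []} {P ∷ ⟦ c₀ ⟧ ρ ∷ []}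
      (P-integral ∷ ⟦ c₀ ⟧-integral (P-integral ∷ ρ-integral) ∷ [])
      λ { fz → ≈-refl ; (fs fz) → logω≈c₀ }))
    where
    ω : ℚ
    -- With -W = 12ω the series log(1 + 12pω)/p has the integer coefficients 12^k/k, namely 12, 72,
    -- 576, 5184 up to sign.
    ω = inv 12 * - W p
    12* : ∀ x → ℕ→ℚ 12 * (inv 12 * x) ≡ x
    12* x = trans (sym (*-assoc (ℕ→ℚ 12) (inv 12) x)) (*-identityˡ x)
    p∤12 : ¬ p ∣ 12
    p∤12 = ∤-* {3} {4} (∤-<7 3 {s≤s (s≤s (s≤s z≤n))}) (∤-<7 4 {s≤s (s≤s (s≤s (s≤s z≤n)))})
    ω-integral : Integral ω
    ω-integral = *-integral (inv-integral p∤12) (neg-integral W-integral)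
    ω′ logω : Polynomial 2
    ω′ = var (# 1)
    logω = 12 · ω′ :- 72 · (p′ :* ω′ :* ω′) :+ 576 · (p′ :* p′ :* ω′ :* ω′ :* ω′) :- 5184 · (p′ :* p′ :* p′ :* ω′ :* ω′ :* ω′ :* ω′)
    24W≡ : ℕ→ℚ 24 * W p ≡ - (ℕ→ℚ 24 * (ℕ→ℚ 12 * ω))
    24W≡ = trans (solve 1 (λ w → con (+ 24) :* w := :- (con (+ 24) :* (:- w))) refl (W p)) (cong (λ z → - (ℕ→ℚ 24 * z)) (sym (12* (- W p))))
    logω≈c₀ : ⟦ logω ⟧ (P ∷ ω ∷ []) ≈ ⟦ c₀ ⟧ ρ [mod 4 ]
    logω≈c₀ = ≈-cancelˡ-ℕ 12 p∤12 (≈-trans (≡⇒≈ (trans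
      (prove (P ∷ ω ∷ []) (12 · logω) (logPoly p′ (12 · ω′)) refl)
      (trans (sym (log≡ (ℕ→ℚ 12 * ω))) (cong log (12* (- W p)))))) log-W≈c₀)

  -- Here the coefficients of the formula are verified: in the common coordinates both sides are
  -- integer polynomials, and their difference has no terms below p^4.
  W≈rhs : W p ≈ rhs p [mod 4 ]
  W≈rhs = ≈-cancelˡ-ℕ 24 p∤24 (≈-trans 24W≈ (≈-sym (≈-trans (≡⇒≈ 24*rhs)
    (≈-trans (⟦⟧-≈ (rhsPoly′ (var (# 0)) (var (# 1)) (var (# 2)) (var (# 3)) (var (# 4)) (var (# 5)) (var (# 6))) {bs} {bs′} bs′-integral bs≈bs′)
      (≈-sym (solveMod 4 (expPoly p′ c₀) (rhsPoly′ p′ (bP 0) (bP 1) (bP 2) (bP 3) (gP 0) (gP 1)) ρ-integral))))))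
    where
    p∤24 : ¬ p ∣ 24
    p∤24 = ∤-* {4} {6} (∤-<7 4 {s≤s (s≤s (s≤s (s≤s z≤n)))}) (∤-<7 6 {ℕₚ.≤-refl})

theorem1p3 : (p : ℕ) → Prime p → 7 ≤ p → W p ≡ rhs p [modℚ p ^ 4 ]
theorem1p3 p p-prime 7≤p = ≈⇒modℚ 4 (W p) (rhs p) W≈rhs
  where open Padic p p-prime 7≤p
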